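{- Let $k\geq 3$ and $\beta\geq 2$ be fixed integers. There exist constants $C=C(k,\beta)>0$, $n_0=n_0(k,\beta)$ and $\delta^*=\delta^*(k,\beta)>0$ such that the following holds for every integer $n\geq n_0$ and every real $\delta$ with $0\leq\delta\leq\delta^*$. If $H$ is a $k$-graph with vertex set $[n]$ satisfying $\mu(H)\leq\beta$ and $$\rho(H)\geq(1-\delta)\,\rho(S_{n,k,\beta}),$$ then there exists a set $W\subseteq[n]$ with $|W|=\beta$ such that every edge of $H$ intersects $W$, and, after relabeling the vertices of $H$ so that $W$ becomes $[\beta]$ (that is, for some permutation $\sigma$ of $[n]$ with $\sigma(W)=[\beta]$, replacing $E(H)$ by $\{\sigma(e):e\in E(H)\}$), we have $$\left|E(H)\,\triangle\, E(S_{n,k,\beta})\right|\leq C\,\delta\, n^{k-1}.$$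
   Context: Write $[n]=\{1,\ldots,n\}$. A $k$-uniform hypergraph ($k$-graph) $H=(V(H),E(H))$ has a vertex set $V(H)$ and an edge set $E(H)$ consisting of $k$-element subsets of $V(H)$. A matching in $H$ is a collection of pairwise disjoint edges, and the matching number $\mu(H)$ is the maximum size of a matching in $H$. For sets $A,B$, $A\triangle B=(A\setminus B)\cup(B\setminus A)$. $S_{n,k,\beta}$ is the $k$-graph on vertex set $[n]$ whose edges are all $k$-subsets $e$ of $[n]$ with $e\cap[\beta]\neq\emptyset$. The adjacency tensor of a $k$-graph $H$ on $[n]$ is $\mathcal{A}(H)=(a_{i_1\cdots i_k})$, indexed by $(i_1,\ldots,i_k)\in[n]^k$, where $a_{i_1\cdots i_k}=\frac{1}{(k-1)!}$ if $\{i_1,\ldots,i_k\}\in E(H)$ and $a_{i_1\cdots i_k}=0$ otherwise. A number $\lambda\in\mathbb{C}$ is an eigenvalue of a tensor $\mathcal{A}=(a_{i_1\cdots i_k})$ of order $k$ and dimension $n$ if there is a nonzero vector $x\in\mathbb{C}^n$ (an eigenvector) with $\sum_{i_2,\ldots,i_k\in[n]}a_{i i_2\cdots i_k}x_{i_2}\cdots x_{i_k}=\lambda x_i^{k-1}$ for every $i\in[n]$. The spectral radius of a tensor is the maximum modulus of its eigenvalues, and $\rho(H)$ denotes the spectral radius of $\mathcal{A}(H)$. -}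

module Defs where

open import Algebra.Bundles.Raw using (RawSemiring)
import Algebra.Definitions.RawSemiring
open import Data.Bool.Base using (if_then_else_)
import Data.Bool.Properties as Bool
open import Data.Empty using (⊥)
open import Data.Fin.Base using (Fin; toℕ)
open import Data.Fin.Permutation using (Permutation′; _⟨$⟩ˡ_)
open import Data.Fin.Subset using (Subset; inside; outside; ⁅_⁆; ⋃; _∩_; ∣_∣; Nonempty; Empty)
open import Data.Fin.Subset.Properties using (nonempty?; anySubset?)
open import Data.Integer.Base using (+_)
open import Data.List.Base as List using (List; []; _∷_; _++_; filter; length)
open import Data.List.Relation.Unary.All using (All)
open import Data.List.Relation.Unary.AllPairs using (AllPairs)
open import Data.List.Relation.Unary.Unique.Propositional using (Unique)
open import Data.Nat.Base as ℕ using (ℕ; zero; suc; _∸_; _!; _<ᵇ_)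
import Data.Nat.Properties as ℕ
open import Data.Product.Base using (∃; _×_; _,_; proj₁; proj₂)
open import Data.Rational.Base as ℚ using (ℚ; 0ℚ; 1ℚ; ½)
import Data.Rational.Properties as ℚ
open import Data.Rational.Solver using (module +-*-Solver)
open import Data.Sum.Base using (_⊎_)
open import Data.Vec.Base as Vec using (Vec; []; _∷_; tabulate; lookup; toList)
open import Data.Vec.Functional using (Vector)
open import Data.Vec.Properties using (≡-dec)
open import Level using (0ℓ)
open import Relation.Binary.PropositionalEquality.Core using (_≡_; refl; sym; trans; cong; cong₂; subst)
open import Relation.Nullary.Decidable.Core using (does; _×-dec_; _⊎-dec_; ¬?)
open import Relation.Nullary.Negation.Core using (¬_)
open import Relation.Unary using (Pred; Decidable)

------------------------------------------------------------------------
-- Real numbers: Cauchy sequences of rationals with a modulus of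
-- convergence, considered up to _≈ℝ_.

IsCauchy : (ℕ → ℚ) → Set
IsCauchy a = ∀ ε → 0ℚ ℚ.< ε → ∃ λ N → ∀ m n → N ℕ.≤ m → N ℕ.≤ n → ℚ.∣ a m ℚ.- a n ∣ ℚ.< ε

record ℝ : Set where
  constructor mkℝ
  field
    seq    : ℕ → ℚ
    cauchy : IsCauchy seq

open ℝ public

abstract

  private

    add-sub : ∀ x y → x ≡ y ℚ.+ (x ℚ.- y)
    add-sub = solve 2 (λ x y → x := y :+ (x :- y)) refl
      where open +-*-Solver

    neg-sub : ∀ x y → ℚ.- (x ℚ.- y) ≡ ℚ.- x ℚ.- ℚ.- y
    neg-sub = solve 2 (λ x y → :- (x :- y) := (:- x) :- (:- y)) refl
      where open +-*-Solver

    sum-sub : ∀ x y z w → (x ℚ.+ y) ℚ.- (z ℚ.+ w) ≡ (x ℚ.- z) ℚ.+ (y ℚ.- w)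
    sum-sub = solve 4 (λ x y z w → (x :+ y) :- (z :+ w) := (x :- z) :+ (y :- w)) refl
      where open +-*-Solver

    prod-sub : ∀ x y z w → x ℚ.* y ℚ.- z ℚ.* w ≡ x ℚ.* (y ℚ.- w) ℚ.+ w ℚ.* (x ℚ.- z)
    prod-sub = solve 4 (λ x y z w → x :* y :- z :* w := x :* (y :- w) :+ w :* (x :- z)) refl
      where open +-*-Solver

    half-half : ∀ p → ½ ℚ.* p ℚ.+ ½ ℚ.* p ≡ p
    half-half p = trans (sym (ℚ.*-distribʳ-+ p ½ ½)) (ℚ.*-identityˡ p)

    half-pos : ∀ {p} → 0ℚ ℚ.< p → 0ℚ ℚ.< ½ ℚ.* p
    half-pos {p} 0<p = subst (ℚ._< ½ ℚ.* p) (ℚ.*-zeroʳ ½) (ℚ.*-monoʳ-<-pos ½ 0<p)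

    bounded : ∀ {a} → IsCauchy a →
              ∃ λ B → 0ℚ ℚ.< B × ∃ λ N → ∀ n → N ℕ.≤ n → ℚ.∣ a n ∣ ℚ.≤ B
    bounded {a} ca with ca 1ℚ (ℚ.positive⁻¹ 1ℚ)
    ... | N , close = ℚ.∣ a N ∣ ℚ.+ 1ℚ
                    , ℚ.+-mono-≤-< (ℚ.0≤∣p∣ (a N)) (ℚ.positive⁻¹ 1ℚ)
                    , N
                    , bound
      where
      open ℚ.≤-Reasoning
      bound : ∀ n → N ℕ.≤ n → ℚ.∣ a n ∣ ℚ.≤ ℚ.∣ a N ∣ ℚ.+ 1ℚ
      bound n N≤n = begin
        ℚ.∣ a n ∣
          ≡⟨ cong ℚ.∣_∣ (add-sub (a n) (a N)) ⟩
        ℚ.∣ a N ℚ.+ (a n ℚ.- a N) ∣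
          ≤⟨ ℚ.∣p+q∣≤∣p∣+∣q∣ (a N) (a n ℚ.- a N) ⟩
        ℚ.∣ a N ∣ ℚ.+ ℚ.∣ a n ℚ.- a N ∣
          ≤⟨ ℚ.+-monoʳ-≤ ℚ.∣ a N ∣ (ℚ.<⇒≤ (close n N N≤n ℕ.≤-refl)) ⟩
        ℚ.∣ a N ∣ ℚ.+ 1ℚ ∎

  const-cauchy : ∀ q → IsCauchy (λ _ → q)
  const-cauchy q ε 0<ε =
    0 , λ _ _ _ _ → subst (ℚ._< ε) (sym (cong ℚ.∣_∣ (ℚ.+-inverseʳ q))) 0<ε

  neg-cauchy : ∀ {a} → IsCauchy a → IsCauchy (λ n → ℚ.- a n)
  neg-cauchy {a} ca ε 0<ε with ca ε 0<ε
  ... | N , close = N , λ m n N≤m N≤n →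
    subst (ℚ._< ε) (eq (a m) (a n)) (close m n N≤m N≤n)
    where
    eq : ∀ x y → ℚ.∣ x ℚ.- y ∣ ≡ ℚ.∣ ℚ.- x ℚ.- ℚ.- y ∣
    eq x y = trans (sym (ℚ.∣-p∣≡∣p∣ (x ℚ.- y)))
      (cong ℚ.∣_∣ (neg-sub x y))

  +-cauchy : ∀ {a b} → IsCauchy a → IsCauchy b → IsCauchy (λ n → a n ℚ.+ b n)
  +-cauchy {a} {b} ca cb ε 0<ε with ca (½ ℚ.* ε) (half-pos 0<ε) | cb (½ ℚ.* ε) (half-pos 0<ε)
  ... | N , closeA | M , closeB = N ℕ.⊔ M , close
    where
    open ℚ.≤-Reasoning
    close : ∀ m n → N ℕ.⊔ M ℕ.≤ m → N ℕ.⊔ M ℕ.≤ n →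
            ℚ.∣ (a m ℚ.+ b m) ℚ.- (a n ℚ.+ b n) ∣ ℚ.< ε
    close m n p q = begin-strict
      ℚ.∣ (a m ℚ.+ b m) ℚ.- (a n ℚ.+ b n) ∣
        ≡⟨ cong ℚ.∣_∣ (sum-sub (a m) (b m) (a n) (b n)) ⟩
      ℚ.∣ (a m ℚ.- a n) ℚ.+ (b m ℚ.- b n) ∣
        ≤⟨ ℚ.∣p+q∣≤∣p∣+∣q∣ (a m ℚ.- a n) (b m ℚ.- b n) ⟩
      ℚ.∣ a m ℚ.- a n ∣ ℚ.+ ℚ.∣ b m ℚ.- b n ∣
        <⟨ ℚ.+-mono-< (closeA m n (ℕ.m⊔n≤o⇒m≤o N M p) (ℕ.m⊔n≤o⇒m≤o N M q))
                      (closeB m n (ℕ.m⊔n≤o⇒n≤o N M p) (ℕ.m⊔n≤o⇒n≤o N M q)) ⟩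
      ½ ℚ.* ε ℚ.+ ½ ℚ.* ε
        ≡⟨ half-half ε ⟩
      ε ∎

  private

    divide : ∀ M ε → 0ℚ ℚ.< M → 0ℚ ℚ.< ε → ∃ λ η → 0ℚ ℚ.< η × M ℚ.* η ≡ ε
    divide M ε 0<M 0<ε = (ℚ.1/ M) ℚ.* ε , 0<η , Mη
      where
      instance
        M-pos : ℚ.Positive M
        M-pos = ℚ.positive 0<M

        M-nonZero : ℚ.NonZero M
        M-nonZero = ℚ.pos⇒nonZero M

        1/M-pos : ℚ.Positive (ℚ.1/ M)
        1/M-pos = ℚ.1/pos⇒pos M

      0<η : 0ℚ ℚ.< (ℚ.1/ M) ℚ.* ε
      0<η = subst (ℚ._< (ℚ.1/ M) ℚ.* ε) (ℚ.*-zeroʳ (ℚ.1/ M)) (ℚ.*-monoʳ-<-pos (ℚ.1/ M) 0<ε)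

      Mη : M ℚ.* ((ℚ.1/ M) ℚ.* ε) ≡ ε
      Mη = trans (sym (ℚ.*-assoc M (ℚ.1/ M) ε))
          (trans (cong (ℚ._* ε) (ℚ.*-inverseʳ M)) (ℚ.*-identityˡ ε))

    prod-small : ∀ M η p q → 0ℚ ℚ.< M → ℚ.∣ p ∣ ℚ.≤ M → ℚ.∣ q ∣ ℚ.< η → ℚ.∣ p ℚ.* q ∣ ℚ.< M ℚ.* η
    prod-small M η p q 0<M p≤M q<η = begin-strict
      ℚ.∣ p ℚ.* q ∣          ≡⟨ ℚ.∣p*q∣≡∣p∣*∣q∣ p q ⟩
      ℚ.∣ p ∣ ℚ.* ℚ.∣ q ∣    ≤⟨ ℚ.*-monoʳ-≤-nonNeg ℚ.∣ q ∣ {{ℚ.nonNegative (ℚ.0≤∣p∣ q)}} p≤M ⟩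
      M ℚ.* ℚ.∣ q ∣          <⟨ ℚ.*-monoʳ-<-pos M {{ℚ.positive 0<M}} q<η ⟩
      M ℚ.* η                ∎
      where open ℚ.≤-Reasoning

    prod-close : ∀ A B α β x y z w → 0ℚ ℚ.< A → 0ℚ ℚ.< B → ℚ.∣ x ∣ ℚ.≤ A → ℚ.∣ w ∣ ℚ.≤ B →
                 ℚ.∣ y ℚ.- w ∣ ℚ.< α → ℚ.∣ x ℚ.- z ∣ ℚ.< β →
                 ℚ.∣ x ℚ.* y ℚ.- z ℚ.* w ∣ ℚ.< A ℚ.* α ℚ.+ B ℚ.* β
    prod-close A B α β x y z w 0<A 0<B x≤A w≤B dy dx = begin-strict
      ℚ.∣ x ℚ.* y ℚ.- z ℚ.* w ∣
        ≡⟨ cong ℚ.∣_∣ (prod-sub x y z w) ⟩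
      ℚ.∣ x ℚ.* (y ℚ.- w) ℚ.+ w ℚ.* (x ℚ.- z) ∣
        ≤⟨ ℚ.∣p+q∣≤∣p∣+∣q∣ (x ℚ.* (y ℚ.- w)) (w ℚ.* (x ℚ.- z)) ⟩
      ℚ.∣ x ℚ.* (y ℚ.- w) ∣ ℚ.+ ℚ.∣ w ℚ.* (x ℚ.- z) ∣
        <⟨ ℚ.+-mono-< (prod-small A α x (y ℚ.- w) 0<A x≤A dy) (prod-small B β w (x ℚ.- z) 0<B w≤B dx) ⟩
      A ℚ.* α ℚ.+ B ℚ.* β ∎
      where open ℚ.≤-Reasoning

    prod-modulus :
      ∀ (a b : ℕ → ℚ) A B α β N₁ N₂ N₃ N₄ → 0ℚ ℚ.< A → 0ℚ ℚ.< B →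
      (∀ n → N₁ ℕ.≤ n → ℚ.∣ a n ∣ ℚ.≤ A) →
      (∀ n → N₂ ℕ.≤ n → ℚ.∣ b n ∣ ℚ.≤ B) →
      (∀ m n → N₃ ℕ.≤ m → N₃ ℕ.≤ n → ℚ.∣ b m ℚ.- b n ∣ ℚ.< α) →
      (∀ m n → N₄ ℕ.≤ m → N₄ ℕ.≤ n → ℚ.∣ a m ℚ.- a n ∣ ℚ.< β) →
      ∃ λ N → ∀ m n → N ℕ.≤ m → N ℕ.≤ n →
        ℚ.∣ a m ℚ.* b m ℚ.- a n ℚ.* b n ∣ ℚ.< A ℚ.* α ℚ.+ B ℚ.* β
    prod-modulus a b A B α β N₁ N₂ N₃ N₄ 0<A 0<B boundA boundB closeB closeA =
      L ℕ.⊔ R , λ m n p q →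
        prod-close A B α β (a m) (b m) (a n) (b n) 0<A 0<B
          (boundA m (ℕ.m⊔n≤o⇒m≤o N₁ N₂ (left p)))
          (boundB n (ℕ.m⊔n≤o⇒n≤o N₁ N₂ (left q)))
          (closeB m n (ℕ.m⊔n≤o⇒m≤o N₃ N₄ (right p)) (ℕ.m⊔n≤o⇒m≤o N₃ N₄ (right q)))
          (closeA m n (ℕ.m⊔n≤o⇒n≤o N₃ N₄ (right p)) (ℕ.m⊔n≤o⇒n≤o N₃ N₄ (right q)))
      where
      L R : ℕ
      L = N₁ ℕ.⊔ N₂
      R = N₃ ℕ.⊔ N₄

      left : ∀ {o} → L ℕ.⊔ R ℕ.≤ o → L ℕ.≤ o
      left = ℕ.m⊔n≤o⇒m≤o L R

      right : ∀ {o} → L ℕ.⊔ R ℕ.≤ o → R ℕ.≤ o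
      right = ℕ.m⊔n≤o⇒n≤o L R

  *-cauchy : ∀ {a b} → IsCauchy a → IsCauchy b → IsCauchy (λ n → a n ℚ.* b n)
  *-cauchy {a} {b} ca cb ε 0<ε = from (bounded {a} ca) (bounded {b} cb)
    where
    Bounded : (ℕ → ℚ) → Set
    Bounded c = ∃ λ B → 0ℚ ℚ.< B × ∃ λ N → ∀ n → N ℕ.≤ n → ℚ.∣ c n ∣ ℚ.≤ B

    Goal : ℚ → Set
    Goal e = ∃ λ N → ∀ m n → N ℕ.≤ m → N ℕ.≤ n → ℚ.∣ a m ℚ.* b m ℚ.- a n ℚ.* b n ∣ ℚ.< e

    from : Bounded a → Bounded b → Goal ε
    from (A , 0<A , N₁ , boundA) (B , 0<B , N₂ , boundB) =
      split (divide A (½ ℚ.* ε) 0<A (half-pos 0<ε)) (divide B (½ ℚ.* ε) 0<B (half-pos 0<ε))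
      where
      split : (∃ λ α → 0ℚ ℚ.< α × A ℚ.* α ≡ ½ ℚ.* ε) →
              (∃ λ β → 0ℚ ℚ.< β × B ℚ.* β ≡ ½ ℚ.* ε) → Goal ε
      split (α , 0<α , Aα) (β , 0<β , Bβ) =
        subst Goal (trans (cong₂ ℚ._+_ Aα Bβ) (half-half ε))
          (prod-modulus a b A B α β N₁ N₂ (proj₁ (cb α 0<α)) (proj₁ (ca β 0<β)) 0<A 0<B
            boundA boundB (proj₂ (cb α 0<α)) (proj₂ (ca β 0<β)))

infix  4 _≈ℝ_ _≤ℝ_ _<ℝ_
infixl 6 _+ℝ_ _-ℝ_
infixl 7 _*ℝ_
infix  8 -ℝ_

fromℚ : ℚ → ℝ
fromℚ q = mkℝ (λ _ → q) (const-cauchy q)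

fromℕ : ℕ → ℝ
fromℕ n = fromℚ (+ n ℚ./ 1)

0ℝ 1ℝ : ℝ
0ℝ = fromℚ 0ℚ
1ℝ = fromℚ 1ℚ

_+ℝ_ _*ℝ_ : ℝ → ℝ → ℝ
x +ℝ y = mkℝ (λ n → seq x n ℚ.+ seq y n) (+-cauchy {seq x} {seq y} (cauchy x) (cauchy y))
x *ℝ y = mkℝ (λ n → seq x n ℚ.* seq y n) (*-cauchy {seq x} {seq y} (cauchy x) (cauchy y))

-ℝ_ : ℝ → ℝ
-ℝ x = mkℝ (λ n → ℚ.- seq x n) (neg-cauchy {seq x} (cauchy x))

_-ℝ_ : ℝ → ℝ → ℝ
x -ℝ y = x +ℝ (-ℝ y)

_≈ℝ_ _≤ℝ_ _<ℝ_ : ℝ → ℝ → Set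
x ≈ℝ y = ∀ ε → 0ℚ ℚ.< ε → ∃ λ N → ∀ n → N ℕ.≤ n → ℚ.∣ seq x n ℚ.- seq y n ∣ ℚ.< ε
x ≤ℝ y = ∀ ε → 0ℚ ℚ.< ε → ∃ λ N → ∀ n → N ℕ.≤ n → seq x n ℚ.≤ seq y n ℚ.+ ε
x <ℝ y = ∃ λ ε → 0ℚ ℚ.< ε × ∃ λ N → ∀ n → N ℕ.≤ n → seq x n ℚ.+ ε ℚ.≤ seq y n

------------------------------------------------------------------------
-- Complex numbers

infix  4 _≈ℂ_
infixl 6 _+ℂ_
infixl 7 _*ℂ_

record ℂ : Set where
  constructor _+i_
  field
    re im : ℝ

open ℂ public

fromℝ : ℝ → ℂ
fromℝ x = x +i 0ℝ

0ℂ 1ℂ : ℂ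
0ℂ = fromℝ 0ℝ
1ℂ = fromℝ 1ℝ

_+ℂ_ _*ℂ_ : ℂ → ℂ → ℂ
z +ℂ w = (re z +ℝ re w) +i (im z +ℝ im w)
z *ℂ w = (re z *ℝ re w -ℝ im z *ℝ im w) +i (re z *ℝ im w +ℝ im z *ℝ re w)

_≈ℂ_ : ℂ → ℂ → Set
z ≈ℂ w = re z ≈ℝ re w × im z ≈ℝ im w

-- The real number r is ∣z∣.
IsModulus : ℂ → ℝ → Set
IsModulus z r = 0ℝ ≤ℝ r × r *ℝ r ≈ℝ re z *ℝ re z +ℝ im z *ℝ im z

ℂ-rawSemiring : RawSemiring 0ℓ 0ℓ
ℂ-rawSemiring = record
  { Carrier = ℂ
  ; _≈_     = _≈ℂ_
  ; _+_     = _+ℂ_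
  ; _*_     = _*ℂ_
  ; 0#      = 0ℂ
  ; 1#      = 1ℂ
  }

module ℂ-Ops = Algebra.Definitions.RawSemiring ℂ-rawSemiring

------------------------------------------------------------------------
-- Tensors and their eigenvalues

Tensor : (k n : ℕ) → Set
Tensor k n = Vec (Fin n) k → ℂ

-- The sum of f over all of [n]^m.
sumTuples : ∀ m {n} → (Vec (Fin n) m → ℂ) → ℂ
sumTuples zero    f = f []
sumTuples (suc m) f = ℂ-Ops.sum (λ i → sumTuples m (λ is → f (i ∷ is)))

-- The eigenvalue equation involves the entries indexed by (i, i₂, …, iₖ)
-- and the power k − 1, so it only makes sense for order k ≥ 1.
IsEigenpair : ∀ {k n} → Tensor k n → ℂ → Vector ℂ n → Set
IsEigenpair {zero}  𝒜 l x = ⊥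
IsEigenpair {suc m} 𝒜 l x =
  (¬ (∀ i → x i ≈ℂ 0ℂ)) ×
  (∀ i → sumTuples m (λ is → 𝒜 (i ∷ is) *ℂ ℂ-Ops.product (λ j → x (lookup is j)))
         ≈ℂ l *ℂ (x i ℂ-Ops.^ m))

IsEigenvalue : ∀ {k n} → Tensor k n → ℂ → Set
IsEigenvalue 𝒜 l = ∃ λ x → IsEigenpair 𝒜 l x

IsSpectralRadius : ∀ {k n} → Tensor k n → ℝ → Set
IsSpectralRadius 𝒜 ρ =
  (∃ λ l → IsEigenvalue 𝒜 l × IsModulus l ρ) ×
  (∀ l r → IsEigenvalue 𝒜 l → IsModulus l r → r ≤ℝ ρ)

------------------------------------------------------------------------
-- Hypergraphs on [n], where [n] is represented by Fin n, so that the
-- vertex i ∈ {1, …, n} corresponds to the element of Fin n with toℕ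
-- equal to i − 1

infix 4 _∈ₛ_

record SetFamily (n : ℕ) : Set₁ where
  field
    Member  : Pred (Subset n) 0ℓ
    member? : Decidable Member

open SetFamily public

_∈ₛ_ : ∀ {n} → Subset n → SetFamily n → Set
e ∈ₛ F = Member F e

record Hypergraph (k n : ℕ) : Set₁ where
  field
    E       : SetFamily n
    uniform : ∀ {e} → e ∈ₛ E → ∣ e ∣ ≡ k

open Hypergraph public

allSubsets : ∀ n → List (Subset n)
allSubsets zero    = [] ∷ []
allSubsets (suc n) =
  List.map (outside ∷_) (allSubsets n) ++ List.map (inside ∷_) (allSubsets n)

card : ∀ {n} → SetFamily n → ℕ
card {n} F = length (filter (member? F) (allSubsets n))

_△_ : ∀ {n} → SetFamily n → SetFamily n → SetFamily n
F △ G = record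
  { Member  = λ e → (e ∈ₛ F × ¬ (e ∈ₛ G)) ⊎ (e ∈ₛ G × ¬ (e ∈ₛ F))
  ; member? = λ e → (member? F e ×-dec ¬? (member? G e)) ⊎-dec (member? G e ×-dec ¬? (member? F e))
  }

-- { σ(i) : i ∈ e }: a vertex j belongs to it iff σ⁻¹(j) ∈ e.
image : ∀ {n} → Permutation′ n → Subset n → Subset n
image σ e = tabulate (λ j → lookup e (σ ⟨$⟩ˡ j))

-- { σ(e) : e ∈ F }
relabel : ∀ {n} → Permutation′ n → SetFamily n → SetFamily n
relabel σ F = record
  { Member  = λ f → ∃ λ e → e ∈ₛ F × f ≡ image σ e
  ; member? = λ f → anySubset? (λ e → member? F e ×-dec ≡-dec Bool._≟_ f (image σ e))
  }

-- Distinctness has to be required separately only because an empty edge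
-- is disjoint from itself.
IsMatching : ∀ {k n} → Hypergraph k n → List (Subset n) → Set
IsMatching H M =
  All (_∈ₛ E H) M × Unique M × AllPairs (λ e f → Empty (e ∩ f)) M

IsMatchingNumber : ∀ {k n} → Hypergraph k n → ℕ → Set
IsMatchingNumber H μ =
  (∃ λ M → IsMatching H M × length M ≡ μ) ×
  (∀ M → IsMatching H M → length M ℕ.≤ μ)

-- [β] as a subset of [n]
initial : ∀ n → ℕ → Subset n
initial n β = tabulate (λ i → toℕ i <ᵇ β)

S : (n k β : ℕ) → Hypergraph k n
S n k β = record
  { E = record
    { Member  = λ e → ∣ e ∣ ≡ k × Nonempty (e ∩ initial n β)
    ; member? = λ e → (∣ e ∣ ℕ.≟ k) ×-dec nonempty? (e ∩ initial n β)
    }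
  ; uniform = proj₁
  }

-- { i₁, …, iₖ }; it has fewer than k elements if the entries repeat.
support : ∀ {k n} → Vec (Fin n) k → Subset n
support is = ⋃ (List.map ⁅_⁆ (toList is))

1/_! : ℕ → ℚ
1/ m ! = ℚ._/_ (+ 1) (m !) {{m ℕ.!≢0}}

adjacency : ∀ {k n} → Hypergraph k n → Tensor k n
adjacency {k} H is =
  if does (member? (E H) (support is)) then fromℝ (fromℚ (1/ (k ∸ 1) !)) else 0ℂ

{-# OPTIONS --safe #-}

-- The heavy vertices of H are those lying in many edges.  A greedy matching
-- shows that there are at most β of them, and that if there are exactly β then
-- every edge contains one.
--
-- S has a Perron vector with entries a on [β] and 1 elsewhere, where a tends to
-- infinity with n but a = o(n).  Let y be the vector of moduli of an eigenvector
-- of H for an eigenvalue of largest modulus.  Writing y = u z with a positive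
-- vector u and applying AM–GM to the product of the z over each edge bounds
-- Σ_e y^e by the largest ratio of the eigenvalue equation at u.  With u about a
-- on β − 1 vertices and 1 elsewhere, this shows that the edges meeting a fixed
-- set of fewer than β vertices, together with an edge set of small maximum
-- degree or with the edges through a vertex of small y, give a spectral radius
-- below (1 − δ*) ρ(S).
-- Hence there are exactly β heavy vertices, and y is large on each of them.
-- With u the Perron vector of S, every edge missing from H loses its whole AM–GM
-- term, which is at least a multiple of n^{1−k} ρ(S) Σ y^k, so that at most
-- C δ n^{k−1} edges are missing.
--
-- Edges are counted by the k-tuples listing their vertices.  The root a is found
-- by bisection; all estimates are made over ℚ, at a late index of the Cauchy
-- sequences of a and y and for a rational number slightly larger than δ.
-- Inequalities between rational numbers are decidable, so it is enough to refute
-- that no such index exists.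
module Submission where

import Algebra.Definitions.RawSemiring
import Algebra.Properties.CommutativeMonoid.Sum
import Algebra.Properties.Semiring.Sum
open import Algebra.Bundles using (CommutativeRing)
open import Data.Bool.Base as Bool using (Bool; true; false; _∨_; _∧_; not; if_then_else_)
import Data.Bool.Properties as Bool
import Data.Empty as Empty
open import Data.Fin.Base as Fin using (Fin; zero; suc)
open import Data.Fin.Permutation as Perm using (Permutation′; _⟨$⟩ʳ_; _⟨$⟩ˡ_)
import Data.Fin.Properties as Fin
open import Data.Fin.Subset as Subset using (Subset; inside; outside; ⁅_⁆; ⋃; _∩_; _∪_; Nonempty; Empty; _∈_; _∉_)
open import Data.Fin.Subset.Properties
import Data.Integer.Base as ℤ
import Data.Integer.Properties as ℤ
import Data.List.Base as List
import Data.List.Properties as List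
import Data.List.Relation.Unary.All as All
import Data.List.Relation.Unary.All.Properties as All
open import Data.List.Relation.Unary.Unique.Propositional using (Unique)
import Data.List.Relation.Unary.Unique.Propositional.Properties as Unique
open import Data.Nat.Base as ℕ using (ℕ; zero; suc; _!; _<ᵇ_)
import Data.Nat.Properties as ℕ
open import Data.Product.Base using (∃; _×_; _,_; proj₁; proj₂)
open import Data.Rational.Base as ℚ using (ℚ; mkℚ; 0ℚ; 1ℚ; ½; _+_; _*_; _-_; -_)
open import Data.Rational.Properties as ℚ using
  (≤-trans; ≤-reflexive; <⇒≤; ≤-refl; *-identityʳ; *-identityˡ; +-monoˡ-≤; +-monoʳ-≤; <-≤-trans; ≤-<-trans; +-identityˡ; +-identityʳ; +-mono-≤;
   *-assoc; <-irrefl; *-zeroˡ; *-zeroʳ; *-comm; +-assoc; ≮⇒≥; ≰⇒>;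
   +-monoˡ-<; +-monoʳ-<; +-comm; _<?_; _≤?_; +-inverseʳ; ≤-total; *-distribˡ-+; module ≤-Reasoning)
open import Data.Rational.Solver using (module +-*-Solver)
import Data.Rational.Unnormalised.Base as ℚᵘ
import Data.Rational.Unnormalised.Properties as ℚᵘ
open import Data.Sum.Base using (_⊎_; inj₁; inj₂)
open import Data.Vec.Base as Vec using (Vec; []; _∷_; lookup; insertAt; tabulate)
open import Data.Vec.Properties using (insertAt-lookup; lookup∘tabulate; []=⇒lookup; lookup⇒[]=; lookup-map; lookup-zipWith; ≡-dec; tabulate-cong; toList∘fromList)
open import Defs
open import Function.Base using (_∘_; case_of_)
open import Level using (0ℓ)
open import Relation.Binary.Bundles using (Preorder)
import Relation.Binary.Reasoning.Preorder
open import Relation.Binary.PropositionalEquality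
open import Relation.Nullary using (Dec; yes; no; contradiction; does; ¬_)
open import Relation.Nullary.Decidable using (dec-true; dec-false; decidable-stable)
open import Relation.Unary using (Pred; Decidable)
open +-*-Solver using (solve; _:=_; _:+_; _:*_; _:-_; :-_; con)

-- Write m = k - 1. Counting tuples, a row of S has total weight about nᵐ at a vertex of [β] and
-- about m β a n^(m-1) elsewhere. Equating these with λ aᵐ and λ gives a of order n^(1/k) and, up to
-- the factor m!, ρ(S) about m β a n^(m-1). Two features of this value shape the proof. It exceeds
-- by a factor of order a the degree O(n^(m-1)) of a vertex that is not heavy, so the edges without
-- heavy vertices are negligible. And it is proportional to β, so giving up one vertex of [β] costs
-- a fraction 1/β of it; h = 1 / (8 β) is the part of this loss that survives the approximations,
-- and δ* is a fraction of h. The obstacle is that nothing is known in advance about the eigenvector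
-- of H beyond the inequality that its moduli satisfy. Hence all test vectors come from the side of
-- S. AM-GM weighted by the Perron vector u of S is an equality at y = u, so its total slack is only
-- k δ ρ(S) Σ yᵏ; this is what makes the final bound linear in δ.

-- Rational arithmetic and sums over all tuples of vertices

module RationalSums where

  open import Data.Rational.Base using (_≤_; _<_)

  open Algebra.Definitions.RawSemiring ℚ.+-*-rawSemiring public using (_^_; sum; product)
  private
    module CM = Algebra.Properties.CommutativeMonoid.Sum ℚ.+-0-commutativeMonoid
    module SR = Algebra.Properties.Semiring.Sum (CommutativeRing.semiring ℚ.+-*-commutativeRing)

  p≤p+q : ∀ {p q} → 0ℚ ≤ q → p ≤ p + q
  p≤p+q {p} {q} 0≤q = subst (_≤ p + q) (+-identityʳ p) (+-monoʳ-≤ p 0≤q)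

  by-difference : ∀ {p q} d → 0ℚ ≤ d → q ≡ p + d → p ≤ q
  by-difference {p} d 0≤d eq = subst (p ≤_) (sym eq) (p≤p+q 0≤d)

  0≤q-p : ∀ {p q} → p ≤ q → 0ℚ ≤ q - p
  0≤q-p {p} {q} p≤q = subst (_≤ q - p) (+-inverseʳ p) (+-monoˡ-≤ (- p) p≤q)

  0<q-p : ∀ {p q} → p < q → 0ℚ < q - p
  0<q-p {p} {q} p<q = subst (_< q - p) (+-inverseʳ p) (+-monoˡ-< (- p) p<q)

  p≤q⇐0≤q-p : ∀ {p q} → 0ℚ ≤ q - p → p ≤ q
  p≤q⇐0≤q-p {p} {q} h = by-difference (q - p) h (solve 2 (λ p q → q := p :+ (q :- p)) refl p q)

  +-nonneg : ∀ {p q} → 0ℚ ≤ p → 0ℚ ≤ q → 0ℚ ≤ p + q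
  +-nonneg = +-mono-≤

  *-monoˡ : ∀ {r p q} → 0ℚ ≤ r → p ≤ q → r * p ≤ r * q
  *-monoˡ {r} 0≤r = ℚ.*-monoˡ-≤-nonNeg r {{ℚ.nonNegative 0≤r}}

  *-monoʳ : ∀ {r p q} → 0ℚ ≤ r → p ≤ q → p * r ≤ q * r
  *-monoʳ {r} 0≤r = ℚ.*-monoʳ-≤-nonNeg r {{ℚ.nonNegative 0≤r}}

  *-nonneg : ∀ {p q} → 0ℚ ≤ p → 0ℚ ≤ q → 0ℚ ≤ p * q
  *-nonneg {p} {q} 0≤p 0≤q = subst (_≤ p * q) (*-zeroʳ p) (*-monoˡ 0≤p 0≤q)

  *-pos : ∀ {p q} → 0ℚ < p → 0ℚ < q → 0ℚ < p * q
  *-pos {p} {q} 0<p 0<q = subst (_< p * q) (*-zeroʳ p) (ℚ.*-monoʳ-<-pos p {{ℚ.positive 0<p}} 0<q)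

  *-mono : ∀ {p p′ q q′} → 0ℚ ≤ p → 0ℚ ≤ q′ → p ≤ p′ → q ≤ q′ → p * q ≤ p′ * q′
  *-mono 0≤p 0≤q′ p≤p′ q≤q′ = ≤-trans (*-monoˡ 0≤p q≤q′) (*-monoʳ 0≤q′ p≤p′)

  *-monoˡ-< : ∀ {r p q} → 0ℚ < r → p < q → r * p < r * q
  *-monoˡ-< {r} 0<r = ℚ.*-monoʳ-<-pos r {{ℚ.positive 0<r}}

  *-cancelˡ : ∀ {r p q} → 0ℚ < r → r * p ≤ r * q → p ≤ q
  *-cancelˡ {r} 0<r = ℚ.*-cancelˡ-≤-pos r {{ℚ.positive 0<r}}

  +-cancelʳ : ∀ {p q} r → p + r ≤ q + r → p ≤ q
  +-cancelʳ {p} {q} r h = p≤q⇐0≤q-p (subst (0ℚ ≤_)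
    (solve 3 (λ p q r → (q :+ r) :- (p :+ r) := q :- p) refl p q r) (0≤q-p h))

  0≤1 : 0ℚ ≤ 1ℚ
  0≤1 = ℚ.nonNegative⁻¹ 1ℚ

  0<1 : 0ℚ < 1ℚ
  0<1 = ℚ.positive⁻¹ 1ℚ

  square-nonneg : ∀ p → 0ℚ ≤ p * p
  square-nonneg p with ≤-total 0ℚ p
  ... | inj₁ 0≤p = *-nonneg 0≤p 0≤p
  ... | inj₂ p≤0 = subst (0ℚ ≤_) (solve 1 (λ p → (:- p) :* (:- p) := p :* p) refl p) (*-nonneg 0≤-p 0≤-p)
    where
    0≤-p : 0ℚ ≤ - p
    0≤-p = ℚ.neg-antimono-≤ p≤0

  recip : ∀ {p} → 0ℚ < p → ∃ λ r → 0ℚ < r × p * r ≡ 1ℚ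
  recip {p} 0<p = ℚ.1/ p , ℚ.positive⁻¹ _ {{ℚ.1/pos⇒pos p}} , ℚ.*-inverseʳ p
    where instance
      p-pos : ℚ.Positive p
      p-pos = ℚ.positive 0<p
      p-nz : ℚ.NonZero p
      p-nz = ℚ.pos⇒nonZero p

  ^-nonneg : ∀ {p} m → 0ℚ ≤ p → 0ℚ ≤ p ^ m
  ^-nonneg zero 0≤p = 0≤1
  ^-nonneg (suc m) 0≤p = *-nonneg 0≤p (^-nonneg m 0≤p)

  ^-pos : ∀ {p} m → 0ℚ < p → 0ℚ < p ^ m
  ^-pos zero 0<p = 0<1
  ^-pos (suc m) 0<p = *-pos 0<p (^-pos m 0<p)

  ^-mono : ∀ {p q} m → 0ℚ ≤ p → p ≤ q → p ^ m ≤ q ^ m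
  ^-mono zero 0≤p p≤q = ≤-refl
  ^-mono (suc m) 0≤p p≤q =
    *-mono 0≤p (^-nonneg m (≤-trans 0≤p p≤q)) p≤q (^-mono m 0≤p p≤q)

  1≤^ : ∀ {p} m → 1ℚ ≤ p → 1ℚ ≤ p ^ m
  1≤^ zero 1≤p = ≤-refl
  1≤^ (suc m) 1≤p = *-mono 0≤1 (^-nonneg m (≤-trans 0≤1 1≤p)) 1≤p (1≤^ m 1≤p)

  1^ : ∀ m → 1ℚ ^ m ≡ 1ℚ
  1^ zero = refl
  1^ (suc m) = trans (*-identityˡ _) (1^ m)

  ^-distrib-* : ∀ p q m → (p * q) ^ m ≡ p ^ m * q ^ m
  ^-distrib-* p q zero = refl
  ^-distrib-* p q (suc m) = trans (cong ((p * q) *_) (^-distrib-* p q m))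
    (solve 4 (λ a b c d → (a :* b) :* (c :* d) := (a :* c) :* (b :* d)) refl p q (p ^ m) (q ^ m))

  -- The recursion makes `ι (suc n)` unfold to `1ℚ + ι n`, the form given to the ring solver; `ι≡/1`
  -- links it to `fromℕ`.
  ι : ℕ → ℚ
  ι zero = 0ℚ
  ι (suc n) = 1ℚ + ι n

  ι≡/1 : ∀ n → ι n ≡ ℤ.+ n ℚ./ 1
  ι≡/1 n = trans (go n) (ℚ.fromℚᵘ-cong {x = ℚᵘ.mkℚᵘ (ℤ.+ n) 0} ℚᵘ.≃-refl)
    where
    go : ∀ n → ι n ≡ ℚ.fromℚᵘ (ℚᵘ.mkℚᵘ (ℤ.+ n) 0)
    go zero = refl
    go (suc n) = ℚ.toℚᵘ-injective (begin
      ℚ.toℚᵘ (1ℚ + ι n) ≈⟨ ℚ.toℚᵘ-homo-+ 1ℚ (ι n) ⟩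
      ℚ.toℚᵘ 1ℚ ℚᵘ.+ ℚ.toℚᵘ (ι n) ≈⟨ ℚᵘ.+-congʳ (ℚ.toℚᵘ 1ℚ) (ℚ.toℚᵘ-cong (go n)) ⟩
      ℚ.toℚᵘ 1ℚ ℚᵘ.+ ℚ.toℚᵘ (ℚ.fromℚᵘ (ℚᵘ.mkℚᵘ (ℤ.+ n) 0)) ≈⟨ ℚᵘ.+-congʳ (ℚ.toℚᵘ 1ℚ) (ℚ.toℚᵘ-fromℚᵘ (ℚᵘ.mkℚᵘ (ℤ.+ n) 0)) ⟩
      ℚ.toℚᵘ 1ℚ ℚᵘ.+ ℚᵘ.mkℚᵘ (ℤ.+ n) 0 ≈⟨ ℚᵘ.*≡* (cong (λ z → (ℤ.+ 1 ℤ.+ z) ℤ.* ℤ.+ 1) (ℤ.*-identityʳ (ℤ.+ n))) ⟩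
      ℚᵘ.mkℚᵘ (ℤ.+ suc n) 0 ≈⟨ ℚᵘ.≃-sym (ℚ.toℚᵘ-fromℚᵘ (ℚᵘ.mkℚᵘ (ℤ.+ suc n) 0)) ⟩
      ℚ.toℚᵘ (ℚ.fromℚᵘ (ℚᵘ.mkℚᵘ (ℤ.+ suc n) 0)) ∎)
      where open ℚᵘ.≃-Reasoning

  ι-+ : ∀ m n → ι (m ℕ.+ n) ≡ ι m + ι n
  ι-+ zero n = sym (+-identityˡ (ι n))
  ι-+ (suc m) n = trans (cong (1ℚ +_) (ι-+ m n)) (sym (+-assoc 1ℚ (ι m) (ι n)))

  ι-* : ∀ m n → ι (m ℕ.* n) ≡ ι m * ι n
  ι-* zero n = sym (*-zeroˡ (ι n))
  ι-* (suc m) n = trans (ι-+ n (m ℕ.* n)) (trans (cong (ι n +_) (ι-* m n))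
    (solve 2 (λ a b → b :+ a :* b := (con 1ℚ :+ a) :* b) refl (ι m) (ι n)))

  ι-^ : ∀ n m → ι (n ℕ.^ m) ≡ ι n ^ m
  ι-^ n zero = refl
  ι-^ n (suc m) = trans (ι-* n (n ℕ.^ m)) (cong (ι n *_) (ι-^ n m))

  0≤ι : ∀ n → 0ℚ ≤ ι n
  0≤ι zero = ≤-refl
  0≤ι (suc n) = +-nonneg 0≤1 (0≤ι n)

  ι-mono : ∀ {m n} → m ℕ.≤ n → ι m ≤ ι n
  ι-mono {m} {n} m≤n with ℕ.m≤n⇒∃[o]m+o≡n m≤n
  ... | o , refl = by-difference (ι o) (0≤ι o) (ι-+ m o)

  0<ι : ∀ n → 0ℚ < ι (suc n)
  0<ι n = ℚ.+-mono-<-≤ 0<1 (0≤ι n)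

  1≤ι : ∀ n → 1ℚ ≤ ι (suc n)
  1≤ι n = p≤p+q (0≤ι n)

  ι-cancel : ∀ {m n} → ι m ≤ ι n → m ℕ.≤ n
  ι-cancel {m} {n} h with m ℕ.≤? n
  ... | yes p = p
  ... | no ¬p = contradiction (≤-trans (ι-mono (ℕ.≰⇒> ¬p)) h) λ q →
    <-irrefl refl (<-≤-trans (subst (_< 1ℚ + ι n) (+-identityˡ (ι n)) (+-monoˡ-< (ι n) 0<1)) q)

  sum-cong : ∀ {n} {f g : Fin n → ℚ} → (∀ i → f i ≡ g i) → sum f ≡ sum g
  sum-cong = CM.sum-cong-≗

  sum-+ : ∀ {n} (f g : Fin n → ℚ) → sum (λ i → f i + g i) ≡ sum f + sum g
  sum-+ f g = CM.∑-distrib-+ f g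

  sum-comm : ∀ {m n} (f : Fin m → Fin n → ℚ) → sum (λ i → sum (f i)) ≡ sum (λ j → sum (λ i → f i j))
  sum-comm = CM.∑-comm

  sum-permute : ∀ {n} (f : Fin n → ℚ) (π : Permutation′ n) → sum f ≡ sum (λ i → f (π ⟨$⟩ʳ i))
  sum-permute = CM.sum-permute

  sum-*ˡ : ∀ {n} c (f : Fin n → ℚ) → sum (λ i → c * f i) ≡ c * sum f
  sum-*ˡ c f = sym (SR.*-distribˡ-sum c f)

  sum-*ʳ : ∀ {n} c (f : Fin n → ℚ) → sum (λ i → f i * c) ≡ sum f * c
  sum-*ʳ c f = sym (SR.*-distribʳ-sum c f)

  sum-mono : ∀ {n} {f g : Fin n → ℚ} → (∀ i → f i ≤ g i) → sum f ≤ sum g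
  sum-mono {zero} h = ≤-refl
  sum-mono {suc n} h = +-mono-≤ (h zero) (sum-mono (h ∘ suc))

  sum-nonneg : ∀ {n} {f : Fin n → ℚ} → (∀ i → 0ℚ ≤ f i) → 0ℚ ≤ sum f
  sum-nonneg {zero} h = ≤-refl
  sum-nonneg {suc n} h = +-nonneg (h zero) (sum-nonneg (h ∘ suc))

  term≤sum : ∀ {n} {f : Fin n → ℚ} → (∀ i → 0ℚ ≤ f i) → ∀ i → f i ≤ sum f
  term≤sum h zero = p≤p+q (sum-nonneg (h ∘ suc))
  term≤sum {f = f} h (suc i) = ≤-trans (term≤sum (h ∘ suc) i)
    (subst (_≤ sum f) (+-identityˡ _) (+-monoˡ-≤ (sum (f ∘ suc)) (h zero)))

  sum-const : ∀ n c → sum {n} (λ _ → c) ≡ ι n * c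
  sum-const zero c = sym (*-zeroˡ c)
  sum-const (suc n) c = trans (cong (c +_) (sum-const n c))
    (solve 2 (λ a b → b :+ a :* b := (con 1ℚ :+ a) :* b) refl (ι n) c)

  sum-zero : ∀ {n} {f : Fin n → ℚ} → (∀ i → f i ≡ 0ℚ) → sum f ≡ 0ℚ
  sum-zero {n} h = trans (sum-cong h) (trans (sum-const n 0ℚ) (*-zeroʳ (ι n)))

  sum-< : ∀ {n} {f g : Fin n → ℚ} → sum g < sum f → ∃ λ i → g i < f i
  sum-< {zero} h = contradiction h (<-irrefl refl)
  sum-< {suc n} {f} {g} h with g zero <? f zero
  ... | yes lt = zero , lt
  ... | no ¬lt with sum (g ∘ suc) <? sum (f ∘ suc)
  ...   | yes lt = let i , p = sum-< lt in suc i , p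
  ...   | no ¬lt′ = contradiction (<-≤-trans h (+-mono-≤ (≮⇒≥ ¬lt) (≮⇒≥ ¬lt′))) (<-irrefl refl)

  product-nonneg : ∀ {n} {f : Fin n → ℚ} → (∀ i → 0ℚ ≤ f i) → 0ℚ ≤ product f
  product-nonneg {zero} h = 0≤1
  product-nonneg {suc n} h = *-nonneg (h zero) (product-nonneg (h ∘ suc))

  product-cong : ∀ {n} {f g : Fin n → ℚ} → (∀ i → f i ≡ g i) → product f ≡ product g
  product-cong {zero} h = refl
  product-cong {suc n} h = cong₂ _*_ (h zero) (product-cong (h ∘ suc))

  product-* : ∀ {n} (f g : Fin n → ℚ) → product (λ i → f i * g i) ≡ product f * product g
  product-* {zero} f g = refl
  product-* {suc n} f g = trans (cong ((f zero * g zero) *_) (product-* (f ∘ suc) (g ∘ suc)))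
    (solve 4 (λ a b c d → (a :* b) :* (c :* d) := (a :* c) :* (b :* d)) refl
      (f zero) (g zero) (product (f ∘ suc)) (product (g ∘ suc)))

  1≤product : ∀ {n} {f : Fin n → ℚ} → (∀ i → 1ℚ ≤ f i) → 1ℚ ≤ product f
  1≤product {zero} h = ≤-refl
  1≤product {suc n} h = *-mono 0≤1 (≤-trans 0≤1 (1≤product (h ∘ suc))) (h zero) (1≤product (h ∘ suc))

  factor≤product : ∀ {n} {f : Fin n → ℚ} → (∀ i → 1ℚ ≤ f i) → ∀ i → f i ≤ product f
  factor≤product {f = f} h zero = subst (_≤ product f) (*-identityʳ (f zero))
    (*-monoˡ (≤-trans 0≤1 (h zero)) (1≤product (h ∘ suc)))
  factor≤product {f = f} h (suc i) = ≤-trans (factor≤product (h ∘ suc) i)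
    (subst (_≤ product f) (*-identityˡ _) (*-monoʳ (≤-trans 0≤1 (1≤product (h ∘ suc))) (h zero)))

  ∑ₜ : ∀ m {n} → (Vec (Fin n) m → ℚ) → ℚ
  ∑ₜ zero f = f []
  ∑ₜ (suc m) f = sum (λ i → ∑ₜ m (λ is → f (i ∷ is)))

  ∑ₜ-cong : ∀ m {n} {f g : Vec (Fin n) m → ℚ} → (∀ t → f t ≡ g t) → ∑ₜ m f ≡ ∑ₜ m g
  ∑ₜ-cong zero h = h []
  ∑ₜ-cong (suc m) h = sum-cong (λ i → ∑ₜ-cong m (λ is → h (i ∷ is)))

  ∑ₜ-zero : ∀ m {n} {f : Vec (Fin n) m → ℚ} → (∀ t → f t ≡ 0ℚ) → ∑ₜ m f ≡ 0ℚ
  ∑ₜ-zero zero h = h []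
  ∑ₜ-zero (suc m) h = sum-zero (λ i → ∑ₜ-zero m (λ is → h (i ∷ is)))

  ∑ₜ-mono : ∀ m {n} {f g : Vec (Fin n) m → ℚ} → (∀ t → f t ≤ g t) → ∑ₜ m f ≤ ∑ₜ m g
  ∑ₜ-mono zero h = h []
  ∑ₜ-mono (suc m) h = sum-mono (λ i → ∑ₜ-mono m (λ is → h (i ∷ is)))

  ∑ₜ-nonneg : ∀ m {n} {f : Vec (Fin n) m → ℚ} → (∀ t → 0ℚ ≤ f t) → 0ℚ ≤ ∑ₜ m f
  ∑ₜ-nonneg zero h = h []
  ∑ₜ-nonneg (suc m) h = sum-nonneg (λ i → ∑ₜ-nonneg m (λ is → h (i ∷ is)))

  ∑ₜ-distrib-+ : ∀ m {n} (f g : Vec (Fin n) m → ℚ) → ∑ₜ m (λ t → f t + g t) ≡ ∑ₜ m f + ∑ₜ m g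
  ∑ₜ-distrib-+ zero f g = refl
  ∑ₜ-distrib-+ (suc m) f g =
    trans (sum-cong (λ i → ∑ₜ-distrib-+ m (λ is → f (i ∷ is)) (λ is → g (i ∷ is)))) (sum-+ (λ i → ∑ₜ m (λ is → f (i ∷ is))) (λ i → ∑ₜ m (λ is → g (i ∷ is))))

  ∑ₜ-*ˡ : ∀ m {n} c (f : Vec (Fin n) m → ℚ) → ∑ₜ m (λ t → c * f t) ≡ c * ∑ₜ m f
  ∑ₜ-*ˡ zero c f = refl
  ∑ₜ-*ˡ (suc m) c f = trans (sum-cong (λ i → ∑ₜ-*ˡ m c (λ is → f (i ∷ is)))) (sum-*ˡ c (λ i → ∑ₜ m (λ is → f (i ∷ is))))

  ∑ₜ-*ʳ : ∀ m {n} c (f : Vec (Fin n) m → ℚ) → ∑ₜ m (λ t → f t * c) ≡ ∑ₜ m f * c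
  ∑ₜ-*ʳ m c f = trans (∑ₜ-cong m (λ t → *-comm (f t) c)) (trans (∑ₜ-*ˡ m c f) (*-comm c _))

  ∑ₜ-sum : ∀ m {n r} (f : Vec (Fin n) m → Fin r → ℚ) →
           ∑ₜ m (λ t → sum (f t)) ≡ sum (λ j → ∑ₜ m (λ t → f t j))
  ∑ₜ-sum zero f = refl
  ∑ₜ-sum (suc m) f = trans (sum-cong (λ i → ∑ₜ-sum m (λ is → f (i ∷ is))))
    (sum-comm (λ i j → ∑ₜ m (λ is → f (i ∷ is) j)))

  ∑ₜ-term : ∀ m {n} {f : Vec (Fin n) m → ℚ} → (∀ t → 0ℚ ≤ f t) → ∀ t → f t ≤ ∑ₜ m f
  ∑ₜ-term zero h [] = ≤-refl
  ∑ₜ-term (suc m) h (i ∷ is) = ≤-trans (∑ₜ-term m (λ js → h (i ∷ js)) is)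
    (term≤sum (λ j → ∑ₜ-nonneg m (λ js → h (j ∷ js))) i)

  ∑ₜ-< : ∀ m {n} {f g : Vec (Fin n) m → ℚ} → ∑ₜ m g < ∑ₜ m f → ∃ λ t → g t < f t
  ∑ₜ-< zero h = [] , h
  ∑ₜ-< (suc m) h = let i , p = sum-< h ; is , q = ∑ₜ-< m p in i ∷ is , q

  ∑ₜ-permute : ∀ m {n} (f : Vec (Fin n) m → ℚ) (π : Permutation′ n) →
               ∑ₜ m f ≡ ∑ₜ m (λ t → f (Vec.map (π ⟨$⟩ʳ_) t))
  ∑ₜ-permute zero f π = refl
  ∑ₜ-permute (suc m) f π = trans (sum-permute (λ i → ∑ₜ m (λ is → f (i ∷ is))) π)
    (sum-cong (λ i → ∑ₜ-permute m (λ is → f ((π ⟨$⟩ʳ i) ∷ is)) π))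

  -- Exchanging sums allows any position of the tuple to be singled out, not only the first.
  ∑ₜ-insertAt : ∀ m {n} (f : Vec (Fin n) (suc m) → ℚ) (j : Fin (suc m)) →
                ∑ₜ (suc m) f ≡ sum (λ i → ∑ₜ m (λ is → f (Vec.insertAt is j i)))
  ∑ₜ-insertAt m f zero = refl
  ∑ₜ-insertAt (suc m) f (suc j) =
    trans (sum-cong (λ i → ∑ₜ-insertAt m (λ is → f (i ∷ is)) j))
      (sum-comm (λ i i′ → ∑ₜ m (λ is → f (i ∷ Vec.insertAt is j i′))))

  infix 9 _⟪_⟫

  _⟪_⟫ : ∀ {n m} → (Fin n → ℚ) → Vec (Fin n) m → ℚ
  u ⟪ t ⟫ = product (λ j → u (lookup t j))

  ⟪⟫-one : ∀ {n m} (t : Vec (Fin n) m) → (λ _ → 1ℚ) ⟪ t ⟫ ≡ 1ℚ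
  ⟪⟫-one [] = refl
  ⟪⟫-one (i ∷ is) = trans (*-identityˡ _) (⟪⟫-one is)

  ∑ₜ-product : ∀ m {n} (u : Fin n → ℚ) → ∑ₜ m (u ⟪_⟫) ≡ sum u ^ m
  ∑ₜ-product zero u = refl
  ∑ₜ-product (suc m) u = begin
    sum (λ i → ∑ₜ m (λ is → u i * u ⟪ is ⟫)) ≡⟨ sum-cong (λ i → ∑ₜ-*ˡ m (u i) (u ⟪_⟫)) ⟩
    sum (λ i → u i * ∑ₜ m (u ⟪_⟫))           ≡⟨ sum-*ʳ (∑ₜ m (u ⟪_⟫)) u ⟩
    sum u * ∑ₜ m (u ⟪_⟫)                     ≡⟨ cong (sum u *_) (∑ₜ-product m u) ⟩
    sum u * sum u ^ m                        ∎
    where open ≡-Reasoning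

  ⟦_⟧ : Bool → ℚ
  ⟦ b ⟧ = if b then 1ℚ else 0ℚ

  0≤⟦⟧ : ∀ b → 0ℚ ≤ ⟦ b ⟧
  0≤⟦⟧ true = 0≤1
  0≤⟦⟧ false = ≤-refl

  ⟦⟧≤1 : ∀ b → ⟦ b ⟧ ≤ 1ℚ
  ⟦⟧≤1 true = ≤-refl
  ⟦⟧≤1 false = 0≤1

  ⟦⟧-mono : ∀ {b c} → (b ≡ true → c ≡ true) → ⟦ b ⟧ ≤ ⟦ c ⟧
  ⟦⟧-mono {true} h = ≤-reflexive (cong ⟦_⟧ (sym (h refl)))
  ⟦⟧-mono {false} {c} h = 0≤⟦⟧ c

  ⟦∨⟧≤ : ∀ b c → ⟦ b ∨ c ⟧ ≤ ⟦ b ⟧ + ⟦ c ⟧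
  ⟦∨⟧≤ true c = p≤p+q (0≤⟦⟧ c)
  ⟦∨⟧≤ false c = ≤-reflexive (sym (+-identityˡ ⟦ c ⟧))

  ⟦∧⟧ : ∀ b c → ⟦ b ∧ c ⟧ ≡ ⟦ b ⟧ * ⟦ c ⟧
  ⟦∧⟧ true c = sym (*-identityˡ ⟦ c ⟧)
  ⟦∧⟧ false c = sym (*-zeroˡ ⟦ c ⟧)

-- AM-GM, Collatz-Wielandt and union bounds for sums over tuples

module TupleInequalities where

  open import Data.Rational.Base using (_≤_; _<_)
  open RationalSums

  -- By induction: the difference of the two sides at m + 1 is x times the difference at m plus (m +
  -- 1) zᵐ (x - z)².
  young : ∀ m {x z} → 0ℚ ≤ x → 0ℚ ≤ z → ι (suc m) * (x * z ^ m) ≤ x ^ suc m + ι m * z ^ suc m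
  young zero {x} {z} 0≤x 0≤z = ≤-reflexive
    (solve 2 (λ x z → (con 1ℚ :+ con 0ℚ) :* (x :* con 1ℚ) := x :* con 1ℚ :+ con 0ℚ :* (z :* con 1ℚ)) refl x z)
  young (suc m) {x} {z} 0≤x 0≤z = by-difference
    (x * ((x * x ^ m + ι m * (z * z ^ m)) - (1ℚ + ι m) * (x * z ^ m)) + (1ℚ + ι m) * (z ^ m * ((x - z) * (x - z))))
    (+-nonneg (*-nonneg 0≤x (0≤q-p (young m 0≤x 0≤z)))
              (*-nonneg (0≤ι (suc m)) (*-nonneg (^-nonneg m 0≤z) (square-nonneg (x - z)))))
    (solve 5 (λ x z n xm zm →
        x :* (x :* xm) :+ (con 1ℚ :+ n) :* (z :* (z :* zm)) :=
        (con 1ℚ :+ (con 1ℚ :+ n)) :* (x :* (z :* zm)) :+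
        (x :* ((x :* xm :+ n :* (z :* zm)) :- (con 1ℚ :+ n) :* (x :* zm)) :+ (con 1ℚ :+ n) :* (zm :* ((x :- z) :* (x :- z)))))
      refl x z (ι m) (x ^ m) (z ^ m))

  -- No roots are taken. The induction hypothesis replaces the product of the last m factors by the
  -- sum of their m-th powers, and `young` handles each term x zⱼᵐ. The whole is multiplied by m,
  -- which has to be positive to be cancelled; hence the separate case of one factor.
  am-gm : ∀ m (f : Fin m → ℚ) → (∀ j → 0ℚ ≤ f j) → ι m * product f ≤ sum (λ j → f j ^ m)
  am-gm zero f h = ≤-refl
  am-gm (suc zero) f h = ≤-reflexive (solve 1 (λ x → (con 1ℚ :+ con 0ℚ) :* (x :* con 1ℚ) := x :* con 1ℚ :+ con 0ℚ) refl (f zero))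
  am-gm (suc m@(suc l)) f h = *-cancelˡ (0<ι l) (begin
    ι m * (ι (suc m) * (x * product z))
      ≡⟨ solve 4 (λ m sm x p → m :* (sm :* (x :* p)) := (sm :* x) :* (m :* p)) refl (ι m) (ι (suc m)) x (product z) ⟩
    (ι (suc m) * x) * (ι m * product z)
      ≤⟨ *-monoˡ (*-nonneg (0≤ι (suc m)) (h zero)) (am-gm m z (h ∘ suc)) ⟩
    (ι (suc m) * x) * sum (λ j → z j ^ m)
      ≡⟨ sym (sum-*ˡ (ι (suc m) * x) (λ j → z j ^ m)) ⟩
    sum (λ j → (ι (suc m) * x) * z j ^ m)
      ≤⟨ sum-mono (λ j → ≤-trans (≤-reflexive (*-assoc (ι (suc m)) x (z j ^ m))) (young m (h zero) (h (suc j)))) ⟩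
    sum (λ j → x ^ suc m + ι m * z j ^ suc m)
      ≡⟨ sum-+ (λ _ → x ^ suc m) (λ j → ι m * z j ^ suc m) ⟩
    sum {m} (λ _ → x ^ suc m) + sum (λ j → ι m * z j ^ suc m)
      ≡⟨ cong₂ _+_ (sum-const m (x ^ suc m)) (sum-*ˡ (ι m) (λ j → z j ^ suc m)) ⟩
    ι m * x ^ suc m + ι m * sum (λ j → z j ^ suc m)
      ≡⟨ sym (*-distribˡ-+ (ι m) (x ^ suc m) (sum (λ j → z j ^ suc m))) ⟩
    ι m * (x ^ suc m + sum (λ j → z j ^ suc m)) ∎)
    where
    open ≤-Reasoning
    x : ℚ
    x = f zero
    z : Fin m → ℚ
    z = f ∘ suc

  -- Moving one entry to the front is the only rearrangement that the marginals use.
  Symmetric : ∀ {m n} → (Vec (Fin n) (suc m) → ℚ) → Set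
  Symmetric {m} {n} c = ∀ (is : Vec (Fin n) m) j i → c (insertAt is j i) ≡ c (i ∷ is)

  ∑ₜ-marginal : ∀ {m n} (c : Vec (Fin n) (suc m) → ℚ) → Symmetric c → (g : Fin n → ℚ) (j : Fin (suc m)) →
                ∑ₜ (suc m) (λ t → c t * g (lookup t j)) ≡ sum (λ i → g i * ∑ₜ m (λ is → c (i ∷ is)))
  ∑ₜ-marginal {m} c c-sym g j = trans (∑ₜ-insertAt m (λ t → c t * g (lookup t j)) j) (sum-cong (λ i →
    trans (∑ₜ-cong m (λ is → trans (cong₂ _*_ (c-sym is j i) (cong g (insertAt-lookup is j i))) (*-comm (c (i ∷ is)) (g i))))
          (∑ₜ-*ˡ m (g i) (λ is → c (i ∷ is)))))

  ∑ₜ-marginals : ∀ {m n} (c : Vec (Fin n) (suc m) → ℚ) → Symmetric c → (g : Fin n → ℚ) →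
                 ∑ₜ (suc m) (λ t → c t * sum (λ j → g (lookup t j))) ≡
                 ι (suc m) * sum (λ i → g i * ∑ₜ m (λ is → c (i ∷ is)))
  ∑ₜ-marginals {m} c c-sym g = begin
    ∑ₜ (suc m) (λ t → c t * sum (λ j → g (lookup t j)))
      ≡⟨ ∑ₜ-cong (suc m) (λ t → sym (sum-*ˡ (c t) (λ j → g (lookup t j)))) ⟩
    ∑ₜ (suc m) (λ t → sum (λ j → c t * g (lookup t j)))
      ≡⟨ ∑ₜ-sum (suc m) (λ t j → c t * g (lookup t j)) ⟩
    sum (λ j → ∑ₜ (suc m) (λ t → c t * g (lookup t j)))
      ≡⟨ sum-cong (∑ₜ-marginal c c-sym g) ⟩
    sum {suc m} (λ _ → sum (λ i → g i * ∑ₜ m (λ is → c (i ∷ is))))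
      ≡⟨ sum-const (suc m) _ ⟩
    ι (suc m) * sum (λ i → g i * ∑ₜ m (λ is → c (i ∷ is))) ∎
    where open ≡-Reasoning

  ∑ₜ-am-gm : ∀ {m n} (c : Vec (Fin n) (suc m) → ℚ) → (∀ t → 0ℚ ≤ c t) → (z : Fin n → ℚ) → (∀ i → 0ℚ ≤ z i) →
             ι (suc m) * ∑ₜ (suc m) (λ t → c t * z ⟪ t ⟫) ≤ ∑ₜ (suc m) (λ t → c t * sum (λ j → z (lookup t j) ^ suc m))
  ∑ₜ-am-gm {m} c 0≤c z 0≤z = ≤-trans
    (≤-reflexive (sym (∑ₜ-*ˡ (suc m) (ι (suc m)) (λ t → c t * z ⟪ t ⟫))))
    (∑ₜ-mono (suc m) (λ t → ≤-trans
      (≤-reflexive (solve 3 (λ k c p → k :* (c :* p) := c :* (k :* p)) refl (ι (suc m)) (c t) (z ⟪ t ⟫)))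
      (*-monoˡ (0≤c t) (am-gm (suc m) (λ j → z (lookup t j)) (λ j → 0≤z (lookup t j))))))

  ⟪⟫-insertAt : ∀ {n l} (u : Fin n → ℚ) (is : Vec (Fin n) l) j i → u ⟪ insertAt is j i ⟫ ≡ u i * u ⟪ is ⟫
  ⟪⟫-insertAt u is zero i = refl
  ⟪⟫-insertAt u (i′ ∷ is) (suc j) i = trans (cong (u i′ *_) (⟪⟫-insertAt u is j i))
    (solve 3 (λ a b c → a :* (b :* c) := b :* (a :* c)) refl (u i′) (u i) (u ⟪ is ⟫))

  -- Collatz–Wielandt bound with test vector u, where y = u z.
  collatz : ∀ {m n} (c : Vec (Fin n) (suc m) → ℚ) → (∀ t → 0ℚ ≤ c t) → Symmetric c →
            (u z : Fin n → ℚ) → (∀ i → 0ℚ ≤ u i) → (∀ i → 0ℚ ≤ z i) →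
            (r : ℚ) → (∀ i → ∑ₜ m (λ is → c (i ∷ is) * u ⟪ is ⟫) ≤ r * u i ^ m) →
            ∑ₜ (suc m) (λ t → (c t * u ⟪ t ⟫) * sum (λ j → z (lookup t j) ^ suc m))
              ≤ ι (suc m) * (r * sum (λ i → (u i * z i) ^ suc m))
  collatz {m} c 0≤c c-sym u z 0≤u 0≤z r h = begin
    ∑ₜ (suc m) (λ t → (c t * u ⟪ t ⟫) * sum (λ j → z (lookup t j) ^ suc m))
      ≡⟨ ∑ₜ-marginals (λ t → c t * u ⟪ t ⟫) sym′ (λ i → z i ^ suc m) ⟩
    ι (suc m) * sum (λ i → z i ^ suc m * ∑ₜ m (λ is → c (i ∷ is) * (u i * u ⟪ is ⟫)))
      ≤⟨ *-monoˡ (0≤ι (suc m)) (sum-mono row) ⟩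
    ι (suc m) * sum (λ i → r * (u i * z i) ^ suc m)
      ≡⟨ cong (ι (suc m) *_) (sum-*ˡ r (λ i → (u i * z i) ^ suc m)) ⟩
    ι (suc m) * (r * sum (λ i → (u i * z i) ^ suc m)) ∎
    where
    open ≤-Reasoning
    sym′ : Symmetric (λ t → c t * u ⟪ t ⟫)
    sym′ is j i = cong₂ _*_ (c-sym is j i) (⟪⟫-insertAt u is j i)
    row : ∀ i → z i ^ suc m * ∑ₜ m (λ is → c (i ∷ is) * (u i * u ⟪ is ⟫)) ≤ r * (u i * z i) ^ suc m
    row i = begin
      z i ^ suc m * ∑ₜ m (λ is → c (i ∷ is) * (u i * u ⟪ is ⟫))
        ≡⟨ cong (z i ^ suc m *_) (∑ₜ-cong m (λ is →
             solve 3 (λ a b c → a :* (b :* c) := b :* (a :* c)) refl (c (i ∷ is)) (u i) (u ⟪ is ⟫))) ⟩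
      z i ^ suc m * ∑ₜ m (λ is → u i * (c (i ∷ is) * u ⟪ is ⟫))
        ≡⟨ cong (z i ^ suc m *_) (∑ₜ-*ˡ m (u i) (λ is → c (i ∷ is) * u ⟪ is ⟫)) ⟩
      z i ^ suc m * (u i * ∑ₜ m (λ is → c (i ∷ is) * u ⟪ is ⟫))
        ≤⟨ *-monoˡ (^-nonneg (suc m) (0≤z i)) (*-monoˡ (0≤u i) (h i)) ⟩
      z i ^ suc m * (u i * (r * u i ^ m))
        ≡⟨ solve 4 (λ zz ui r um → zz :* (ui :* (r :* um)) := r :* ((ui :* um) :* zz)) refl (z i ^ suc m) (u i) r (u i ^ m) ⟩
      r * (u i ^ suc m * z i ^ suc m)
        ≡⟨ cong (r *_) (sym (^-distrib-* (u i) (z i) (suc m))) ⟩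
      r * (u i * z i) ^ suc m ∎

  -- AM-GM is applied to the factors z only, with c u as the weight of a tuple. The loss therefore
  -- vanishes when z is constant, that is, when y is proportional to the test vector.
  collatz′ : ∀ {m n} (c : Vec (Fin n) (suc m) → ℚ) → (∀ t → 0ℚ ≤ c t) → Symmetric c →
             (u z : Fin n → ℚ) → (∀ i → 0ℚ ≤ u i) → (∀ i → 0ℚ ≤ z i) →
             (r : ℚ) → (∀ i → ∑ₜ m (λ is → c (i ∷ is) * u ⟪ is ⟫) ≤ r * u i ^ m) →
             ∑ₜ (suc m) (λ t → c t * (λ i → u i * z i) ⟪ t ⟫) ≤ r * sum (λ i → (u i * z i) ^ suc m)
  collatz′ {m} c 0≤c c-sym u z 0≤u 0≤z r h = *-cancelˡ (0<ι m) (begin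
    ι (suc m) * ∑ₜ (suc m) (λ t → c t * (λ i → u i * z i) ⟪ t ⟫)
      ≡⟨ cong (ι (suc m) *_) (∑ₜ-cong (suc m) (λ t → trans
           (cong (c t *_) (product-* (λ j → u (lookup t j)) (λ j → z (lookup t j))))
           (sym (*-assoc (c t) (u ⟪ t ⟫) (z ⟪ t ⟫))))) ⟩
    ι (suc m) * ∑ₜ (suc m) (λ t → (c t * u ⟪ t ⟫) * z ⟪ t ⟫)
      ≤⟨ ∑ₜ-am-gm (λ t → c t * u ⟪ t ⟫) (λ t → *-nonneg (0≤c t) (product-nonneg (λ j → 0≤u (lookup t j)))) z 0≤z ⟩
    ∑ₜ (suc m) (λ t → (c t * u ⟪ t ⟫) * sum (λ j → z (lookup t j) ^ suc m))
      ≤⟨ collatz c 0≤c c-sym u z 0≤u 0≤z r h ⟩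
    ι (suc m) * (r * sum (λ i → (u i * z i) ^ suc m)) ∎)
    where open ≤-Reasoning

  meets : ∀ {n m} → (Fin n → Bool) → Vec (Fin n) m → Bool
  meets χ [] = false
  meets χ (i ∷ is) = χ i ∨ meets χ is

  -- Union bound over the position of an entry in χ, the other m entries being arbitrary.
  ∑ₜ-meets : ∀ m {n} (χ : Fin n → Bool) (u : Fin n → ℚ) → (∀ i → 0ℚ ≤ u i) →
             ∑ₜ (suc m) (λ t → ⟦ meets χ t ⟧ * u ⟪ t ⟫) ≤ ι (suc m) * (sum (λ i → ⟦ χ i ⟧ * u i) * sum u ^ m)
  ∑ₜ-meets m {n} χ u 0≤u = begin
    ∑ₜ (suc m) (λ t → ⟦ meets χ t ⟧ * u ⟪ t ⟫)
      ≤⟨ sum-mono (λ i → ∑ₜ-mono m (λ is → *-monoʳ (*-nonneg (0≤u i) (product-nonneg (λ j → 0≤u (lookup is j))))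
           (⟦∨⟧≤ (χ i) (meets χ is)))) ⟩
    sum (λ i → ∑ₜ m (λ is → (⟦ χ i ⟧ + ⟦ meets χ is ⟧) * (u i * u ⟪ is ⟫)))
      ≡⟨ sum-cong (λ i → ∑ₜ-cong m (λ is →
           solve 4 (λ a b c d → (a :+ b) :* (c :* d) := (a :* c) :* d :+ c :* (b :* d)) refl ⟦ χ i ⟧ ⟦ meets χ is ⟧ (u i) (u ⟪ is ⟫))) ⟩
    sum (λ i → ∑ₜ m (λ is → (⟦ χ i ⟧ * u i) * u ⟪ is ⟫ + u i * (⟦ meets χ is ⟧ * u ⟪ is ⟫)))
      ≡⟨ sum-cong (λ i → trans (∑ₜ-distrib-+ m _ _) (cong₂ _+_
           (trans (∑ₜ-*ˡ m (⟦ χ i ⟧ * u i) (u ⟪_⟫)) (cong ((⟦ χ i ⟧ * u i) *_) (∑ₜ-product m u)))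
           (∑ₜ-*ˡ m (u i) (λ is → ⟦ meets χ is ⟧ * u ⟪ is ⟫)))) ⟩
    sum (λ i → (⟦ χ i ⟧ * u i) * s ^ m + u i * A m)
      ≡⟨ trans (sum-+ (λ i → (⟦ χ i ⟧ * u i) * s ^ m) (λ i → u i * A m))
           (cong₂ _+_ (sum-*ʳ (s ^ m) (λ i → ⟦ χ i ⟧ * u i)) (sum-*ʳ (A m) u)) ⟩
    c * s ^ m + s * A m
      ≤⟨ +-monoʳ-≤ (c * s ^ m) (rest m) ⟩
    c * s ^ m + ι m * (c * s ^ m)
      ≡⟨ solve 2 (λ a n → a :+ n :* a := (con 1ℚ :+ n) :* a) refl (c * s ^ m) (ι m) ⟩
    ι (suc m) * (c * s ^ m) ∎
    where
    open ≤-Reasoning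
    s c : ℚ
    s = sum u
    c = sum (λ i → ⟦ χ i ⟧ * u i)
    A : ℕ → ℚ
    A l = ∑ₜ l (λ is → ⟦ meets χ is ⟧ * u ⟪ is ⟫)
    rest : ∀ l → s * A l ≤ ι l * (c * s ^ l)
    rest zero = ≤-reflexive (solve 2 (λ s c → s :* (con 0ℚ :* con 1ℚ) := con 0ℚ :* (c :* con 1ℚ)) refl s c)
    rest (suc l) = ≤-trans (*-monoˡ (sum-nonneg 0≤u) (∑ₜ-meets l χ u 0≤u))
      (≤-reflexive (solve 4 (λ s n c p → s :* (n :* (c :* p)) := n :* (c :* (s :* p))) refl s (ι (suc l)) c (s ^ l)))

  -- Bernoulli's inequality 1 - m h ≤ (1 - h)ᵐ, multiplied by xᵐ to avoid quotients.
  bernoulli : ∀ m {h x d} → 0ℚ ≤ h → h ≤ 1ℚ → 0ℚ ≤ x → (1ℚ - h) * x ≤ d → (1ℚ - ι m * h) * x ^ m ≤ d ^ m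
  bernoulli zero {h} 0≤h h≤1 0≤x hx = ≤-reflexive (solve 1 (λ h → (con 1ℚ :- con 0ℚ :* h) :* con 1ℚ := con 1ℚ) refl h)
  bernoulli (suc m) {h} {x} {d} 0≤h h≤1 0≤x hx = begin
    (1ℚ - (1ℚ + ι m) * h) * (x * x ^ m)
      ≤⟨ by-difference (ι m * (h * h) * (x * x ^ m))
           (*-nonneg (*-nonneg (0≤ι m) (square-nonneg h)) (^-nonneg (suc m) 0≤x))
           (solve 4 (λ n h x xm → ((con 1ℚ :- h) :* x) :* ((con 1ℚ :- n :* h) :* xm) :=
              (con 1ℚ :- (con 1ℚ :+ n) :* h) :* (x :* xm) :+ n :* (h :* h) :* (x :* xm)) refl (ι m) h x (x ^ m)) ⟩
    ((1ℚ - h) * x) * ((1ℚ - ι m * h) * x ^ m)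
      ≤⟨ *-monoˡ 0≤hx (bernoulli m 0≤h h≤1 0≤x hx) ⟩
    ((1ℚ - h) * x) * d ^ m
      ≤⟨ *-monoʳ (^-nonneg m (≤-trans 0≤hx hx)) hx ⟩
    d * d ^ m ∎
    where
    open ≤-Reasoning
    0≤hx : 0ℚ ≤ (1ℚ - h) * x
    0≤hx = *-nonneg (0≤q-p h≤1) 0≤x

-- Lower bounds for the number of tuples of distinct vertices

module DistinctTuples where

  open import Data.Rational.Base using (_≤_; _<_)
  open RationalSums
  open TupleInequalities

  adjoin : ∀ {n} → Fin n → (Fin n → Bool) → Fin n → Bool
  adjoin i F j = does (i Fin.≟ j) ∨ F j

  -- F also collects the entries already used, so distinctness and avoidance of a set go through a
  -- single recursion on the tuple.
  fresh : ∀ {n m} → (Fin n → Bool) → Vec (Fin n) m → Bool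
  fresh F [] = true
  fresh F (i ∷ is) = not (F i) ∧ fresh (adjoin i F) is

  size : ∀ {n} → (Fin n → Bool) → ℚ
  size F = sum (λ i → ⟦ F i ⟧)

  0≤size : ∀ {n} (F : Fin n → Bool) → 0ℚ ≤ size F
  0≤size F = sum-nonneg (λ i → 0≤⟦⟧ (F i))

  ∑-singleton : ∀ {n} (i : Fin n) → sum (λ j → ⟦ does (i Fin.≟ j) ⟧) ≡ 1ℚ
  ∑-singleton {suc n} zero = trans (cong (1ℚ +_) (sum-zero {n} (λ _ → refl))) (+-identityʳ 1ℚ)
  ∑-singleton {suc n} (suc i) = trans (+-identityˡ (sum (λ j → ⟦ does (i Fin.≟ j) ⟧))) (∑-singleton i)

  size-∨ : ∀ {n} (F G : Fin n → Bool) → size (λ i → F i ∨ G i) ≤ size F + size G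
  size-∨ F G = ≤-trans (sum-mono (λ i → ⟦∨⟧≤ (F i) (G i)))
    (≤-reflexive (sum-+ (λ i → ⟦ F i ⟧) (λ i → ⟦ G i ⟧)))

  size-adjoin : ∀ {n} i (F : Fin n → Bool) → size (adjoin i F) ≤ 1ℚ + size F
  size-adjoin i F = ≤-trans (size-∨ (λ j → does (i Fin.≟ j)) F) (+-monoˡ-≤ (size F) (≤-reflexive (∑-singleton i)))

  size-complement : ∀ {n} (F : Fin n → Bool) → size F + size (not ∘ F) ≡ ι n
  size-complement {n} F = trans (sym (sum-+ (λ i → ⟦ F i ⟧) (λ i → ⟦ not (F i) ⟧)))
    (trans (sum-cong (λ i → lem (F i))) (trans (sum-const n 1ℚ) (*-identityʳ (ι n))))
    where
    lem : ∀ b → ⟦ b ⟧ + ⟦ not b ⟧ ≡ 1ℚ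
    lem true = refl
    lem false = refl

  d≤size-complement : ∀ {n} (F : Fin n → Bool) {d} → size F + d ≤ ι n → d ≤ size (not ∘ F)
  d≤size-complement F {d} h = +-cancelʳ (size F)
    (subst₂ _≤_ (+-comm (size F) d) (trans (sym (size-complement F)) (+-comm (size F) (size (not ∘ F)))) h)

  -- Fewer than |F| + m vertices are excluded when an entry is chosen, which leaves at least d
  -- choices for each.
  ∑ₜ-fresh : ∀ m {n} (F : Fin n → Bool) {d} → 0ℚ ≤ d → size F + ι m + d ≤ ι n → d ^ m ≤ ∑ₜ m (λ t → ⟦ fresh F t ⟧)
  ∑ₜ-fresh zero F 0≤d h = ≤-refl
  ∑ₜ-fresh (suc m) {n} F {d} 0≤d h = begin
    d * d ^ m
      ≤⟨ *-monoʳ (^-nonneg m 0≤d) (d≤size-complement F (≤-trans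
           (by-difference (ι (suc m)) (0≤ι (suc m)) (solve 3 (λ s m d → (s :+ m) :+ d := (s :+ d) :+ m) refl (size F) (ι (suc m)) d)) h)) ⟩
    size (not ∘ F) * d ^ m
      ≡⟨ sym (sum-*ʳ (d ^ m) (λ i → ⟦ not (F i) ⟧)) ⟩
    sum (λ i → ⟦ not (F i) ⟧ * d ^ m)
      ≤⟨ sum-mono (λ i → *-monoˡ (0≤⟦⟧ (not (F i))) (∑ₜ-fresh m (adjoin i F) 0≤d (step i))) ⟩
    sum (λ i → ⟦ not (F i) ⟧ * ∑ₜ m (λ is → ⟦ fresh (adjoin i F) is ⟧))
      ≡⟨ sum-cong (λ i → trans (sym (∑ₜ-*ˡ m ⟦ not (F i) ⟧ (λ is → ⟦ fresh (adjoin i F) is ⟧)))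
           (∑ₜ-cong m (λ is → sym (⟦∧⟧ (not (F i)) (fresh (adjoin i F) is))))) ⟩
    sum (λ i → ∑ₜ m (λ is → ⟦ not (F i) ∧ fresh (adjoin i F) is ⟧)) ∎
    where
    open ≤-Reasoning
    step : ∀ i → size (adjoin i F) + ι m + d ≤ ι n
    step i = ≤-trans (+-monoˡ-≤ d (+-monoˡ-≤ (ι m) (size-adjoin i F)))
      (≤-trans (≤-reflexive (solve 3 (λ s m d → ((con 1ℚ :+ s) :+ m) :+ d := (s :+ (con 1ℚ :+ m)) :+ d) refl (size F) (ι m) d)) h)

  weight : ∀ {n} → (Fin n → Bool) → ℚ → Fin n → ℚ
  weight W a i = if W i then a else 1ℚ

  weight-≥1 : ∀ {n} (W : Fin n → Bool) {a} → 1ℚ ≤ a → ∀ i → 1ℚ ≤ weight W a i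
  weight-≥1 W 1≤a i with W i
  ... | true = 1≤a
  ... | false = ≤-refl

  weight-≥0 : ∀ {n} (W : Fin n → Bool) {a} → 1ℚ ≤ a → ∀ i → 0ℚ ≤ weight W a i
  weight-≥0 W 1≤a i = ≤-trans 0≤1 (weight-≥1 W 1≤a i)

  1≤weight⟪⟫ : ∀ {n m} (W : Fin n → Bool) {a} → 1ℚ ≤ a → ∀ (t : Vec (Fin n) m) → 1ℚ ≤ weight W a ⟪ t ⟫
  1≤weight⟪⟫ W 1≤a t = 1≤product (λ j → weight-≥1 W 1≤a (lookup t j))

  0≤weight⟪⟫ : ∀ {n m} (W : Fin n → Bool) {a} → 1ℚ ≤ a → ∀ (t : Vec (Fin n) m) → 0ℚ ≤ weight W a ⟪ t ⟫
  0≤weight⟪⟫ W 1≤a t = ≤-trans 0≤1 (1≤weight⟪⟫ W 1≤a t)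

  ∑-weight : ∀ {n} (W : Fin n → Bool) {a} → sum (λ i → ⟦ W i ⟧ * weight W a i) ≡ size W * a
  ∑-weight W {a} = trans (sum-cong lem) (sum-*ʳ a (λ i → ⟦ W i ⟧))
    where
    lem : ∀ i → ⟦ W i ⟧ * weight W a i ≡ ⟦ W i ⟧ * a
    lem i with W i
    ... | true = refl
    ... | false = trans (*-zeroˡ 1ℚ) (sym (*-zeroˡ a))

  sum-weight≤ : ∀ {n} (W : Fin n → Bool) {a} → 0ℚ ≤ a → sum (weight W a) ≤ ι n + size W * a
  sum-weight≤ {n} W {a} 0≤a = begin
    sum (weight W a)
      ≤⟨ sum-mono lem ⟩
    sum (λ i → 1ℚ + ⟦ W i ⟧ * a)
      ≡⟨ trans (sum-+ (λ _ → 1ℚ) (λ i → ⟦ W i ⟧ * a)) (cong₂ _+_ (trans (sum-const n 1ℚ) (*-identityʳ (ι n))) (sum-*ʳ a (λ i → ⟦ W i ⟧))) ⟩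
    ι n + size W * a ∎
    where
    open ≤-Reasoning
    lem : ∀ i → weight W a i ≤ 1ℚ + ⟦ W i ⟧ * a
    lem i with W i
    ... | true = by-difference 1ℚ 0≤1 (solve 1 (λ a → con 1ℚ :+ con 1ℚ :* a := a :+ con 1ℚ) refl a)
    ... | false = p≤p+q (*-nonneg ≤-refl 0≤a)

  -- Split by the first entry: inside W it contributes the factor a and has as many completions as
  -- `∑ₜ-fresh` provides; outside W the induction applies. The additional d on the right stands for
  -- an exponent m - 1 on the left, which would be truncated at m = 0.
  ∑ₜ-fresh-meets : ∀ m {n} (W F : Fin n → Bool) {a d} → (∀ i → W i ≡ true → F i ≡ false) → 1ℚ ≤ a → 0ℚ ≤ d →
                   size W + size F + ι m + d ≤ ι n →
                   ι m * (size W * a) * d ^ m ≤ d * ∑ₜ m (λ t → ⟦ fresh F t ∧ meets W t ⟧ * weight W a ⟪ t ⟫)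
  ∑ₜ-fresh-meets zero W F {a} {d} disj 1≤a 0≤d h = ≤-reflexive
    (solve 3 (λ w a d → con 0ℚ :* (w :* a) :* con 1ℚ := d :* (con 0ℚ :* con 1ℚ)) refl (size W) a d)
  ∑ₜ-fresh-meets (suc m) {n} W F {a} {d} disj 1≤a 0≤d h = begin
    (1ℚ + ι m) * (size W * a) * (d * d ^ m)
      ≡⟨ solve 5 (λ m w a d dm → (con 1ℚ :+ m) :* (w :* a) :* (d :* dm) := w :* (d :* (a :* dm)) :+ d :* (m :* (w :* a) :* dm))
           refl (ι m) (size W) a d (d ^ m) ⟩
    size W * (d * (a * d ^ m)) + d * R
      ≤⟨ +-monoʳ-≤ (size W * (d * (a * d ^ m))) (*-monoʳ 0≤R (d≤size-complement (λ i → F i ∨ W i) room)) ⟩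
    size W * (d * (a * d ^ m)) + size (λ i → not (F i ∨ W i)) * R
      ≡⟨ sym (trans (sum-+ (λ i → ⟦ W i ⟧ * (d * (a * d ^ m))) (λ i → ⟦ not (F i ∨ W i) ⟧ * R))
           (cong₂ _+_ (sum-*ʳ (d * (a * d ^ m)) (λ i → ⟦ W i ⟧)) (sum-*ʳ R (λ i → ⟦ not (F i ∨ W i) ⟧)))) ⟩
    sum (λ i → ⟦ W i ⟧ * (d * (a * d ^ m)) + ⟦ not (F i ∨ W i) ⟧ * R)
      ≤⟨ sum-mono row ⟩
    sum (λ i → d * ∑ₜ m (λ is → ⟦ fresh F (i ∷ is) ∧ meets W (i ∷ is) ⟧ * (weight W a i * weight W a ⟪ is ⟫)))
      ≡⟨ sum-*ˡ d (λ i → ∑ₜ m (λ is → ⟦ fresh F (i ∷ is) ∧ meets W (i ∷ is) ⟧ * (weight W a i * weight W a ⟪ is ⟫))) ⟩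
    d * ∑ₜ (suc m) (λ t → ⟦ fresh F t ∧ meets W t ⟧ * weight W a ⟪ t ⟫) ∎
    where
    open ≤-Reasoning
    0≤a : 0ℚ ≤ a
    0≤a = ≤-trans 0≤1 1≤a
    R : ℚ
    R = ι m * (size W * a) * d ^ m
    0≤R : 0ℚ ≤ R
    0≤R = *-nonneg (*-nonneg (0≤ι m) (*-nonneg (0≤size W) 0≤a)) (^-nonneg m 0≤d)
    room : size (λ i → F i ∨ W i) + d ≤ ι n
    room = ≤-trans (+-monoˡ-≤ d (size-∨ F W)) (≤-trans (by-difference (ι (suc m)) (0≤ι (suc m))
      (solve 4 (λ w f m d → ((w :+ f) :+ m) :+ d := ((f :+ w) :+ d) :+ m) refl (size W) (size F) (ι (suc m)) d)) h)
    room₁ : ∀ i → size (adjoin i F) + ι m + d ≤ ι n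
    room₁ i = ≤-trans (+-monoˡ-≤ d (+-monoˡ-≤ (ι m) (size-adjoin i F)))
      (≤-trans (by-difference (size W) (0≤size W)
        (solve 4 (λ w f m d → ((w :+ f) :+ (con 1ℚ :+ m)) :+ d := (((con 1ℚ :+ f) :+ m) :+ d) :+ w) refl (size W) (size F) (ι m) d)) h)
    room₂ : ∀ i → size W + size (adjoin i F) + ι m + d ≤ ι n
    room₂ i = ≤-trans (+-monoˡ-≤ d (+-monoˡ-≤ (ι m) (+-monoʳ-≤ (size W) (size-adjoin i F))))
      (≤-trans (≤-reflexive
        (solve 4 (λ w f m d → ((w :+ (con 1ℚ :+ f)) :+ m) :+ d := ((w :+ f) :+ (con 1ℚ :+ m)) :+ d) refl (size W) (size F) (ι m) d)) h)
    disj′ : ∀ i → W i ≡ false → ∀ j → W j ≡ true → adjoin i F j ≡ false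
    disj′ i Wi j Wj = cong₂ _∨_ (dec-false (i Fin.≟ j) λ { refl → case trans (sym Wi) Wj of λ () }) (disj j Wj)
    row : ∀ i → ⟦ W i ⟧ * (d * (a * d ^ m)) + ⟦ not (F i ∨ W i) ⟧ * R ≤
                d * ∑ₜ m (λ is → ⟦ fresh F (i ∷ is) ∧ meets W (i ∷ is) ⟧ * (weight W a i * weight W a ⟪ is ⟫))
    row i with W i in Wi | F i in Fi
    ... | true | true = case trans (sym Fi) (disj i Wi) of λ ()
    ... | true | false = begin
      1ℚ * (d * (a * d ^ m)) + 0ℚ * R
        ≡⟨ solve 4 (λ d a dm R → con 1ℚ :* (d :* (a :* dm)) :+ con 0ℚ :* R := d :* (a :* dm)) refl d a (d ^ m) R ⟩
      d * (a * d ^ m)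
        ≤⟨ *-monoˡ 0≤d (*-monoˡ 0≤a (∑ₜ-fresh m (adjoin i F) 0≤d (room₁ i))) ⟩
      d * (a * ∑ₜ m (λ is → ⟦ fresh (adjoin i F) is ⟧))
        ≡⟨ cong (d *_) (sym (∑ₜ-*ˡ m a _)) ⟩
      d * ∑ₜ m (λ is → a * ⟦ fresh (adjoin i F) is ⟧)
        ≤⟨ *-monoˡ 0≤d (∑ₜ-mono m (λ is → ≤-trans
             (≤-reflexive (solve 2 (λ a b → a :* b := b :* (a :* con 1ℚ)) refl a ⟦ fresh (adjoin i F) is ⟧))
             (≤-trans (*-monoˡ (0≤⟦⟧ (fresh (adjoin i F) is)) (*-monoˡ 0≤a (1≤weight⟪⟫ W 1≤a is)))
               (≤-reflexive (cong (λ b → ⟦ b ⟧ * (a * weight W a ⟪ is ⟫)) (sym (Bool.∧-identityʳ (fresh (adjoin i F) is)))))))) ⟩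
      d * ∑ₜ m (λ is → ⟦ fresh (adjoin i F) is ∧ true ⟧ * (a * weight W a ⟪ is ⟫)) ∎
    ... | false | true = ≤-trans (≤-reflexive (solve 2 (λ x y → con 0ℚ :* x :+ con 0ℚ :* y := con 0ℚ) refl (d * (a * d ^ m)) R))
      (*-nonneg 0≤d (∑ₜ-nonneg m (λ is → *-nonneg ≤-refl (*-nonneg 0≤1 (0≤weight⟪⟫ W 1≤a is)))))
    ... | false | false = begin
      0ℚ * (d * (a * d ^ m)) + 1ℚ * R
        ≡⟨ solve 2 (λ x y → con 0ℚ :* x :+ con 1ℚ :* y := y) refl (d * (a * d ^ m)) R ⟩
      R
        ≤⟨ ∑ₜ-fresh-meets m W (adjoin i F) (disj′ i Wi) 1≤a 0≤d (room₂ i) ⟩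
      d * ∑ₜ m (λ is → ⟦ fresh (adjoin i F) is ∧ meets W is ⟧ * weight W a ⟪ is ⟫)
        ≡⟨ cong (d *_) (∑ₜ-cong m (λ is → cong (⟦ fresh (adjoin i F) is ∧ meets W is ⟧ *_) (sym (*-identityˡ (weight W a ⟪ is ⟫))))) ⟩
      d * ∑ₜ m (λ is → ⟦ fresh (adjoin i F) is ∧ meets W is ⟧ * (1ℚ * weight W a ⟪ is ⟫)) ∎

-- Supports of tuples, relabelling, and the rows of the tensor of S

module CrossingTuples where

  open import Data.Rational.Base using (_≤_; _<_)
  open import Data.Fin.Subset using (∣_∣; ⊥)
  open RationalSums
  open TupleInequalities
  open DistinctTuples

  ι∣∣ : ∀ {n} (p : Subset n) → ι ∣ p ∣ ≡ size (lookup p)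
  ι∣∣ [] = refl
  ι∣∣ (true ∷ p) = cong (1ℚ +_) (ι∣∣ p)
  ι∣∣ (false ∷ p) = trans (ι∣∣ p) (sym (+-identityˡ (size (lookup p))))

  ι-injective : ∀ {m n} → ι m ≡ ι n → m ≡ n
  ι-injective eq = ℕ.≤-antisym (ι-cancel (≤-reflexive eq)) (ι-cancel (≤-reflexive (sym eq)))

  ∣∪∣≤ : ∀ {n} (p q : Subset n) → ∣ p ∪ q ∣ ℕ.≤ ∣ p ∣ ℕ.+ ∣ q ∣
  ∣∪∣≤ p q = ι-cancel (begin
    ι ∣ p ∪ q ∣                         ≡⟨ ι∣∣ (p ∪ q) ⟩
    size (lookup (p ∪ q))               ≡⟨ sum-cong (λ i → cong ⟦_⟧ (lookup-zipWith _∨_ i p q)) ⟩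
    size (λ i → lookup p i ∨ lookup q i) ≤⟨ size-∨ (lookup p) (lookup q) ⟩
    size (lookup p) + size (lookup q)   ≡⟨ cong₂ _+_ (sym (ι∣∣ p)) (sym (ι∣∣ q)) ⟩
    ι ∣ p ∣ + ι ∣ q ∣                   ≡⟨ sym (ι-+ ∣ p ∣ ∣ q ∣) ⟩
    ι (∣ p ∣ ℕ.+ ∣ q ∣)                 ∎)
    where open ≤-Reasoning

  ∈-support⁻ : ∀ {n m} (t : Vec (Fin n) m) {i} → i ∈ support t → ∃ λ j → lookup t j ≡ i
  ∈-support⁻ [] i∈ = contradiction i∈ ∉⊥
  ∈-support⁻ (x ∷ t) i∈ with x∈p∪q⁻ ⁅ x ⁆ (support t) i∈
  ... | inj₁ p = zero , sym (x∈⁅y⁆⇒x≡y x p)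
  ... | inj₂ q = let j , eq = ∈-support⁻ t q in suc j , eq

  ∈-support⁺ : ∀ {n m} (t : Vec (Fin n) m) j → lookup t j ∈ support t
  ∈-support⁺ (x ∷ t) zero = x∈p∪q⁺ (inj₁ (x∈⁅x⁆ x))
  ∈-support⁺ (x ∷ t) (suc j) = x∈p∪q⁺ (inj₂ (∈-support⁺ t j))

  support-insertAt : ∀ {n m} (t : Vec (Fin n) m) j i → support (insertAt t j i) ≡ support (i ∷ t)
  support-insertAt t zero i = refl
  support-insertAt {n} (x ∷ t) (suc j) i = begin
    ⁅ x ⁆ ∪ support (insertAt t j i) ≡⟨ cong (⁅ x ⁆ ∪_) (support-insertAt t j i) ⟩
    ⁅ x ⁆ ∪ (⁅ i ⁆ ∪ support t)      ≡⟨ sym (∪-assoc _ _ _) ⟩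
    (⁅ x ⁆ ∪ ⁅ i ⁆) ∪ support t      ≡⟨ cong (_∪ support t) (∪-comm _ _) ⟩
    (⁅ i ⁆ ∪ ⁅ x ⁆) ∪ support t      ≡⟨ ∪-assoc _ _ _ ⟩
    ⁅ i ⁆ ∪ (⁅ x ⁆ ∪ support t)      ∎
    where open ≡-Reasoning

  meets-insertAt : ∀ {n m} (χ : Fin n → Bool) (t : Vec (Fin n) m) j i → meets χ (insertAt t j i) ≡ meets χ (i ∷ t)
  meets-insertAt χ t zero i = refl
  meets-insertAt χ (x ∷ t) (suc j) i = begin
    χ x ∨ meets χ (insertAt t j i) ≡⟨ cong (χ x ∨_) (meets-insertAt χ t j i) ⟩
    χ x ∨ (χ i ∨ meets χ t)        ≡⟨ sym (Bool.∨-assoc (χ x) (χ i) _) ⟩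
    (χ x ∨ χ i) ∨ meets χ t        ≡⟨ cong (_∨ meets χ t) (Bool.∨-comm (χ x) (χ i)) ⟩
    (χ i ∨ χ x) ∨ meets χ t        ≡⟨ Bool.∨-assoc (χ i) (χ x) _ ⟩
    χ i ∨ (χ x ∨ meets χ t)        ∎
    where open ≡-Reasoning

  ∈⇒lookup : ∀ {n} {p : Subset n} {i} → i ∈ p → lookup p i ≡ true
  ∈⇒lookup = []=⇒lookup

  lookup⇒∈ : ∀ {n} {p : Subset n} {i} → lookup p i ≡ true → i ∈ p
  lookup⇒∈ {p = p} {i} = lookup⇒[]= i p

  meets⁻ : ∀ {n m} (χ : Fin n → Bool) (t : Vec (Fin n) m) → meets χ t ≡ true → ∃ λ j → χ (lookup t j) ≡ true
  meets⁻ χ (i ∷ t) h with χ i in χi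
  ... | true = zero , χi
  ... | false = let j , p = meets⁻ χ t h in suc j , p

  meets⁺ : ∀ {n m} (χ : Fin n → Bool) (t : Vec (Fin n) m) j → χ (lookup t j) ≡ true → meets χ t ≡ true
  meets⁺ χ (i ∷ t) zero h = cong (_∨ meets χ t) h
  meets⁺ χ (i ∷ t) (suc j) h = trans (cong (χ i ∨_) (meets⁺ χ t j h)) (Bool.∨-zeroʳ (χ i))

  meets-∩⁺ : ∀ {n m} (t : Vec (Fin n) m) (W : Subset n) → Nonempty (support t ∩ W) → meets (lookup W) t ≡ true
  meets-∩⁺ t W (i , i∈) with x∈p∩q⁻ (support t) W i∈
  ... | i∈t , i∈W with ∈-support⁻ t i∈t
  ... | j , refl = meets⁺ (lookup W) t j (∈⇒lookup i∈W)

  meets-∩⁻ : ∀ {n m} (t : Vec (Fin n) m) (W : Subset n) → meets (lookup W) t ≡ true → Nonempty (support t ∩ W)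
  meets-∩⁻ t W h with meets⁻ (lookup W) t h
  ... | j , p = lookup t j , x∈p∩q⁺ (∈-support⁺ t j , lookup⇒∈ p)

  fresh-∉ : ∀ {n m} (F : Fin n → Bool) (t : Vec (Fin n) m) → fresh F t ≡ true → ∀ {i} → F i ≡ true → i ∉ support t
  fresh-∉ F [] h Fi i∈ = ∉⊥ i∈
  fresh-∉ F (x ∷ t) h {i} Fi i∈ with F x in Fx | x∈p∪q⁻ ⁅ x ⁆ (support t) i∈
  ... | false | inj₁ p with x∈⁅y⁆⇒x≡y x p
  ... | refl = case trans (sym Fx) Fi of λ ()
  fresh-∉ F (x ∷ t) h {i} Fi i∈ | false | inj₂ q =
    fresh-∉ (adjoin x F) t h (trans (cong (does (x Fin.≟ i) ∨_) Fi) (Bool.∨-zeroʳ _)) q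

  ∣⁅⁆∪∣ : ∀ {n} (i : Fin n) (p : Subset n) → i ∉ p → ∣ ⁅ i ⁆ ∪ p ∣ ≡ suc ∣ p ∣
  ∣⁅⁆∪∣ i p i∉p = ℕ.≤-antisym
    (ℕ.≤-trans (∣∪∣≤ ⁅ i ⁆ p) (ℕ.≤-reflexive (cong (ℕ._+ ∣ p ∣) (∣⁅x⁆∣≡1 i))))
    (p⊂q⇒∣p∣<∣q∣ (q⊆p∪q ⁅ i ⁆ p , i , x∈p∪q⁺ (inj₁ (x∈⁅x⁆ i)) , i∉p))

  fresh-∣∣ : ∀ {n m} (F : Fin n → Bool) (t : Vec (Fin n) m) → fresh F t ≡ true → ∣ support t ∣ ≡ m
  fresh-∣∣ {n} F [] h = ∣⊥∣≡0 n
  fresh-∣∣ F (x ∷ t) h with F x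
  ... | false = trans (∣⁅⁆∪∣ x (support t) (fresh-∉ (adjoin x F) t h (cong (_∨ F x) (dec-true (x Fin.≟ x) refl))))
                      (cong suc (fresh-∣∣ (adjoin x F) t h))

  ∈-image⁻ : ∀ {n} (π : Permutation′ n) (e : Subset n) {j} → j ∈ image π e → (π ⟨$⟩ˡ j) ∈ e
  ∈-image⁻ π e {j} h = lookup⇒∈ (trans (sym (lookup∘tabulate (λ j → lookup e (π ⟨$⟩ˡ j)) j)) (∈⇒lookup h))

  ∈-image⁺ : ∀ {n} (π : Permutation′ n) (e : Subset n) {j} → (π ⟨$⟩ˡ j) ∈ e → j ∈ image π e
  ∈-image⁺ π e {j} h = lookup⇒∈ (trans (lookup∘tabulate (λ j → lookup e (π ⟨$⟩ˡ j)) j) (∈⇒lookup h))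

  support-map : ∀ {n m} (π : Permutation′ n) (t : Vec (Fin n) m) → support (Vec.map (π ⟨$⟩ʳ_) t) ≡ image π (support t)
  support-map π t = ⊆-antisym
    (λ i∈ → let j , eq = ∈-support⁻ (Vec.map (π ⟨$⟩ʳ_) t) i∈ in ∈-image⁺ π (support t)
       (subst (_∈ support t) (trans (sym (Perm.inverseˡ π)) (cong (π ⟨$⟩ˡ_) (trans (sym (lookup-map j (π ⟨$⟩ʳ_) t)) eq))) (∈-support⁺ t j)))
    (λ {i} i∈ → let j , eq = ∈-support⁻ t (∈-image⁻ π (support t) i∈) in
       subst (_∈ support (Vec.map (π ⟨$⟩ʳ_) t)) (trans (lookup-map j (π ⟨$⟩ʳ_) t) (trans (cong (π ⟨$⟩ʳ_) eq) (Perm.inverseʳ π)))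
         (∈-support⁺ (Vec.map (π ⟨$⟩ʳ_) t) j))

  ∣image∣ : ∀ {n} (π : Permutation′ n) (e : Subset n) → ∣ image π e ∣ ≡ ∣ e ∣
  ∣image∣ π e = ι-injective (begin
    ι ∣ image π e ∣                 ≡⟨ ι∣∣ (image π e) ⟩
    size (lookup (image π e))       ≡⟨ sum-cong (λ j → cong ⟦_⟧ (lookup∘tabulate (λ j → lookup e (π ⟨$⟩ˡ j)) j)) ⟩
    sum (λ j → ⟦ lookup e (π ⟨$⟩ˡ j) ⟧) ≡⟨ sym (sum-permute (λ i → ⟦ lookup e i ⟧) (Perm.flip π)) ⟩
    size (lookup e)                 ≡⟨ sym (ι∣∣ e) ⟩
    ι ∣ e ∣                         ∎)
    where open ≡-Reasoning

  meets-map : ∀ {n m} (χ : Fin n → Bool) (f : Fin n → Fin n) (t : Vec (Fin n) m) → meets χ (Vec.map f t) ≡ meets (χ ∘ f) t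
  meets-map χ f [] = refl
  meets-map χ f (i ∷ t) = cong (χ (f i) ∨_) (meets-map χ f t)

  meets-cong : ∀ {n m} {χ ψ : Fin n → Bool} → (∀ i → χ i ≡ ψ i) → (t : Vec (Fin n) m) → meets χ t ≡ meets ψ t
  meets-cong h [] = refl
  meets-cong h (i ∷ t) = cong₂ _∨_ (h i) (meets-cong h t)

  spans : ∀ {n k} → Vec (Fin n) k → Bool
  spans {k = k} t = does (∣ support t ∣ ℕ.≟ k)

  crossing : ∀ {n k} → (Fin n → Bool) → Vec (Fin n) k → Bool
  crossing W t = spans t ∧ meets W t

  crossing-insertAt : ∀ {n m} (W : Fin n → Bool) (t : Vec (Fin n) m) j i → crossing W (insertAt t j i) ≡ crossing W (i ∷ t)
  crossing-insertAt {m = m} W t j i =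
    cong₂ _∧_ (cong (λ e → does (∣ e ∣ ℕ.≟ suc m)) (support-insertAt t j i)) (meets-insertAt W t j i)

  crossing-map : ∀ {n k} (W : Fin n → Bool) (π : Permutation′ n) (t : Vec (Fin n) k) →
                 crossing W (Vec.map (π ⟨$⟩ʳ_) t) ≡ crossing (W ∘ (π ⟨$⟩ʳ_)) t
  crossing-map {k = k} W π t = cong₂ _∧_
    (cong (λ s → does (s ℕ.≟ k)) (trans (cong ∣_∣ (support-map π t)) (∣image∣ π (support t))))
    (meets-map W (π ⟨$⟩ʳ_) t)

  -- The left-hand side of the eigenvalue equation of S at the vertex i, up to
  -- the factor (k − 1)!, for the vector with entries a on W and 1 elsewhere.
  link : ∀ {n} m → (Fin n → Bool) → ℚ → Fin n → ℚ
  link m W a i = ∑ₜ m (λ is → ⟦ crossing W (i ∷ is) ⟧ * weight W a ⟪ is ⟫)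

  link-permute : ∀ {n} m (W : Fin n → Bool) a (π : Permutation′ n) i →
                 link m W a (π ⟨$⟩ʳ i) ≡ link m (W ∘ (π ⟨$⟩ʳ_)) a i
  link-permute m W a π i = trans (∑ₜ-permute m _ π) (∑ₜ-cong m (λ is →
    cong₂ _*_ (cong ⟦_⟧ (crossing-map W π (i ∷ is)))
      (product-cong (λ j → cong (weight W a) (lookup-map j (π ⟨$⟩ʳ_) is)))))

  link-cong : ∀ {n} m {W V : Fin n → Bool} → (∀ i → W i ≡ V i) → ∀ a i → link m W a i ≡ link m V a i
  link-cong m h a i = ∑ₜ-cong m (λ is → cong₂ _*_
    (cong (λ b → ⟦ spans (i ∷ is) ∧ b ⟧) (meets-cong h (i ∷ is)))
    (product-cong (λ j → cong (λ b → if b then a else 1ℚ) (h (lookup is j)))))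

  -- The transposition of i and j preserves W. So `link` has only two values, one on W and one off
  -- W, and the eigenvalue equation of S reduces to two scalar equations.
  link-const : ∀ {n} m (W : Fin n → Bool) a i j → W i ≡ W j → link m W a i ≡ link m W a j
  link-const m W a i j Wi≡Wj = trans (sym (cong (link m W a) π-i)) (trans (link-permute m W a (Perm.transpose j i) j) (link-cong m inv a j))
    where
    π-i : Perm.transpose j i ⟨$⟩ʳ j ≡ i
    π-i rewrite dec-true (j Fin.≟ j) refl = refl
    inv : ∀ l → W (Perm.transpose j i ⟨$⟩ʳ l) ≡ W l
    inv l with l Fin.≟ j
    ... | yes refl = Wi≡Wj
    ... | no _ with l Fin.≟ i
    ...   | yes refl = sym Wi≡Wj
    ...   | no _ = refl

  -- It suffices to count the tuples of distinct vertices outside W, of weight at least 1 each; as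
  -- long as a is small against n they form the main term.
  link-in-≥ : ∀ {n} m (W : Fin n → Bool) {a d} i → W i ≡ true → 1ℚ ≤ a → 0ℚ ≤ d → size W + ι m + d ≤ ι n → d ^ m ≤ link m W a i
  link-in-≥ m W {a} {d} i Wi 1≤a 0≤d h = ≤-trans (∑ₜ-fresh m W 0≤d h) (∑ₜ-mono m λ is →
    subst (_≤ ⟦ crossing W (i ∷ is) ⟧ * weight W a ⟪ is ⟫) (*-identityʳ ⟦ fresh W is ⟧) (*-mono (0≤⟦⟧ (fresh W is)) (0≤weight⟪⟫ W 1≤a is) (⟦⟧-mono (fr is)) (1≤weight⟪⟫ W 1≤a is)))
    where
    fr : ∀ is → fresh W is ≡ true → crossing W (i ∷ is) ≡ true
    fr is h = cong₂ _∧_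
      (dec-true (∣ support (i ∷ is) ∣ ℕ.≟ suc m) (trans (∣⁅⁆∪∣ i (support is) (fresh-∉ W is h Wi)) (cong suc (fresh-∣∣ W is h))))
      (cong (_∨ meets W is) Wi)

  link-out-≥ : ∀ {n} m (W : Fin n → Bool) {a d} i → W i ≡ false → 1ℚ ≤ a → 0ℚ < d → size W + 1ℚ + ι (suc m) + d ≤ ι n →
               ι (suc m) * (size W * a) * d ^ m ≤ link (suc m) W a i
  link-out-≥ {n} m W {a} {d} i Wi 1≤a 0<d h = *-cancelˡ 0<d (begin
    d * (ι (suc m) * (size W * a) * d ^ m)
      ≡⟨ solve 3 (λ d x y → d :* (x :* y) := x :* (d :* y)) refl d (ι (suc m) * (size W * a)) (d ^ m) ⟩
    ι (suc m) * (size W * a) * d ^ suc m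
      ≤⟨ ∑ₜ-fresh-meets (suc m) W F disj 1≤a (<⇒≤ 0<d) room ⟩
    d * ∑ₜ (suc m) (λ t → ⟦ fresh F t ∧ meets W t ⟧ * weight W a ⟪ t ⟫)
      ≤⟨ *-monoˡ (<⇒≤ 0<d) (∑ₜ-mono (suc m) (λ is → *-monoʳ (0≤weight⟪⟫ W 1≤a is) (⟦⟧-mono (fr is)))) ⟩
    d * link (suc m) W a i ∎)
    where
    open ≤-Reasoning
    F : Fin n → Bool
    F = adjoin i (λ _ → false)
    Fi : F i ≡ true
    Fi = cong (_∨ false) (dec-true (i Fin.≟ i) refl)
    disj : ∀ j → W j ≡ true → F j ≡ false
    disj j Wj = cong (_∨ false) (dec-false (i Fin.≟ j) λ { refl → case trans (sym Wi) Wj of λ () })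
    room : size W + size F + ι (suc m) + d ≤ ι n
    room = ≤-trans (+-monoˡ-≤ d (+-monoˡ-≤ (ι (suc m)) (+-monoʳ-≤ (size W) (≤-trans (size-adjoin i (λ _ → false))
      (≤-reflexive (trans (cong (1ℚ +_) (sum-zero {n} (λ _ → refl))) (+-identityʳ 1ℚ))))))) h
    fr : ∀ is → fresh F is ∧ meets W is ≡ true → crossing W (i ∷ is) ≡ true
    fr is h with fresh F is in fris | meets W is
    ... | true | true = cong₂ _∧_
      (dec-true (∣ support (i ∷ is) ∣ ℕ.≟ suc (suc m)) (trans (∣⁅⁆∪∣ i (support is) (fresh-∉ F is fris Fi)) (cong suc (fresh-∣∣ F is fris))))
      (Bool.∨-zeroʳ (W i))

  link-≤ : ∀ {n} m (W : Fin n → Bool) {a} i → 1ℚ ≤ a → link m W a i ≤ sum (weight W a) ^ m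
  link-≤ m W {a} i 1≤a = ≤-trans
    (∑ₜ-mono m (λ is → subst (⟦ crossing W (i ∷ is) ⟧ * weight W a ⟪ is ⟫ ≤_) (*-identityˡ _)
      (*-monoʳ (0≤weight⟪⟫ W 1≤a is) (⟦⟧≤1 (crossing W (i ∷ is))))))
    (≤-reflexive (∑ₜ-product m (weight W a)))

  -- Since i is outside W, one of the remaining entries must be in W, and the union bound applies to
  -- its position.
  link-out-≤ : ∀ {n} m (W : Fin n → Bool) {a} i → W i ≡ false → 1ℚ ≤ a →
               link (suc m) W a i ≤ ι (suc m) * (size W * a * sum (weight W a) ^ m)
  link-out-≤ m W {a} i Wi 1≤a = ≤-trans
    (∑ₜ-mono (suc m) (λ is → *-monoʳ (0≤weight⟪⟫ W 1≤a is) (⟦⟧-mono (cr is))))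
    (≤-trans (∑ₜ-meets m W (weight W a) (weight-≥0 W 1≤a))
      (≤-reflexive (cong (λ c → ι (suc m) * (c * sum (weight W a) ^ m)) (∑-weight W {a}))))
    where
    cr : ∀ is → crossing W (i ∷ is) ≡ true → meets W is ≡ true
    cr is h with spans (i ∷ is)
    ... | true = trans (cong (_∨ meets W is) (sym Wi)) h

-- The range of a in which upper and lower estimates of a row agree

module Regimes where

  open import Data.Rational.Base using (_≤_; _<_)
  open RationalSums
  open TupleInequalities

  -- D bounds from below the number of choices for each further entry of a tuple
  -- of distinct vertices, X from above the total weight of the vertices; for
  -- a = o(n) the two agree to first order, which X^≤D^ quantifies.
  record Regime (l β n : ℕ) (a h : ℚ) : Set where
    field
      1≤b : 1ℚ ≤ ι β
      1≤a : 1ℚ ≤ a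
      0<h : 0ℚ < h
      8bh≡1 : ι 8 * ι β * h ≡ 1ℚ
      a-small : ι 32 * ι β * ι β * ι (suc l) * a ≤ ι n
      n-large : ι 16 * ι β * ι (suc l) * (ι β + 1ℚ + ι (suc l)) ≤ ι n

    b M N c D X : ℚ
    b = ι β
    M = ι (suc l)
    N = ι n
    c = b + 1ℚ + M
    D = N - c
    X = N + ι 2 * b * a

    0≤h : 0ℚ ≤ h
    0≤h = <⇒≤ 0<h

    0≤b : 0ℚ ≤ b
    0≤b = 0≤ι β

    0≤a : 0ℚ ≤ a
    0≤a = ≤-trans 0≤1 1≤a

    0≤N : 0ℚ ≤ N
    0≤N = 0≤ι n

    0≤2ba : 0ℚ ≤ ι 2 * b * a
    0≤2ba = *-nonneg (*-nonneg (0≤ι 2) 0≤b) 0≤a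

    N≤X : N ≤ X
    N≤X = p≤p+q 0≤2ba

    0≤X : 0ℚ ≤ X
    0≤X = ≤-trans 0≤N N≤X

    8h≤1 : ι 8 * h ≤ 1ℚ
    8h≤1 = subst (ι 8 * h ≤_) 8bh≡1 (by-difference (ι 8 * h * (b - 1ℚ)) (*-nonneg (*-nonneg (0≤ι 8) 0≤h) (0≤q-p 1≤b))
      (solve 2 (λ b h → con (ι 8) :* b :* h := con (ι 8) :* h :+ con (ι 8) :* h :* (b :- con 1ℚ)) refl b h))

    0≤1-8h : 0ℚ ≤ 1ℚ - ι 8 * h
    0≤1-8h = 0≤q-p 8h≤1

    h≤1 : h ≤ 1ℚ
    h≤1 = ≤-trans (by-difference (ι 7 * h) (*-nonneg (0≤ι 7) 0≤h)
      (solve 1 (λ h → con (ι 8) :* h := h :+ con (ι 7) :* h) refl h)) 8h≤1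

    0≤1-h : 0ℚ ≤ 1ℚ - h
    0≤1-h = 0≤q-p h≤1

    1≤M : 1ℚ ≤ M
    1≤M = 1≤ι l

    0≤M : 0ℚ ≤ M
    0≤M = 0≤ι (suc l)

    1≤N : 1ℚ ≤ N
    1≤N = ≤-trans (≤-trans 1≤M (by-difference (b + 1ℚ) (+-nonneg 0≤b 0≤1)
      (solve 2 (λ b M → b :+ con 1ℚ :+ M := M :+ (b :+ con 1ℚ)) refl b M)))
      (≤-trans (≤-reflexive (sym (*-identityˡ c)))
        (≤-trans (*-monoʳ (+-nonneg (+-nonneg 0≤b 0≤1) 0≤M) one≤) n-large))
      where
      one≤ : 1ℚ ≤ ι 16 * b * M
      one≤ = *-mono 0≤1 0≤M (*-mono 0≤1 0≤b (1≤ι 15) 1≤b) 1≤M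

    0<X : 0ℚ < X
    0<X = <-≤-trans 0<1 (≤-trans 1≤N N≤X)

    X≤2N : X ≤ ι 2 * N
    X≤2N = ≤-trans (+-monoʳ-≤ N 2ba≤N) (≤-reflexive (solve 1 (λ N → N :+ N := con (ι 2) :* N) refl N))
      where
      2ba≤N : ι 2 * b * a ≤ N
      2ba≤N = ≤-trans (*-monoʳ 0≤a (≤-trans (*-monoʳ {b} 0≤b (ι-mono {2} {32} (ℕ.s≤s (ℕ.s≤s ℕ.z≤n))))
        (≤-trans (≤-reflexive (solve 1 (λ b → con (ι 32) :* b := con (ι 32) :* b :* con 1ℚ :* con 1ℚ) refl b))
          (*-mono (*-nonneg (*-nonneg (0≤ι 32) 0≤b) 0≤1) 0≤M
            (*-monoˡ (*-nonneg (0≤ι 32) 0≤b) 1≤b) 1≤M)))) a-small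

    -- Bernoulli with h′ = h / M reduces this to (1 - h′) X ≤ D. As 8 b M h′ = 1, the hypotheses
    -- `a-small` and `n-large` say that 2 b a and c are each at most N h′ / 2, and X - D is their
    -- sum.
    X^≤D^ : ∀ j → j ℕ.≤ suc l → (1ℚ - h) * X ^ j ≤ D ^ j
    X^≤D^ j j≤m = ≤-trans (*-monoʳ (^-nonneg j 0≤X) 1-h≤) (bernoulli j 0≤h′ h′≤1 0≤X base)
      where
      inverse : ∃ λ r → 0ℚ < r × M * r ≡ 1ℚ
      inverse = recip (0<ι l)
      h′ : ℚ
      h′ = h * proj₁ inverse
      0≤h′ : 0ℚ ≤ h′
      0≤h′ = *-nonneg 0≤h (<⇒≤ (proj₁ (proj₂ inverse)))
      Mh′≡h : M * h′ ≡ h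
      Mh′≡h = trans (solve 3 (λ M h r → M :* (h :* r) := h :* (M :* r)) refl M h (proj₁ inverse))
        (trans (cong (h *_) (proj₂ (proj₂ inverse))) (*-identityʳ h))
      h′≤h : h′ ≤ h
      h′≤h = subst (h′ ≤_) Mh′≡h (subst (_≤ M * h′) (*-identityˡ h′) (*-monoʳ 0≤h′ 1≤M))
      h′≤1 : h′ ≤ 1ℚ
      h′≤1 = ≤-trans h′≤h h≤1
      1-h≤ : 1ℚ - h ≤ 1ℚ - ι j * h′
      1-h≤ = +-monoʳ-≤ 1ℚ (ℚ.neg-antimono-≤ (subst (ι j * h′ ≤_) Mh′≡h (*-monoʳ 0≤h′ (ι-mono j≤m))))
      8bMh′≡1 : ι 8 * b * M * h′ ≡ 1ℚ
      8bMh′≡1 = trans (*-assoc (ι 8 * b) M h′) (trans (cong (ι 8 * b *_) Mh′≡h) 8bh≡1)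
      from-a : ι 4 * b * a ≤ N * h′
      from-a = subst (_≤ N * h′) (trans
        (solve 4 (λ b M a h → con (ι 32) :* b :* b :* M :* a :* h := con (ι 4) :* b :* a :* (con (ι 8) :* b :* M :* h)) refl b M a h′)
        (trans (cong (ι 4 * b * a *_) 8bMh′≡1) (*-identityʳ (ι 4 * b * a)))) (*-monoʳ 0≤h′ a-small)
      from-n : ι 2 * c ≤ N * h′
      from-n = subst (_≤ N * h′) (trans
        (solve 4 (λ b M c h → con (ι 16) :* b :* M :* c :* h := con (ι 2) :* c :* (con (ι 8) :* b :* M :* h)) refl b M c h′)
        (trans (cong (ι 2 * c *_) 8bMh′≡1) (*-identityʳ (ι 2 * c)))) (*-monoʳ 0≤h′ n-large)
      base : (1ℚ - h′) * X ≤ D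
      base = *-cancelˡ (0<ι 1) (by-difference
        ((N * h′ - ι 4 * b * a) + (N * h′ - ι 2 * c) + ι 2 * (h′ * (ι 2 * b * a)))
        (+-nonneg (+-nonneg (0≤q-p from-a) (0≤q-p from-n)) (*-nonneg (0≤ι 2) (*-nonneg 0≤h′ 0≤2ba)))
        (solve 5 (λ N b a c h →
           con (ι 2) :* (N :- c) :=
           con (ι 2) :* ((con 1ℚ :- h) :* (N :+ con (ι 2) :* b :* a)) :+
           ((N :* h :- con (ι 4) :* b :* a) :+ (N :* h :- con (ι 2) :* c) :+ con (ι 2) :* (h :* (con (ι 2) :* b :* a))))
          refl N b a c h′))

    0<1-h : 0ℚ < 1ℚ - h
    0<1-h = 0<q-p (<-≤-trans (subst₂ _<_ (+-identityˡ h)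
      (solve 1 (λ h → con (ι 7) :* h :+ h := con (ι 8) :* h) refl h)
      (+-monoˡ-< h (*-pos (0<ι 6) 0<h))) 8h≤1)

    0<D : 0ℚ < D
    0<D = <-≤-trans (*-pos 0<1-h 0<X) (subst₂ _≤_ (cong ((1ℚ - h) *_) (*-identityʳ X)) (*-identityʳ D) (X^≤D^ 1 (ℕ.s≤s ℕ.z≤n)))

    0≤D : 0ℚ ≤ D
    0≤D = <⇒≤ 0<D

-- A gap below ρ(S) for the edges meeting fewer than β vertices

module SpectralGap where

  open import Data.Rational.Base using (_≤_; _<_)
  open RationalSums
  open TupleInequalities
  open DistinctTuples
  open CrossingTuples
  open Regimes

  -- The vector y / `weight W a` when r is the inverse of a.
  quotient : ∀ {n} → (Fin n → Bool) → ℚ → (Fin n → ℚ) → Fin n → ℚ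
  quotient W r y i = if W i then r * y i else y i

  quotient-nonneg : ∀ {n} (W : Fin n → Bool) {r} {y : Fin n → ℚ} → 0ℚ ≤ r → (∀ i → 0ℚ ≤ y i) → ∀ i → 0ℚ ≤ quotient W r y i
  quotient-nonneg W 0≤r 0≤y i with W i
  ... | true = *-nonneg 0≤r (0≤y i)
  ... | false = 0≤y i

  weight-quotient : ∀ {n} (W : Fin n → Bool) {a r} (y : Fin n → ℚ) → a * r ≡ 1ℚ → ∀ i → weight W a i * quotient W r y i ≡ y i
  weight-quotient W {a} {r} y ar≡1 i with W i
  ... | true = trans (sym (*-assoc a r (y i))) (trans (cong (_* y i) ar≡1) (*-identityˡ (y i)))
  ... | false = *-identityˡ (y i)

  -- With V at most one vertex smaller than β, the test vector with entries
  -- (1 + 4h) a on V and 1 elsewhere beats Λ by the factor 1 − h: on V because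
  -- the entry has grown, off V because V has lost a vertex.
  gap : ∀ {l β n a h Λ} (R : Regime l β n a h) → let open Regime R in
        D ^ suc l ≤ Λ * a ^ suc l → M * (b * a) * D ^ l ≤ Λ →
        (V : Fin n → Bool) → size V + 1ℚ ≤ b → (y : Fin n → ℚ) → (∀ i → 0ℚ ≤ y i) →
        ∑ₜ (suc (suc l)) (λ t → ⟦ meets V t ⟧ * y ⟪ t ⟫) ≤ (1ℚ - h) * Λ * sum (λ i → y i ^ suc (suc l))
  gap {l} {β} {n} {a} {h} {Λ} R inΛ outΛ V V<b y 0≤y = subst₂ _≤_
    (∑ₜ-cong k (λ t → cong (⟦ meets V t ⟧ *_) (product-cong (λ j → uz≡y (lookup t j)))))
    (cong ((1ℚ - h) * Λ *_) (sum-cong (λ i → cong (_^ k) (uz≡y i))))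
    (collatz′ {m} (λ t → ⟦ meets V t ⟧) (λ t → 0≤⟦⟧ (meets V t)) (λ is j i → cong ⟦_⟧ (meets-insertAt V is j i))
      u z (weight-≥0 V 1≤sa) (quotient-nonneg V (<⇒≤ (proj₁ (proj₂ inverse))) 0≤y) ((1ℚ - h) * Λ) row)
    where
    open Regime R
    open ≤-Reasoning
    k m : ℕ
    k = suc (suc l)
    m = suc l
    -- The 4 reconciles (1 - h)² (1 + 4h) ≥ 1, used on V, with (b - 1) (1 + 4h) ≤ (1 - h)² b, used
    -- off V. In both, one factor 1 - h is the gain and the other pays for passing from X to D.
    s : ℚ
    s = 1ℚ + ι 4 * h
    1≤s : 1ℚ ≤ s
    1≤s = p≤p+q (*-nonneg (0≤ι 4) 0≤h)
    0≤s : 0ℚ ≤ s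
    0≤s = ≤-trans 0≤1 1≤s
    1≤sa : 1ℚ ≤ s * a
    1≤sa = *-mono 0≤1 0≤a 1≤s 1≤a
    0≤sa : 0ℚ ≤ s * a
    0≤sa = ≤-trans 0≤1 1≤sa
    inverse : ∃ λ r → 0ℚ < r × (s * a) * r ≡ 1ℚ
    inverse = recip (<-≤-trans 0<1 1≤sa)
    u z : Fin n → ℚ
    u = weight V (s * a)
    z = quotient V (proj₁ inverse) y
    uz≡y : ∀ i → u i * z i ≡ y i
    uz≡y = weight-quotient V y (proj₂ (proj₂ inverse))
    0≤sum : 0ℚ ≤ sum u
    0≤sum = sum-nonneg (weight-≥0 V 1≤sa)
    V≤b : size V ≤ b
    V≤b = ≤-trans (p≤p+q 0≤1) V<b
    -- The 2 in X = N + 2 b a makes room for the enlarged entries (1 + 4h) a.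
    sum≤X : sum u ≤ X
    sum≤X = ≤-trans (sum-weight≤ V 0≤sa) (+-monoʳ-≤ N (≤-trans (*-monoʳ 0≤sa V≤b)
      (by-difference (b * a * (1ℚ - ι 8 * h) + b * a * (ι 4 * h))
        (+-nonneg (*-nonneg (*-nonneg 0≤b 0≤a) 0≤1-8h) (*-nonneg (*-nonneg 0≤b 0≤a) (*-nonneg (0≤ι 4) 0≤h)))
        (solve 3 (λ b a h → con (ι 2) :* b :* a := b :* ((con 1ℚ :+ con (ι 4) :* h) :* a) :+
           (b :* a :* (con 1ℚ :- con (ι 8) :* h) :+ b :* a :* (con (ι 4) :* h))) refl b a h))))
    0≤Λ : 0ℚ ≤ Λ
    0≤Λ = ≤-trans (*-nonneg (*-nonneg 0≤M (*-nonneg 0≤b 0≤a)) (^-nonneg l 0≤D)) outΛ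
    row-in : sum u ^ m ≤ (1ℚ - h) * Λ * (s * a) ^ m
    row-in = begin
      sum u ^ m
        ≤⟨ ^-mono m 0≤sum sum≤X ⟩
      X ^ m
        ≤⟨ by-difference ((1ℚ - ι 8 * h) * h * X ^ m + h * (1ℚ + h + ι 4 * (h * h)) * X ^ m)
             (+-nonneg (*-nonneg (*-nonneg 0≤1-8h 0≤h) (^-nonneg m 0≤X))
               (*-nonneg (*-nonneg 0≤h (+-nonneg (+-nonneg 0≤1 0≤h) (*-nonneg (0≤ι 4) (square-nonneg h)))) (^-nonneg m 0≤X)))
             (solve 2 (λ h x → (con 1ℚ :- h) :* (con 1ℚ :+ con (ι 4) :* h) :* ((con 1ℚ :- h) :* x) :=
                x :+ ((con 1ℚ :- con (ι 8) :* h) :* h :* x :+ h :* (con 1ℚ :+ h :+ con (ι 4) :* (h :* h)) :* x)) refl h (X ^ m)) ⟩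
      (1ℚ - h) * s * ((1ℚ - h) * X ^ m)
        ≤⟨ *-monoˡ (*-nonneg 0≤1-h 0≤s) (≤-trans (X^≤D^ m ℕ.≤-refl) inΛ) ⟩
      (1ℚ - h) * s * (Λ * a ^ m)
        ≤⟨ *-monoʳ (*-nonneg 0≤Λ (^-nonneg m 0≤a)) (*-monoˡ 0≤1-h s≤s^m) ⟩
      (1ℚ - h) * s ^ m * (Λ * a ^ m)
        ≡⟨ solve 4 (λ g s L x → g :* s :* (L :* x) := g :* L :* (s :* x)) refl (1ℚ - h) (s ^ m) Λ (a ^ m) ⟩
      (1ℚ - h) * Λ * (s ^ m * a ^ m)
        ≡⟨ cong ((1ℚ - h) * Λ *_) (sym (^-distrib-* s a m)) ⟩
      (1ℚ - h) * Λ * (s * a) ^ m ∎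
      where
      s≤s^m : s ≤ s ^ m
      s≤s^m = subst (_≤ s ^ m) (*-identityʳ s) (*-monoˡ 0≤s (1≤^ l 1≤s))
    row-out : M * (size V * (s * a) * sum u ^ l) ≤ (1ℚ - h) * Λ
    row-out = begin
      M * (size V * (s * a) * sum u ^ l)
        ≤⟨ *-monoˡ 0≤M (*-mono (*-nonneg (0≤size V) 0≤sa) (^-nonneg l 0≤X) (*-monoʳ 0≤sa V≤b-1) (^-mono l 0≤sum sum≤X)) ⟩
      M * ((b - 1ℚ) * (s * a) * X ^ l)
        ≡⟨ solve 5 (λ M b s a x → M :* ((b :- con 1ℚ) :* (s :* a) :* x) := (b :- con 1ℚ) :* s :* (M :* a :* x)) refl M b s a (X ^ l) ⟩
      (b - 1ℚ) * s * (M * a * X ^ l)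
        ≤⟨ *-monoʳ (*-nonneg (*-nonneg 0≤M 0≤a) (^-nonneg l 0≤X)) b-ineq ⟩
      (1ℚ - h) * b * (1ℚ - h) * (M * a * X ^ l)
        ≡⟨ solve 5 (λ g b M a x → g :* b :* g :* (M :* a :* x) := g :* (M :* (b :* a)) :* (g :* x)) refl (1ℚ - h) b M a (X ^ l) ⟩
      (1ℚ - h) * (M * (b * a)) * ((1ℚ - h) * X ^ l)
        ≤⟨ *-monoˡ (*-nonneg 0≤1-h (*-nonneg 0≤M (*-nonneg 0≤b 0≤a))) (X^≤D^ l (ℕ.n≤1+n l)) ⟩
      (1ℚ - h) * (M * (b * a)) * D ^ l
        ≡⟨ *-assoc (1ℚ - h) (M * (b * a)) (D ^ l) ⟩
      (1ℚ - h) * (M * (b * a) * D ^ l)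
        ≤⟨ *-monoˡ 0≤1-h outΛ ⟩
      (1ℚ - h) * Λ ∎
      where
      V≤b-1 : size V ≤ b - 1ℚ
      V≤b-1 = subst (_≤ b - 1ℚ) (solve 1 (λ v → v :+ con 1ℚ :- con 1ℚ := v) refl (size V)) (+-monoˡ-≤ (- 1ℚ) V<b)
      -- (1 − h)² b − (b − 1)(1 + 4h) = 1 − 6bh + 4h + bh², where 8bh = 1.
      b-ineq : (b - 1ℚ) * s ≤ (1ℚ - h) * b * (1ℚ - h)
      b-ineq = by-difference (ι 2 * b * h + ι 4 * h + b * (h * h))
        (+-nonneg (+-nonneg (*-nonneg (*-nonneg (0≤ι 2) 0≤b) 0≤h) (*-nonneg (0≤ι 4) 0≤h)) (*-nonneg 0≤b (square-nonneg h)))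
        (trans (solve 2 (λ b h → (con 1ℚ :- h) :* b :* (con 1ℚ :- h) :=
            ((b :- con 1ℚ) :* (con 1ℚ :+ con (ι 4) :* h) :+ con (ι 2) :* b :* h :+ con (ι 4) :* h :+ b :* (h :* h)) :+ (con 1ℚ :- con (ι 8) :* b :* h) ) refl b h)
          (trans (cong (λ x → ((b - 1ℚ) * s + ι 2 * b * h + ι 4 * h + b * (h * h)) + (1ℚ - x)) 8bh≡1)
            (solve 4 (λ p q r t → (p :+ q :+ r :+ t) :+ (con 1ℚ :- con 1ℚ) := p :+ (q :+ r :+ t)) refl
              ((b - 1ℚ) * s) (ι 2 * b * h) (ι 4 * h) (b * (h * h)))))
    row : ∀ i → ∑ₜ m (λ is → ⟦ meets V (i ∷ is) ⟧ * u ⟪ is ⟫) ≤ (1ℚ - h) * Λ * u i ^ m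
    row i with V i
    ... | true = ≤-trans (≤-reflexive (trans (∑ₜ-cong m (λ is → *-identityˡ (u ⟪ is ⟫))) (∑ₜ-product m u))) row-in
    ... | false = subst (∑ₜ m (λ is → ⟦ meets V is ⟧ * u ⟪ is ⟫) ≤_)
      (sym (trans (cong ((1ℚ - h) * Λ *_) (1^ m)) (*-identityʳ ((1ℚ - h) * Λ))))
      (≤-trans (∑ₜ-meets l V u (weight-≥0 V 1≤sa))
        (≤-trans (≤-reflexive (cong (λ c → M * (c * sum u ^ l)) (∑-weight V {s * a}))) row-out))

-- Consequences of the gap for a nearly extremal H

module Stability where

  open import Data.Rational.Base using (_≤_; _<_)
  open RationalSums
  open TupleInequalities
  open DistinctTuples
  open CrossingTuples
  open Regimes
  open SpectralGap

  Z : ∀ {n k} → (Vec (Fin n) k → Bool) → (Fin n → ℚ) → ℚ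
  Z {k = k} H y = ∑ₜ k (λ t → ⟦ H t ⟧ * y ⟪ t ⟫)

  Y : ∀ {n} → ℕ → (Fin n → ℚ) → ℚ
  Y k y = sum (λ i → y i ^ k)

  -- After division by ΛY the bounds read h ≤ δ + h / 2 ≤ 3h / 4, which contradicts h > 0.
  deficient : ∀ {h δ ΛY Zy rest} → 0ℚ < h → 0ℚ < ΛY → ι 4 * δ ≤ h →
              (1ℚ - δ) * ΛY ≤ Zy → Zy ≤ (1ℚ - h) * ΛY + rest → ι 2 * rest ≤ h * ΛY → Empty.⊥
  deficient {h} {δ} {ΛY} {Zy} {rest} 0<h 0<ΛY 4δ≤h low up rest≤ = <-irrefl refl (<-≤-trans (*-pos 0<h 0<ΛY) (p≤q⇐0≤q-p
    (subst (0ℚ ≤_)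
      (solve 5 (λ h d s z e →
          con (ι 4) :* ((((con 1ℚ :- h) :* s :+ e) :- z) :+ (z :- (con 1ℚ :- d) :* s)) :+ con (ι 2) :* (h :* s :- con (ι 2) :* e) :+ s :* (h :- con (ι 4) :* d)
          := con 0ℚ :- h :* s) refl h δ ΛY Zy rest)
      (+-nonneg (+-nonneg (*-nonneg (0≤ι 4) (+-nonneg (0≤q-p up) (0≤q-p low))) (*-nonneg (0≤ι 2) (0≤q-p rest≤)))
        (*-nonneg (<⇒≤ 0<ΛY) (0≤q-p 4δ≤h))))))

  module _ {l β n : ℕ} {a h Λ δ : ℚ} (R : Regime l β n a h)
           (inΛ : Regime.D R ^ suc l ≤ Λ * a ^ suc l)
           (outΛ : Regime.M R * (Regime.b R * a) * Regime.D R ^ l ≤ Λ)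
           (4δ≤h : ι 4 * δ ≤ h)
           (H : Vec (Fin n) (suc (suc l)) → Bool)
           (H-sym : ∀ is j i → H (insertAt is j i) ≡ H (i ∷ is))
           (y : Fin n → ℚ) (0≤y : ∀ i → 0ℚ ≤ y i) (0<Y : 0ℚ < Y (suc (suc l)) y)
           (large : (1ℚ - δ) * (Λ * Y (suc (suc l)) y) ≤ Z H y)
    where

    open Regime R hiding (c)
    open ≤-Reasoning

    private
      k m : ℕ
      k = suc (suc l)
      m = suc l

      0<Λ : 0ℚ < Λ
      0<Λ = <-≤-trans (*-pos (*-pos (0<ι l) (*-pos (<-≤-trans 0<1 1≤b) (<-≤-trans 0<1 1≤a))) (^-pos l 0<D)) outΛ

      0≤Λ : 0ℚ ≤ Λ
      0≤Λ = <⇒≤ 0<Λ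

      ΛY : ℚ
      ΛY = Λ * Y k y

      0<ΛY : 0ℚ < ΛY
      0<ΛY = *-pos 0<Λ 0<Y

      0≤y⟪⟫ : ∀ {j} (t : Vec (Fin n) j) → 0ℚ ≤ y ⟪ t ⟫
      0≤y⟪⟫ t = product-nonneg (λ j → 0≤y (lookup t j))

      gap′ : (V : Fin n → Bool) → size V + 1ℚ ≤ b → ∑ₜ k (λ t → ⟦ meets V t ⟧ * y ⟪ t ⟫) ≤ (1ℚ - h) * ΛY
      gap′ V V<b = ≤-trans (gap R inΛ outΛ V V<b y 0≤y) (≤-reflexive (*-assoc (1ℚ - h) Λ (Y k y)))

    -- The edges meeting V fall under `gap`. On the others the constant test vector turns the degree
    -- bound Δ into a contribution of at most Δ Y, which does not make up for the gap.
    sparse-rest : (V : Fin n → Bool) → size V + 1ℚ ≤ b → (Δ : ℚ) → ι 2 * Δ ≤ h * Λ →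
                  ¬ (∀ i → ∑ₜ m (λ is → ⟦ H (i ∷ is) ∧ not (meets V (i ∷ is)) ⟧) ≤ Δ)
    sparse-rest V V<b Δ 2Δ≤ deg = deficient {h} {δ} 0<h 0<ΛY 4δ≤h large upper
      (≤-trans (≤-reflexive (sym (*-assoc (ι 2) Δ (Y k y))))
        (≤-trans (*-monoʳ (<⇒≤ 0<Y) 2Δ≤) (≤-reflexive (*-assoc h Λ (Y k y)))))
      where
      c : Vec (Fin n) k → Bool
      c t = H t ∧ not (meets V t)
      split : ∀ t → ⟦ H t ⟧ ≤ ⟦ meets V t ⟧ + ⟦ c t ⟧
      split t with H t | meets V t
      ... | true | true = p≤p+q ≤-refl
      ... | true | false = ≤-reflexive (sym (+-identityˡ 1ℚ))
      ... | false | v = +-nonneg (0≤⟦⟧ v) ≤-refl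
      rest : ∑ₜ k (λ t → ⟦ c t ⟧ * y ⟪ t ⟫) ≤ Δ * Y k y
      rest = subst₂ _≤_
        (∑ₜ-cong k (λ t → cong (⟦ c t ⟧ *_) (product-cong (λ j → *-identityˡ (y (lookup t j))))))
        (cong (Δ *_) (sum-cong (λ i → cong (_^ k) (*-identityˡ (y i)))))
        (collatz′ {m} (λ t → ⟦ c t ⟧) (λ t → 0≤⟦⟧ (c t))
          (λ is j i → cong ⟦_⟧ (cong₂ _∧_ (H-sym is j i) (cong not (meets-insertAt V is j i))))
          (λ _ → 1ℚ) y (λ _ → 0≤1) 0≤y Δ
          (λ i → subst₂ _≤_ (∑ₜ-cong m (λ is → sym (trans (cong (⟦ c (i ∷ is) ⟧ *_) (⟪⟫-one is)) (*-identityʳ ⟦ c (i ∷ is) ⟧))))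
            (sym (trans (cong (Δ *_) (1^ m)) (*-identityʳ Δ))) (deg i)))
      upper : Z H y ≤ (1ℚ - h) * ΛY + Δ * Y k y
      upper = begin
        ∑ₜ k (λ t → ⟦ H t ⟧ * y ⟪ t ⟫)
          ≤⟨ ∑ₜ-mono k (λ t → ≤-trans (*-monoʳ (0≤y⟪⟫ t) (split t)) (≤-reflexive (ℚ.*-distribʳ-+ (y ⟪ t ⟫) ⟦ meets V t ⟧ ⟦ c t ⟧))) ⟩
        ∑ₜ k (λ t → ⟦ meets V t ⟧ * y ⟪ t ⟫ + ⟦ c t ⟧ * y ⟪ t ⟫)
          ≡⟨ ∑ₜ-distrib-+ k (λ t → ⟦ meets V t ⟧ * y ⟪ t ⟫) (λ t → ⟦ c t ⟧ * y ⟪ t ⟫) ⟩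
        ∑ₜ k (λ t → ⟦ meets V t ⟧ * y ⟪ t ⟫) + ∑ₜ k (λ t → ⟦ c t ⟧ * y ⟪ t ⟫)
          ≤⟨ +-mono-≤ (gap′ V V<b) rest ⟩
        (1ℚ - h) * ΛY + Δ * Y k y ∎

    module _ (W : Fin n → Bool) (∣W∣ : size W ≡ b) (H⊆W : ∀ t → H t ≡ true → crossing W t ≡ true)
             (eigen : ∀ i → link m W a i ≤ Λ * weight W a i ^ m) where

      private
        K q r : ℚ
        K = ι k
        -- Chosen to give q h = 4 K; this keeps the edges through a small entry below h ΛY / 2 in
        -- `entry-large`.
        q = ι 32 * b * K
        0<a : 0ℚ < a
        0<a = <-≤-trans 0<1 1≤a
        inverse : ∃ λ r → 0ℚ < r × a * r ≡ 1ℚ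
        inverse = recip 0<a
        r = proj₁ inverse
        0≤r : 0ℚ ≤ r
        0≤r = <⇒≤ (proj₁ (proj₂ inverse))
        u z : Fin n → ℚ
        u = weight W a
        z = quotient W r y
        0≤u : ∀ i → 0ℚ ≤ u i
        0≤u = weight-≥0 W 1≤a
        0≤z : ∀ i → 0ℚ ≤ z i
        0≤z = quotient-nonneg W 0≤r 0≤y
        uz≡y : ∀ i → u i * z i ≡ y i
        uz≡y = weight-quotient W y (proj₂ (proj₂ inverse))
        y⟪⟫ : ∀ {j} (t : Vec (Fin n) j) → y ⟪ t ⟫ ≡ u ⟪ t ⟫ * z ⟪ t ⟫
        y⟪⟫ t = trans (product-cong (λ j → sym (uz≡y (lookup t j)))) (product-* (λ j → u (lookup t j)) (λ j → z (lookup t j)))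
        σ : ∀ {j} → Vec (Fin n) j → ℚ
        σ t = sum (λ j → z (lookup t j) ^ k)
        0≤σ : ∀ {j} (t : Vec (Fin n) j) → 0ℚ ≤ σ t
        0≤σ t = sum-nonneg (λ j → ^-nonneg k (0≤z (lookup t j)))
        0≤K : 0ℚ ≤ K
        0≤K = 0≤ι k
        0≤q : 0ℚ ≤ q
        0≤q = *-nonneg (*-nonneg (0≤ι 32) 0≤b) 0≤K
        0<q : 0ℚ < q
        0<q = *-pos (*-pos (0<ι 31) (<-≤-trans 0<1 1≤b)) (0<ι m)
        qh≡4K : q * h ≡ ι 4 * K
        qh≡4K = trans (solve 3 (λ b K h → con (ι 32) :* b :* K :* h := con (ι 4) :* K :* (con (ι 8) :* b :* h)) refl b K h)
          (trans (cong (ι 4 * K *_) 8bh≡1) (*-identityʳ (ι 4 * K)))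

        -- The AM-GM terms of all edges of S. `missing-few` splits this sum into the part of H and
        -- the missing part.
        Full : ℚ
        Full = ∑ₜ k (λ t → (⟦ crossing W t ⟧ * u ⟪ t ⟫) * σ t)
        Full≤ : Full ≤ K * ΛY
        Full≤ = subst (Full ≤_) (cong (λ x → K * (Λ * x)) (sum-cong (λ i → cong (_^ k) (uz≡y i))))
          (collatz {m} (λ t → ⟦ crossing W t ⟧) (λ t → 0≤⟦⟧ (crossing W t))
            (λ is j i → cong ⟦_⟧ (crossing-insertAt W is j i)) u z 0≤u 0≤z Λ eigen)

      -- Otherwise the edges through w contribute little, and the remaining edges
      -- meet the β − 1 other vertices of W, where gap applies.
      entry-large : ∀ w → W w ≡ true → Y k y ≤ q ^ k * y w ^ k
      entry-large w Ww with ≤-total (q ^ k * y w ^ k) (Y k y)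
      ... | inj₂ ok = ok
      ... | inj₁ small = Empty.⊥-elim (deficient {h} {δ} 0<h 0<ΛY 4δ≤h large upper rest≤)
        where
        V : Fin n → Bool
        V i = W i ∧ not (does (w Fin.≟ i))
        V<b : size V + 1ℚ ≤ b
        V<b = ≤-reflexive (trans (cong (size V +_) (sym (∑-singleton w)))
          (trans (sym (sum-+ (λ i → ⟦ V i ⟧) (λ i → ⟦ does (w Fin.≟ i) ⟧))) (trans (sum-cong part) ∣W∣)))
          where
          part : ∀ i → ⟦ V i ⟧ + ⟦ does (w Fin.≟ i) ⟧ ≡ ⟦ W i ⟧
          part i with w Fin.≟ i
          ... | yes refl = trans (cong (λ b → ⟦ b ∧ false ⟧ + 1ℚ) Ww) (cong ⟦_⟧ (sym Ww))
          ... | no _ = trans (+-identityʳ _) (cong ⟦_⟧ (Bool.∧-identityʳ (W i)))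
        at-w : Fin n → ℚ
        at-w i = ⟦ does (w Fin.≟ i) ⟧
        cy : Vec (Fin n) k → ℚ
        cy t = ⟦ crossing W t ⟧ * y ⟪ t ⟫
        row rest : ℚ
        row = ∑ₜ m (λ is → cy (w ∷ is))
        rest = K * row
        split : ∀ t → ⟦ H t ⟧ * y ⟪ t ⟫ ≤ ⟦ meets V t ⟧ * y ⟪ t ⟫ + cy t * sum (λ j → at-w (lookup t j))
        split t with H t in Ht
        ... | false = ≤-trans (≤-reflexive (*-zeroˡ (y ⟪ t ⟫)))
          (+-nonneg (*-nonneg (0≤⟦⟧ (meets V t)) (0≤y⟪⟫ t))
            (*-nonneg (*-nonneg (0≤⟦⟧ (crossing W t)) (0≤y⟪⟫ t)) (sum-nonneg (λ j → 0≤⟦⟧ (does (w Fin.≟ lookup t j))))))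
        ... | true with meets V t in Vt
        ...   | true = p≤p+q (*-nonneg (*-nonneg (0≤⟦⟧ (crossing W t)) (0≤y⟪⟫ t)) (sum-nonneg (λ j → 0≤⟦⟧ (does (w Fin.≟ lookup t j)))))
        ...   | false = begin
          1ℚ * y ⟪ t ⟫
            ≡⟨ solve 1 (λ y → con 1ℚ :* y := (con 1ℚ :* y) :* con 1ℚ) refl (y ⟪ t ⟫) ⟩
          1ℚ * y ⟪ t ⟫ * 1ℚ
            ≤⟨ *-monoˡ (*-nonneg 0≤1 (0≤y⟪⟫ t)) hit ⟩
          1ℚ * y ⟪ t ⟫ * sum (λ j → at-w (lookup t j))
            ≡⟨ cong (λ b → ⟦ b ⟧ * y ⟪ t ⟫ * sum (λ j → at-w (lookup t j))) (sym (H⊆W t Ht)) ⟩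
          cy t * sum (λ j → at-w (lookup t j))
            ≡⟨ solve 2 (λ x y → x := con 0ℚ :* y :+ x) refl (cy t * sum (λ j → at-w (lookup t j))) (y ⟪ t ⟫) ⟩
          0ℚ * y ⟪ t ⟫ + cy t * sum (λ j → at-w (lookup t j)) ∎
          where
          -- An edge of H meets W; if it avoids V, the common vertex can only be w.
          hit : 1ℚ ≤ sum (λ j → at-w (lookup t j))
          hit with meets⁻ W t (Bool.∧-conicalʳ (spans t) (meets W t) (H⊆W t Ht))
          ... | j , Wj = ≤-trans (≤-reflexive (cong ⟦_⟧ (sym eq))) (term≤sum (λ j → 0≤⟦⟧ (does (w Fin.≟ lookup t j))) j)
            where
            eq : does (w Fin.≟ lookup t j) ≡ true
            eq with does (w Fin.≟ lookup t j) in d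
            ... | true = refl
            ... | false = case trans (sym Vt) (meets⁺ V t j (trans (cong₂ _∧_ Wj (cong not d)) refl)) of λ ()
        cy-sym : Symmetric cy
        cy-sym is j i = cong₂ _*_ (cong ⟦_⟧ (crossing-insertAt W is j i)) (⟪⟫-insertAt y is j i)
        upper : Z H y ≤ (1ℚ - h) * ΛY + rest
        upper = begin
          Z H y
            ≤⟨ ∑ₜ-mono k split ⟩
          ∑ₜ k (λ t → ⟦ meets V t ⟧ * y ⟪ t ⟫ + cy t * sum (λ j → at-w (lookup t j)))
            ≡⟨ ∑ₜ-distrib-+ k (λ t → ⟦ meets V t ⟧ * y ⟪ t ⟫) (λ t → cy t * sum (λ j → at-w (lookup t j))) ⟩
          ∑ₜ k (λ t → ⟦ meets V t ⟧ * y ⟪ t ⟫) + ∑ₜ k (λ t → cy t * sum (λ j → at-w (lookup t j)))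
            ≤⟨ +-mono-≤ (gap′ V V<b) (≤-reflexive (trans (∑ₜ-marginals cy cy-sym at-w) (cong (K *_) single))) ⟩
          (1ℚ - h) * ΛY + rest ∎
          where
          single : sum (λ i → at-w i * ∑ₜ m (λ is → cy (i ∷ is))) ≡ row
          single = trans (sum-cong (λ i → lem i)) (trans (sum-*ʳ row at-w) (trans (cong (_* row) (∑-singleton w)) (*-identityˡ row)))
            where
            lem : ∀ i → at-w i * ∑ₜ m (λ is → cy (i ∷ is)) ≡ at-w i * row
            lem i with w Fin.≟ i
            ... | yes refl = refl
            ... | no _ = trans (*-zeroˡ (∑ₜ m (λ is → cy (i ∷ is)))) (sym (*-zeroˡ row))
        cu : Vec (Fin n) m → ℚ
        cu is = ⟦ crossing W (w ∷ is) ⟧ * u ⟪ w ∷ is ⟫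
        0≤cu : ∀ is → 0ℚ ≤ cu is
        0≤cu is = *-nonneg (0≤⟦⟧ (crossing W (w ∷ is))) (product-nonneg (λ j → 0≤u (lookup (w ∷ is) j)))
        -- AM–GM with the entry at w scaled up by q.
        am-gm-w : ∀ is → K * q * cy (w ∷ is) ≤ cu is * (q * z w) ^ k + cu is * σ is
        am-gm-w is = begin
          K * q * (⟦ crossing W (w ∷ is) ⟧ * y ⟪ w ∷ is ⟫)
            ≡⟨ cong (λ p → K * q * (⟦ crossing W (w ∷ is) ⟧ * p)) (y⟪⟫ (w ∷ is)) ⟩
          K * q * (⟦ crossing W (w ∷ is) ⟧ * (u ⟪ w ∷ is ⟫ * (z w * z ⟪ is ⟫)))
            ≡⟨ solve 6 (λ K q c u zw zs → K :* q :* (c :* (u :* (zw :* zs))) := c :* u :* (K :* (q :* zw :* zs))) refl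
                 K q ⟦ crossing W (w ∷ is) ⟧ (u ⟪ w ∷ is ⟫) (z w) (z ⟪ is ⟫) ⟩
          cu is * (K * product f)
            ≤⟨ *-monoˡ (0≤cu is) (am-gm k f (λ { zero → *-nonneg 0≤q (0≤z w) ; (suc j) → 0≤z (lookup is j) })) ⟩
          cu is * ((q * z w) ^ k + σ is)
            ≡⟨ *-distribˡ-+ (cu is) ((q * z w) ^ k) (σ is) ⟩
          cu is * (q * z w) ^ k + cu is * σ is ∎
          where
          f : Fin k → ℚ
          f zero = q * z w
          f (suc j) = z (lookup is j)
        -- The eigenvalue inequality at w turns this sum into Λ qᵏ y wᵏ, to which the assumption
        -- `small` applies.
        first : ∑ₜ m (λ is → cu is * (q * z w) ^ k) ≤ Λ * Y k y
        first = begin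
          ∑ₜ m (λ is → cu is * (q * z w) ^ k)
            ≡⟨ ∑ₜ-*ʳ m ((q * z w) ^ k) cu ⟩
          ∑ₜ m cu * (q * z w) ^ k
            ≡⟨ cong (_* (q * z w) ^ k) (trans (∑ₜ-cong m (λ is → solve 3 (λ c u v → c :* (u :* v) := u :* (c :* v)) refl
                 ⟦ crossing W (w ∷ is) ⟧ (u w) (u ⟪ is ⟫))) (∑ₜ-*ˡ m (u w) (λ is → ⟦ crossing W (w ∷ is) ⟧ * u ⟪ is ⟫))) ⟩
          u w * link m W a w * (q * z w) ^ k
            ≤⟨ *-monoʳ (^-nonneg k (*-nonneg 0≤q (0≤z w))) (*-monoˡ (0≤u w) (eigen w)) ⟩
          u w * (Λ * u w ^ m) * (q * z w) ^ k
            ≡⟨ cong (u w * (Λ * u w ^ m) *_) (^-distrib-* q (z w) k) ⟩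
          u w * (Λ * u w ^ m) * (q ^ k * z w ^ k)
            ≡⟨ solve 5 (λ u L um q z → u :* (L :* um) :* (q :* z) := L :* (q :* ((u :* um) :* z))) refl (u w) Λ (u w ^ m) (q ^ k) (z w ^ k) ⟩
          Λ * (q ^ k * (u w ^ k * z w ^ k))
            ≡⟨ cong (λ x → Λ * (q ^ k * x)) (trans (sym (^-distrib-* (u w) (z w) k)) (cong (_^ k) (uz≡y w))) ⟩
          Λ * (q ^ k * y w ^ k)
            ≤⟨ *-monoˡ 0≤Λ small ⟩
          Λ * Y k y ∎
        -- The row at w is one of the nonnegative rows that add up to `Full`.
        second : ∑ₜ m (λ is → cu is * σ is) ≤ K * ΛY
        second = ≤-trans (∑ₜ-mono m (λ is → *-monoˡ (0≤cu is) (subst (_≤ σ (w ∷ is)) (+-identityˡ (σ is))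
            (+-monoˡ-≤ (σ is) (^-nonneg k (0≤z w))))))
          (≤-trans (term≤sum {f = λ i → ∑ₜ m (λ is → (⟦ crossing W (i ∷ is) ⟧ * u ⟪ i ∷ is ⟫) * σ (i ∷ is))}
            (λ i → ∑ₜ-nonneg m (λ is → *-nonneg (*-nonneg (0≤⟦⟧ (crossing W (i ∷ is))) (product-nonneg (λ j → 0≤u (lookup (i ∷ is) j)))) (0≤σ (i ∷ is)))) w) Full≤)
        rest≤ : ι 2 * rest ≤ h * ΛY
        rest≤ = *-cancelˡ 0<q (begin
          q * (ι 2 * (K * row))
            ≡⟨ solve 4 (λ q two K row → q :* (two :* (K :* row)) := two :* (K :* q :* row)) refl q (ι 2) K row ⟩
          ι 2 * (K * q * row)
            ≡⟨ cong (ι 2 *_) (sym (∑ₜ-*ˡ m (K * q) (λ is → cy (w ∷ is)))) ⟩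
          ι 2 * ∑ₜ m (λ is → K * q * cy (w ∷ is))
            ≤⟨ *-monoˡ (0≤ι 2) (≤-trans (∑ₜ-mono m am-gm-w)
                 (≤-trans (≤-reflexive (∑ₜ-distrib-+ m (λ is → cu is * (q * z w) ^ k) (λ is → cu is * σ is)))
                   (+-mono-≤ first second))) ⟩
          ι 2 * (ΛY + K * ΛY)
            ≤⟨ by-difference (ι 2 * ((K - 1ℚ) * ΛY)) (*-nonneg (0≤ι 2) (*-nonneg (0≤q-p (1≤ι m)) (<⇒≤ 0<ΛY)))
                 (solve 2 (λ K s → con (ι 4) :* K :* s := con (ι 2) :* (s :+ K :* s) :+ con (ι 2) :* ((K :- con 1ℚ) :* s)) refl K ΛY) ⟩
          ι 4 * K * ΛY
            ≡⟨ cong (_* ΛY) (sym qh≡4K) ⟩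
          q * h * ΛY
            ≡⟨ *-assoc q h ΛY ⟩
          q * (h * ΛY) ∎)

      missing : Vec (Fin n) k → Bool
      missing t = crossing W t ∧ not (H t)

      -- A missing edge loses the whole term of the AM–GM bound, which by
      -- entry-large is at least a fixed multiple of Y.
      missing-few : Λ * a ^ m ≤ ι 2 * X ^ m → 0ℚ ≤ δ →
                    ∑ₜ k (λ t → ⟦ missing t ⟧) ≤ K * q ^ k * ι 2 * (ι 2 * N) ^ m * δ
      missing-few Λ≤ 0≤δ = *-cancelˡ 0<Y (begin
        Y k y * ∑ₜ k (λ t → ⟦ missing t ⟧)
          ≡⟨ sym (∑ₜ-*ˡ k (Y k y) (λ t → ⟦ missing t ⟧)) ⟩
        ∑ₜ k (λ t → Y k y * ⟦ missing t ⟧)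
          ≤⟨ ∑ₜ-mono k each ⟩
        ∑ₜ k (λ t → q ^ k * a ^ m * ((⟦ missing t ⟧ * u ⟪ t ⟫) * σ t))
          ≡⟨ ∑ₜ-*ˡ k (q ^ k * a ^ m) (λ t → (⟦ missing t ⟧ * u ⟪ t ⟫) * σ t) ⟩
        q ^ k * a ^ m * B
          ≤⟨ *-monoˡ (*-nonneg (^-nonneg k 0≤q) (^-nonneg m 0≤a)) B≤ ⟩
        q ^ k * a ^ m * (K * (δ * ΛY))
          ≡⟨ solve 6 (λ q a K d L Y → q :* a :* (K :* (d :* (L :* Y))) := q :* K :* d :* Y :* (L :* a)) refl (q ^ k) (a ^ m) K δ Λ (Y k y) ⟩
        q ^ k * K * δ * Y k y * (Λ * a ^ m)
          ≤⟨ *-monoˡ (*-nonneg (*-nonneg (*-nonneg (^-nonneg k 0≤q) 0≤K) 0≤δ) (<⇒≤ 0<Y))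
               (≤-trans Λ≤ (*-monoˡ (0≤ι 2) (^-mono m 0≤X X≤2N))) ⟩
        q ^ k * K * δ * Y k y * (ι 2 * (ι 2 * N) ^ m)
          ≡⟨ solve 6 (λ q K d Y t x → q :* K :* d :* Y :* (t :* x) := Y :* (K :* q :* t :* x :* d)) refl (q ^ k) K δ (Y k y) (ι 2) ((ι 2 * N) ^ m) ⟩
        Y k y * (K * q ^ k * ι 2 * (ι 2 * N) ^ m * δ) ∎)
        where
        A B : ℚ
        A = ∑ₜ k (λ t → (⟦ H t ⟧ * u ⟪ t ⟫) * σ t)
        B = ∑ₜ k (λ t → (⟦ missing t ⟧ * u ⟪ t ⟫) * σ t)
        A+B≡Full : A + B ≡ Full
        A+B≡Full = trans (sym (∑ₜ-distrib-+ k (λ t → (⟦ H t ⟧ * u ⟪ t ⟫) * σ t) (λ t → (⟦ missing t ⟧ * u ⟪ t ⟫) * σ t)))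
          (∑ₜ-cong k (λ t → trans (solve 4 (λ p q u s → (p :* u) :* s :+ (q :* u) :* s := ((p :+ q) :* u) :* s) refl ⟦ H t ⟧ ⟦ missing t ⟧ (u ⟪ t ⟫) (σ t))
            (cong (λ x → (x * u ⟪ t ⟫) * σ t) (part t))))
          where
          part : ∀ t → ⟦ H t ⟧ + ⟦ missing t ⟧ ≡ ⟦ crossing W t ⟧
          part t with H t in Ht
          ... | true rewrite H⊆W t Ht = +-identityʳ 1ℚ
          ... | false = trans (+-identityˡ _) (cong ⟦_⟧ (Bool.∧-identityʳ (crossing W t)))
        low : K * ((1ℚ - δ) * ΛY) ≤ A
        low = begin
          K * ((1ℚ - δ) * ΛY)
            ≤⟨ *-monoˡ 0≤K large ⟩
          K * Z H y
            ≡⟨ cong (K *_) (∑ₜ-cong k (λ t → trans (cong (⟦ H t ⟧ *_) (y⟪⟫ t)) (sym (*-assoc ⟦ H t ⟧ (u ⟪ t ⟫) (z ⟪ t ⟫))))) ⟩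
          K * ∑ₜ k (λ t → (⟦ H t ⟧ * u ⟪ t ⟫) * z ⟪ t ⟫)
            ≤⟨ ∑ₜ-am-gm (λ t → ⟦ H t ⟧ * u ⟪ t ⟫) (λ t → *-nonneg (0≤⟦⟧ (H t)) (product-nonneg (λ j → 0≤u (lookup t j)))) z 0≤z ⟩
          A ∎
        -- A + B is at most K ΛY, and H alone uses up K (1 - δ) ΛY of it.
        B≤ : B ≤ K * (δ * ΛY)
        B≤ = by-difference ((A - K * ((1ℚ - δ) * ΛY)) + (K * ΛY - Full)) (+-nonneg (0≤q-p low) (0≤q-p Full≤))
          (trans (solve 5 (λ K d s A B → K :* (d :* s) := B :+ ((A :- K :* ((con 1ℚ :- d) :* s)) :+ (K :* s :- (A :+ B)))) refl K δ ΛY A B)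
            (cong (λ x → B + ((A - K * ((1ℚ - δ) * ΛY)) + (K * ΛY - x))) A+B≡Full))
        vanish : ∀ t → Y k y * 0ℚ ≤ q ^ k * a ^ m * ((0ℚ * u ⟪ t ⟫) * σ t)
        vanish t = ≤-reflexive (solve 5 (λ Y q a u s → Y :* con 0ℚ := q :* a :* ((con 0ℚ :* u) :* s)) refl (Y k y) (q ^ k) (a ^ m) (u ⟪ t ⟫) (σ t))
        each : ∀ t → Y k y * ⟦ missing t ⟧ ≤ q ^ k * a ^ m * ((⟦ missing t ⟧ * u ⟪ t ⟫) * σ t)
        each t with spans t | meets W t in mt | H t
        ... | false | _ | _ = vanish t
        ... | true | false | _ = vanish t
        ... | true | true | true = vanish t
        ... | true | true | false with meets⁻ W t mt
        ...   | j , Wj = begin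
          Y k y * 1ℚ
            ≡⟨ *-identityʳ (Y k y) ⟩
          Y k y
            ≤⟨ entry-large w Wj ⟩
          q ^ k * y w ^ k
            ≡⟨ cong (λ x → q ^ k * x) (trans (cong (_^ k) (sym (uz≡y w))) (^-distrib-* (u w) (z w) k)) ⟩
          q ^ k * (u w ^ k * z w ^ k)
            ≡⟨ cong (λ x → q ^ k * (x ^ k * z w ^ k)) (cong (λ b → if b then a else 1ℚ) Wj) ⟩
          q ^ k * (a * a ^ m * z w ^ k)
            ≡⟨ solve 4 (λ q a am zk → q :* (a :* am :* zk) := q :* am :* (a :* zk)) refl (q ^ k) a (a ^ m) (z w ^ k) ⟩
          -- Of the k factors a in y wᵏ = (a z w)ᵏ only one is absorbed by the tuple: u ⟪ t ⟫ ≥ a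
          -- because w occurs in t, and σ t ≥ z wᵏ.
          q ^ k * a ^ m * (a * z w ^ k)
            ≤⟨ *-monoˡ (*-nonneg (^-nonneg k 0≤q) (^-nonneg m 0≤a))
                 (*-mono 0≤a (0≤σ t) (≤-trans (≤-reflexive (cong (λ b → if b then a else 1ℚ) (sym Wj))) (factor≤product (λ i → weight-≥1 W 1≤a (lookup t i)) j))
                   (term≤sum (λ i → ^-nonneg k (0≤z (lookup t i))) j)) ⟩
          q ^ k * a ^ m * (u ⟪ t ⟫ * σ t)
            ≡⟨ cong (λ x → q ^ k * a ^ m * (x * σ t)) (sym (*-identityˡ (u ⟪ t ⟫))) ⟩
          q ^ k * a ^ m * ((1ℚ * u ⟪ t ⟫) * σ t) ∎
          where
          w : Fin n
          w = lookup t j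

-- Heavy vertices and greedy matchings

module HeavyVertices where

  open import Data.Rational.Base using (_≤_; _<_)
  open import Data.Fin.Subset using (∣_∣; ⊥)
  open import Data.List.Base using (List; []; _∷_; length)
  open import Data.List.Relation.Unary.All using (All; []; _∷_)
  open import Data.List.Relation.Unary.AllPairs using (AllPairs; []; _∷_)
  open RationalSums
  open TupleInequalities
  open CrossingTuples

  elements : ∀ {n} → Subset n → List (Fin n)
  elements [] = []
  elements (true ∷ p) = zero ∷ List.map suc (elements p)
  elements (false ∷ p) = List.map suc (elements p)

  length-elements : ∀ {n} (p : Subset n) → length (elements p) ≡ ∣ p ∣
  length-elements [] = refl
  length-elements (true ∷ p) = cong suc (trans (List.length-map suc (elements p)) (length-elements p))
  length-elements (false ∷ p) = trans (List.length-map suc (elements p)) (length-elements p)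

  elements-unique : ∀ {n} (p : Subset n) → Unique (elements p)
  elements-unique [] = []
  elements-unique (true ∷ p) = All.map⁺ (All.universal (λ _ ()) (elements p)) ∷ Unique.map⁺ Fin.suc-injective (elements-unique p)
  elements-unique (false ∷ p) = Unique.map⁺ Fin.suc-injective (elements-unique p)

  elements-∈ : ∀ {n} (p : Subset n) → All (_∈ p) (elements p)
  elements-∈ [] = []
  elements-∈ (true ∷ p) = Vec.here ∷ All.map⁺ (All.map Vec.there (elements-∈ p))
  elements-∈ (false ∷ p) = All.map⁺ (All.map Vec.there (elements-∈ p))

  ⁅_⁆* : ∀ {n} → List (Fin n) → Subset n
  ⁅ ws ⁆* = ⋃ (List.map ⁅_⁆ ws)

  ∣⁅⁆*∣≤ : ∀ {n} (ws : List (Fin n)) → ∣ ⁅ ws ⁆* ∣ ℕ.≤ length ws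
  ∣⁅⁆*∣≤ {n} [] = ℕ.≤-reflexive (∣⊥∣≡0 n)
  ∣⁅⁆*∣≤ (w ∷ ws) = ℕ.≤-trans (∣∪∣≤ ⁅ w ⁆ ⁅ ws ⁆*) (ℕ.+-mono-≤ (ℕ.≤-reflexive (∣⁅x⁆∣≡1 w)) (∣⁅⁆*∣≤ ws))

  ∉⁅⁆*⇒All : ∀ {n} (ws : List (Fin n)) {e : Subset n} → Empty (e ∩ ⁅ ws ⁆*) → All (_∉ e) ws
  ∉⁅⁆*⇒All [] h = []
  ∉⁅⁆*⇒All (w ∷ ws) h =
    (λ w∈e → h (w , x∈p∩q⁺ (w∈e , x∈p∪q⁺ (inj₁ (x∈⁅x⁆ w))))) ∷
    ∉⁅⁆*⇒All ws (λ (v , v∈) → let v∈e , v∈ws = x∈p∩q⁻ _ ⁅ ws ⁆* v∈ in h (v , x∈p∩q⁺ (v∈e , x∈p∪q⁺ (inj₂ v∈ws))))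

  ∉-⁅⁆* : ∀ {n} {w : Fin n} (ws : List (Fin n)) → All (λ v → ¬ w ≡ v) ws → w ∉ ⁅ ws ⁆*
  ∉-⁅⁆* [] [] w∈ = ∉⊥ w∈
  ∉-⁅⁆* (v ∷ ws) (w≢v ∷ ps) w∈ with x∈p∪q⁻ ⁅ v ⁆ ⁅ ws ⁆* w∈
  ... | inj₁ p = w≢v (x∈⁅y⁆⇒x≡y v p)
  ... | inj₂ p = ∉-⁅⁆* ws ps p

  does⁻ : ∀ {p} {P : Set p} (P? : Dec P) → does P? ≡ true → P
  does⁻ (yes p) _ = p

  does-false⁻ : ∀ {p} {P : Set p} (P? : Dec P) → does P? ≡ false → ¬ P
  does-false⁻ (no ¬p) _ = ¬p

  edgeᵇ : ∀ {k n} → Hypergraph k n → Vec (Fin n) k → Bool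
  edgeᵇ H t = does (member? (E H) (support t))

  edgeᵇ⇒∈ : ∀ {k n} (H : Hypergraph k n) t → edgeᵇ H t ≡ true → support t ∈ₛ E H
  edgeᵇ⇒∈ H t = does⁻ (member? (E H) (support t))

  degree : ∀ {m n} → Hypergraph (suc m) n → Fin n → ℚ
  degree {m} H i = ∑ₜ m (λ is → ⟦ edgeᵇ H (i ∷ is) ⟧)

  module _ {l n : ℕ} (H : Hypergraph (suc (suc l)) n) (B : ℕ) where

    private
      k m : ℕ
      k = suc (suc l)
      m = suc l

    -- The number of m-tuples meeting a given set of B vertices is at most this.
    threshold : ℚ
    threshold = ι m * (ι B * ι n ^ l)

    Heavy : Fin n → Set
    Heavy i = threshold < degree H i

    -- More tuples complete w to an edge than meet F, so one of them completes w and avoids F.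
    edge-avoiding : ∀ {w} (F : Subset n) → Heavy w → ∣ F ∣ ℕ.≤ B → w ∉ F →
                    ∃ λ e → e ∈ₛ E H × w ∈ e × Empty (e ∩ F)
    edge-avoiding {w} F heavy ∣F∣≤B w∉F = from (∑ₜ-< m (≤-<-trans (begin
      ∑ₜ m (λ is → ⟦ meets (lookup F) is ⟧)
        ≡⟨ ∑ₜ-cong m (λ is → sym (trans (cong (⟦ meets (lookup F) is ⟧ *_) (⟪⟫-one is)) (*-identityʳ ⟦ meets (lookup F) is ⟧))) ⟩
      ∑ₜ m (λ is → ⟦ meets (lookup F) is ⟧ * (λ _ → 1ℚ) ⟪ is ⟫)
        ≤⟨ ∑ₜ-meets l (lookup F) (λ _ → 1ℚ) (λ _ → 0≤1) ⟩
      ι m * (sum (λ i → ⟦ lookup F i ⟧ * 1ℚ) * sum {n} (λ _ → 1ℚ) ^ l)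
        ≡⟨ cong₂ (λ x y → ι m * (x * y ^ l))
             (trans (sum-cong (λ i → *-identityʳ ⟦ lookup F i ⟧)) (sym (ι∣∣ F)))
             (trans (sum-const n 1ℚ) (*-identityʳ (ι n))) ⟩
      ι m * (ι ∣ F ∣ * ι n ^ l)
        ≤⟨ *-monoˡ (0≤ι m) (*-monoʳ (^-nonneg l (0≤ι n)) (ι-mono ∣F∣≤B)) ⟩
      threshold ∎) heavy))
      where
      open ≤-Reasoning
      from : (∃ λ is → ⟦ meets (lookup F) is ⟧ < ⟦ edgeᵇ H (w ∷ is) ⟧) → ∃ λ e → e ∈ₛ E H × w ∈ e × Empty (e ∩ F)
      from (is , lt) with edgeᵇ H (w ∷ is) in edge | meets (lookup F) is in meet
      ... | false | b = contradiction (<-≤-trans lt (0≤⟦⟧ b)) (<-irrefl refl)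
      ... | true | true = contradiction lt (<-irrefl refl)
      ... | true | false = support (w ∷ is) , edgeᵇ⇒∈ H (w ∷ is) edge , ∈-support⁺ (w ∷ is) zero , disjoint
        where
        disjoint : Empty (support (w ∷ is) ∩ F)
        disjoint (i , i∈) with x∈p∩q⁻ (support (w ∷ is)) F i∈
        ... | i∈e , i∈F with ∈-support⁻ (w ∷ is) i∈e
        ...   | zero , refl = w∉F i∈F
        ...   | suc j , refl = case trans (sym meet) (meets⁺ (lookup F) is j (∈⇒lookup i∈F)) of λ ()

    -- The edge chosen at w also avoids the vertices still waiting in ws, so that these remain
    -- available. F collects the vertices already covered; each step adds k of them, and B is the
    -- budget for this.
    greedy : ∀ (ws : List (Fin n)) (F : Subset n) → Unique ws → All Heavy ws → All (_∉ F) ws →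
             ∣ F ∣ ℕ.+ k ℕ.* length ws ℕ.≤ B →
             ∃ λ M → IsMatching H M × length M ≡ length ws × All (λ e → Empty (e ∩ F)) M
    greedy [] F _ _ _ _ = [] , ([] , [] , []) , refl , []
    greedy (w ∷ ws) F (w∉ws ∷ uniq) (heavy ∷ heavies) (w∉F ∷ ws∉F) room =
      extend (edge-avoiding (F ∪ ⁅ ws ⁆*) heavy room₁ w∉)
      where
      room₁ : ∣ F ∪ ⁅ ws ⁆* ∣ ℕ.≤ B
      room₁ = ℕ.≤-trans (∣∪∣≤ F ⁅ ws ⁆*) (ℕ.≤-trans
        (ℕ.+-monoʳ-≤ ∣ F ∣ (ℕ.≤-trans (∣⁅⁆*∣≤ ws) (ℕ.≤-trans (ℕ.n≤1+n (length ws)) (ℕ.m≤n*m (suc (length ws)) k)))) room)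
      w∉ : w ∉ F ∪ ⁅ ws ⁆*
      w∉ w∈ with x∈p∪q⁻ F ⁅ ws ⁆* w∈
      ... | inj₁ w∈F = w∉F w∈F
      ... | inj₂ w∈ws = ∉-⁅⁆* ws w∉ws w∈ws
      Goal : Set
      Goal = ∃ λ M → IsMatching H M × length M ≡ suc (length ws) × All (λ e → Empty (e ∩ F)) M
      extend : (∃ λ e → e ∈ₛ E H × w ∈ e × Empty (e ∩ (F ∪ ⁅ ws ⁆*))) → Goal
      extend (e , e∈ , w∈e , disj) = finish (greedy ws (F ∪ e) uniq heavies ws∉ room₂)
        where
        e∩ws : Empty (e ∩ ⁅ ws ⁆*)
        e∩ws (i , i∈) = let i∈e , i∈ws = x∈p∩q⁻ e ⁅ ws ⁆* i∈ in disj (i , x∈p∩q⁺ (i∈e , x∈p∪q⁺ (inj₂ i∈ws)))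
        ∉F∪e : ∀ {i} → i ∉ F × i ∉ e → i ∉ F ∪ e
        ∉F∪e (p , q) i∈ with x∈p∪q⁻ F e i∈
        ... | inj₁ i∈F = p i∈F
        ... | inj₂ i∈e = q i∈e
        ws∉ : All (_∉ F ∪ e) ws
        ws∉ = All.zipWith ∉F∪e (ws∉F , ∉⁅⁆*⇒All ws e∩ws)
        room₂ : ∣ F ∪ e ∣ ℕ.+ k ℕ.* length ws ℕ.≤ B
        room₂ = ℕ.≤-trans (ℕ.+-monoˡ-≤ (k ℕ.* length ws) (∣∪∣≤ F e)) (ℕ.≤-trans (ℕ.≤-reflexive
          (trans (cong (λ x → ∣ F ∣ ℕ.+ x ℕ.+ k ℕ.* length ws) (uniform H e∈))
            (trans (ℕ.+-assoc ∣ F ∣ k (k ℕ.* length ws)) (cong (∣ F ∣ ℕ.+_) (sym (ℕ.*-suc k (length ws))))))) room)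
        e∩f : ∀ {f} → Empty (f ∩ (F ∪ e)) → Empty (e ∩ f)
        e∩f {f} d (i , i∈) = let i∈e , i∈f = x∈p∩q⁻ e f i∈ in d (i , x∈p∩q⁺ (i∈f , x∈p∪q⁺ (inj₂ i∈e)))
        e≢ : ∀ {f} → Empty (f ∩ (F ∪ e)) → ¬ e ≡ f
        e≢ d refl = e∩f d (w , x∈p∩q⁺ (w∈e , w∈e))
        finish : (∃ λ M → IsMatching H M × length M ≡ length ws × All (λ f → Empty (f ∩ (F ∪ e))) M) → Goal
        finish (M , (all , unique , pairs) , len , disjM) =
          e ∷ M ,
          (e∈ ∷ all , All.map e≢ disjM ∷ unique , All.map (λ {f} → e∩f {f}) disjM ∷ pairs) ,
          cong suc len ,
          (λ (i , i∈) → let i∈e , i∈F = x∈p∩q⁻ e F i∈ in disj (i , x∈p∩q⁺ (i∈e , x∈p∪q⁺ (inj₁ i∈F)))) ∷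
            All.map (λ {f} d (i , i∈) → let i∈f , i∈F = x∈p∩q⁻ f F i∈ in d (i , x∈p∩q⁺ (i∈f , x∈p∪q⁺ (inj₁ i∈F)))) disjM

    heavySet : Subset n
    heavySet = tabulate (λ i → does (threshold <? degree H i))

    ∈-heavySet⁻ : ∀ {i} → i ∈ heavySet → Heavy i
    ∈-heavySet⁻ {i} i∈ = does⁻ (threshold <? degree H i)
      (trans (sym (lookup∘tabulate (λ i → does (threshold <? degree H i)) i)) (∈⇒lookup i∈))

    ∉-heavySet : ∀ i → lookup heavySet i ≡ false → degree H i ≤ threshold
    ∉-heavySet i h = ≮⇒≥ (does-false⁻ (threshold <? degree H i)
      (trans (sym (lookup∘tabulate (λ i → does (threshold <? degree H i)) i)) h))

    module _ {β : ℕ} (B≡ : B ≡ k ℕ.* suc β) (μ≤β : ∀ M → IsMatching H M → length M ℕ.≤ β) where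

      heavySet-small : ∣ heavySet ∣ ℕ.≤ β
      heavySet-small = ℕ.≮⇒≥ λ β<W → 
        -- Only β + 1 heavy vertices are taken, since B = k (β + 1) has no room for more.
        let ws = List.take (suc β) (elements heavySet)
            len : length ws ≡ suc β
            len = trans (List.length-take (suc β) (elements heavySet))
              (ℕ.m≤n⇒m⊓n≡m (ℕ.≤-trans β<W (ℕ.≤-reflexive (sym (length-elements heavySet)))))
            M , match , lenM , _ = greedy ws ⊥ (Unique.take⁺ (suc β) (elements-unique heavySet))
              (All.take⁺ (suc β) (All.map ∈-heavySet⁻ (elements-∈ heavySet))) (All.universal (λ _ → ∉⊥) ws)
              (ℕ.≤-reflexive (trans (cong₂ (λ x y → x ℕ.+ k ℕ.* y) (∣⊥∣≡0 n) len) (sym B≡)))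
        in ℕ.1+n≰n (ℕ.≤-trans (ℕ.≤-reflexive (sym (trans lenM len))) (μ≤β M match))

      -- An edge e missing `heavySet` would extend a greedy matching of β edges disjoint from it.
      -- The k vertices of e and the β steps exhaust B exactly.
      heavySet-covers : ∣ heavySet ∣ ≡ β → ∀ e → e ∈ₛ E H → Nonempty (e ∩ heavySet)
      heavySet-covers size≡β e e∈ = decidable-stable (nonempty? (e ∩ heavySet)) λ e∩W →
        larger (greedy (elements heavySet) e (elements-unique heavySet) (All.map ∈-heavySet⁻ (elements-∈ heavySet))
          (All.map (λ w∈W w∈e → e∩W (_ , x∈p∩q⁺ (w∈e , w∈W))) (elements-∈ heavySet)) room)
        where
        len : length (elements heavySet) ≡ β
        len = trans (length-elements heavySet) size≡β
        room : ∣ e ∣ ℕ.+ k ℕ.* length (elements heavySet) ℕ.≤ B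
        room = ℕ.≤-reflexive (trans (cong₂ (λ x y → x ℕ.+ k ℕ.* y) (uniform H e∈) len) (trans (sym (ℕ.*-suc k β)) (sym B≡)))
        disjoint-sym : ∀ {f} → Empty (f ∩ e) → Empty (e ∩ f)
        disjoint-sym {f} d (i , i∈) = let i∈e , i∈f = x∈p∩q⁻ e f i∈ in d (i , x∈p∩q⁺ (i∈f , i∈e))
        e-nonempty : Nonempty e
        e-nonempty = decidable-stable (nonempty? e) λ h →
          case trans (sym (uniform H e∈)) (trans (cong ∣_∣ (Empty-unique h)) (∣⊥∣≡0 n)) of λ ()
        e≢ : ∀ {f} → Empty (f ∩ e) → ¬ e ≡ f
        e≢ d refl = let i , i∈ = e-nonempty in d (i , x∈p∩q⁺ (i∈ , i∈))
        larger : (∃ λ M → IsMatching H M × length M ≡ length (elements heavySet) × All (λ f → Empty (f ∩ e)) M) → Empty.⊥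
        larger (M , (all , unique , pairs) , lenM , disj) = ℕ.1+n≰n (ℕ.≤-trans
          (ℕ.≤-reflexive (cong suc (sym (trans lenM len))))
          (μ≤β (e ∷ M) (e∈ ∷ all , All.map e≢ disj ∷ unique , All.map (λ {f} → disjoint-sym {f}) disj ∷ pairs)))

-- The symmetric difference consists of missing edges, counted by tuples

module MissingEdges where

  open import Data.Rational.Base using (_≤_; _<_)
  open import Data.Fin.Subset using (∣_∣)
  open import Data.List.Base using (List; []; _∷_; length)
  open RationalSums
  open CrossingTuples
  open HeavyVertices

  toℕ-punchIn-last : ∀ n (j : Fin n) → Fin.toℕ (Fin.punchIn (Fin.fromℕ n) j) ≡ Fin.toℕ j
  toℕ-punchIn-last (suc n) zero = refl
  toℕ-punchIn-last (suc n) (suc j) = cong suc (toℕ-punchIn-last n j)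

  ≮ᵇ : ∀ {m n} → n ℕ.≤ m → (m <ᵇ n) ≡ false
  ≮ᵇ {m} {n} n≤m with m <ᵇ n in eq
  ... | false = refl
  ... | true = contradiction (ℕ.≤-trans (ℕ.<ᵇ⇒< m n (subst Bool.T (sym eq) _)) n≤m) (ℕ.<-irrefl refl)

  -- By recursion on the vertices: the first vertex stays in front if it belongs to W and goes to
  -- the last position otherwise.
  to-initial : ∀ {n} (W : Subset n) → ∃ λ (σ : Permutation′ n) → ∀ j → lookup W (σ ⟨$⟩ˡ j) ≡ (Fin.toℕ j <ᵇ ∣ W ∣)
  to-initial [] = Perm.id , λ ()
  to-initial (true ∷ p) with to-initial p
  ... | σ , eq = Perm.lift₀ σ , λ { zero → refl ; (suc j) → eq j }
  to-initial {suc n} (false ∷ p) with to-initial p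
  ... | σ , eq = Perm.insert zero (Fin.fromℕ n) σ , eq′
    where
    eq′ : ∀ j → lookup (false ∷ p) (Perm.insert zero (Fin.fromℕ n) σ ⟨$⟩ˡ j) ≡ (Fin.toℕ j <ᵇ ∣ p ∣)
    eq′ j with Fin.fromℕ n Fin.≟ j
    ... | yes refl = sym (≮ᵇ (ℕ.≤-trans (∣p∣≤n p) (ℕ.≤-reflexive (sym (Fin.toℕ-fromℕ n)))))
    ... | no last≢j = trans (eq (Fin.punchOut last≢j)) (cong (_<ᵇ ∣ p ∣)
      (trans (sym (toℕ-punchIn-last n (Fin.punchOut last≢j))) (cong Fin.toℕ (Fin.punchIn-punchOut last≢j))))

  ∑ˡ : ∀ {A : Set} → List A → (A → ℚ) → ℚ
  ∑ˡ [] f = 0ℚ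
  ∑ˡ (x ∷ xs) f = f x + ∑ˡ xs f

  ∑ˡ-++ : ∀ {A : Set} (xs ys : List A) f → ∑ˡ (xs List.++ ys) f ≡ ∑ˡ xs f + ∑ˡ ys f
  ∑ˡ-++ [] ys f = sym (+-identityˡ (∑ˡ ys f))
  ∑ˡ-++ (x ∷ xs) ys f = trans (cong (f x +_) (∑ˡ-++ xs ys f)) (sym (+-assoc (f x) (∑ˡ xs f) (∑ˡ ys f)))

  ∑ˡ-map : ∀ {A B : Set} (g : A → B) xs f → ∑ˡ (List.map g xs) f ≡ ∑ˡ xs (f ∘ g)
  ∑ˡ-map g [] f = refl
  ∑ˡ-map g (x ∷ xs) f = cong (f (g x) +_) (∑ˡ-map g xs f)

  ∑ˡ-mono : ∀ {A : Set} (xs : List A) {f g : A → ℚ} → (∀ x → f x ≤ g x) → ∑ˡ xs f ≤ ∑ˡ xs g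
  ∑ˡ-mono [] h = ≤-refl
  ∑ˡ-mono (x ∷ xs) h = +-mono-≤ (h x) (∑ˡ-mono xs h)

  ∑ˡ-*ˡ : ∀ {A : Set} (xs : List A) c (f : A → ℚ) → ∑ˡ xs (λ x → c * f x) ≡ c * ∑ˡ xs f
  ∑ˡ-*ˡ [] c f = sym (*-zeroʳ c)
  ∑ˡ-*ˡ (x ∷ xs) c f = trans (cong (c * f x +_) (∑ˡ-*ˡ xs c f)) (sym (*-distribˡ-+ c (f x) (∑ˡ xs f)))

  ∑ˡ-∑ₜ : ∀ {A : Set} (xs : List A) k {n} (f : A → Vec (Fin n) k → ℚ) →
          ∑ˡ xs (λ x → ∑ₜ k (f x)) ≡ ∑ₜ k (λ t → ∑ˡ xs (λ x → f x t))
  ∑ˡ-∑ₜ [] k {n} f = sym (∑ₜ-zero k {n} (λ _ → refl))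
  ∑ˡ-∑ₜ (x ∷ xs) k f = trans (cong (∑ₜ k (f x) +_) (∑ˡ-∑ₜ xs k f)) (sym (∑ₜ-distrib-+ k (f x) (λ t → ∑ˡ xs (λ x → f x t))))

  length-filter : ∀ {A : Set} {P : Pred A 0ℓ} (P? : Decidable P) xs → ι (length (List.filter P? xs)) ≡ ∑ˡ xs (λ x → ⟦ does (P? x) ⟧)
  length-filter P? [] = refl
  length-filter P? (x ∷ xs) with does (P? x)
  ... | true = cong (1ℚ +_) (length-filter P? xs)
  ... | false = trans (length-filter P? xs) (sym (+-identityˡ (∑ˡ xs (λ x → ⟦ does (P? x) ⟧))))

  _≟ₛ_ : ∀ {n} (p q : Subset n) → Dec (p ≡ q)
  _≟ₛ_ = ≡-dec Bool._≟_

  ∑-allSubsets : ∀ {n} (s : Subset n) → ∑ˡ (allSubsets n) (λ e → ⟦ does (s ≟ₛ e) ⟧) ≤ 1ℚ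
  ∑-allSubsets [] = ≤-reflexive (+-identityʳ 1ℚ)
  ∑-allSubsets {suc n} (b ∷ s) = ≤-trans (≤-reflexive (trans
    (∑ˡ-++ (List.map (outside ∷_) (allSubsets n)) (List.map (inside ∷_) (allSubsets n)) _)
    (cong₂ _+_ (∑ˡ-map (outside ∷_) (allSubsets n) _) (∑ˡ-map (inside ∷_) (allSubsets n) _)))) (go b)
    where
    none : ∑ˡ (allSubsets n) (λ _ → 0ℚ) ≡ 0ℚ
    none = trans (∑ˡ-*ˡ (allSubsets n) 0ℚ (λ _ → 0ℚ)) (*-zeroˡ (∑ˡ (allSubsets n) (λ _ → 0ℚ)))
    go : ∀ b → ∑ˡ (allSubsets n) (λ e → ⟦ does ((b ∷ s) ≟ₛ (outside ∷ e)) ⟧) +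
               ∑ˡ (allSubsets n) (λ e → ⟦ does ((b ∷ s) ≟ₛ (inside ∷ e)) ⟧) ≤ 1ℚ
    go false = ≤-trans (≤-reflexive (trans (cong (∑ˡ (allSubsets n) (λ e → ⟦ does (s ≟ₛ e) ⟧) +_) none) (+-identityʳ _))) (∑-allSubsets s)
    go true = ≤-trans (≤-reflexive (trans (cong (_+ ∑ˡ (allSubsets n) (λ e → ⟦ does (s ≟ₛ e) ⟧)) none) (+-identityˡ _))) (∑-allSubsets s)

  ⁅⁆*-map-suc : ∀ {n} (ws : List (Fin n)) → ⁅ List.map suc ws ⁆* ≡ outside ∷ ⁅ ws ⁆*
  ⁅⁆*-map-suc [] = refl
  ⁅⁆*-map-suc (w ∷ ws) = cong (⁅ suc w ⁆ ∪_) (⁅⁆*-map-suc ws)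

  ⁅elements⁆* : ∀ {n} (p : Subset n) → ⁅ elements p ⁆* ≡ p
  ⁅elements⁆* [] = refl
  ⁅elements⁆* (true ∷ p) = trans (cong (⁅ zero ⁆ ∪_) (⁅⁆*-map-suc (elements p)))
    (cong (inside ∷_) (trans (∪-identityˡ ⁅ elements p ⁆*) (⁅elements⁆* p)))
  ⁅elements⁆* (false ∷ p) = trans (⁅⁆*-map-suc (elements p)) (cong (outside ∷_) (⁅elements⁆* p))

  listing : ∀ {n k} (e : Subset n) → ∣ e ∣ ≡ k → ∃ λ (t : Vec (Fin n) k) → support t ≡ e
  listing e refl = subst (λ k → ∃ λ (t : Vec _ k) → support t ≡ e) (length-elements e)
    (Vec.fromList (elements e) , trans (cong (λ ws → ⁅ ws ⁆*) (toList∘fromList (elements e))) (⁅elements⁆* e))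

  -- Every member is listed by at least one tuple; that it is in fact listed k! times is given away.
  card≤∑ₜ : ∀ {n k} (F : SetFamily n) → (∀ {e} → e ∈ₛ F → ∣ e ∣ ≡ k) → ι (card F) ≤ ∑ₜ k (λ t → ⟦ does (member? F (support t)) ⟧)
  card≤∑ₜ {n} {k} F F-uniform = begin
    ι (card F)
      ≡⟨ length-filter (member? F) (allSubsets n) ⟩
    ∑ˡ (allSubsets n) (λ e → in-F e)
      ≤⟨ ∑ˡ-mono (allSubsets n) spread ⟩
    ∑ˡ (allSubsets n) (λ e → ∑ₜ k (λ t → in-F e * ⟦ does (support t ≟ₛ e) ⟧))
      ≡⟨ ∑ˡ-∑ₜ (allSubsets n) k (λ e t → in-F e * ⟦ does (support t ≟ₛ e) ⟧) ⟩
    ∑ₜ k (λ t → ∑ˡ (allSubsets n) (λ e → in-F e * ⟦ does (support t ≟ₛ e) ⟧))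
      ≤⟨ ∑ₜ-mono k (λ t → ≤-trans (≤-trans (∑ˡ-mono (allSubsets n) (same t))
           (≤-reflexive (∑ˡ-*ˡ (allSubsets n) (in-F (support t)) (λ e → ⟦ does (support t ≟ₛ e) ⟧))))
           (≤-trans (*-monoˡ (0≤⟦⟧ (does (member? F (support t)))) (∑-allSubsets (support t))) (≤-reflexive (*-identityʳ (in-F (support t)))))) ⟩
    ∑ₜ k (λ t → in-F (support t)) ∎
    where
    open ≤-Reasoning
    in-F : Subset n → ℚ
    in-F e = ⟦ does (member? F e) ⟧
    same : ∀ t e → in-F e * ⟦ does (support t ≟ₛ e) ⟧ ≤ in-F (support t) * ⟦ does (support t ≟ₛ e) ⟧
    same t e with support t ≟ₛ e
    ... | yes eq = ≤-reflexive (cong (λ s → in-F s * 1ℚ) (sym eq))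
    ... | no _ = ≤-reflexive (trans (*-zeroʳ (in-F e)) (sym (*-zeroʳ (in-F (support t)))))
    spread : ∀ e → in-F e ≤ ∑ₜ k (λ t → in-F e * ⟦ does (support t ≟ₛ e) ⟧)
    spread e with member? F e
    ... | no _ = ∑ₜ-nonneg k (λ t → *-nonneg ≤-refl (0≤⟦⟧ (does (support t ≟ₛ e))))
    ... | yes e∈F with listing e (F-uniform e∈F)
    ...   | t , eq = ≤-trans (≤-reflexive (sym (trans (*-identityˡ _) (cong ⟦_⟧ (dec-true (support t ≟ₛ e) eq)))))
      (∑ₜ-term k (λ t → *-nonneg 0≤1 (0≤⟦⟧ (does (support t ≟ₛ e)))) t)

  edgeᵇ-insertAt : ∀ {l n} (H : Hypergraph (suc l) n) (is : Vec (Fin n) l) j i → edgeᵇ H (insertAt is j i) ≡ edgeᵇ H (i ∷ is)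
  edgeᵇ-insertAt H is j i = cong (λ e → does (member? (E H) e)) (support-insertAt is j i)

  edge⇒crossing : ∀ {n k} (H : Hypergraph k n) (W : Subset n) → (∀ e → e ∈ₛ E H → Nonempty (e ∩ W)) →
                  ∀ t → edgeᵇ H t ≡ true → crossing (lookup W) t ≡ true
  edge⇒crossing {k = k} H W cover t h =
    cong₂ _∧_ (dec-true (∣ support t ∣ ℕ.≟ k) (uniform H t∈)) (meets-∩⁺ t W (cover (support t) t∈))
    where
    t∈ : support t ∈ₛ E H
    t∈ = edgeᵇ⇒∈ H t h

  module _ {n k β : ℕ} (H : Hypergraph k n) (W : Subset n) (cover : ∀ e → e ∈ₛ E H → Nonempty (e ∩ W))
           (σ : Permutation′ n) (σW : image σ W ≡ initial n β) where

    private
      Δ : SetFamily n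
      Δ = relabel σ (E H) △ E (S n k β)

      Δ-uniform : ∀ {e} → e ∈ₛ Δ → ∣ e ∣ ≡ k
      Δ-uniform (inj₁ ((e , e∈H , refl) , _)) = trans (∣image∣ σ e) (uniform H e∈H)
      Δ-uniform (inj₂ ((eq , _) , _)) = eq

      -- All edges of H meet W, so their images are edges of S, and only edges of S outside the
      -- image of H are left in the difference.
      Δ⇒missing : ∀ t → image σ (support t) ∈ₛ Δ → crossing (lookup W) t ∧ not (edgeᵇ H t) ≡ true
      Δ⇒missing t (inj₁ ((e , e∈H , eq) , ∉S)) = contradiction
        (trans (cong ∣_∣ eq) (trans (∣image∣ σ e) (uniform H e∈H)) , subst (λ p → Nonempty (p ∩ initial n β)) (sym eq) nonempty) ∉S
        where
        nonempty : Nonempty (image σ e ∩ initial n β)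
        nonempty = let i , i∈ = cover e e∈H
                       i∈e , i∈W = x∈p∩q⁻ e W i∈ in
          σ ⟨$⟩ʳ i , x∈p∩q⁺ (∈-image⁺ σ e (subst (_∈ e) (sym (Perm.inverseˡ σ)) i∈e) ,
                             subst (σ ⟨$⟩ʳ i ∈_) σW (∈-image⁺ σ W (subst (_∈ W) (sym (Perm.inverseˡ σ)) i∈W)))
      Δ⇒missing t (inj₂ ((size , j , j∈) , ∉H)) = cong₂ _∧_
        (cong₂ _∧_ (dec-true (∣ support t ∣ ℕ.≟ k) (trans (sym (∣image∣ σ (support t))) size)) (meets-∩⁺ t W
          (let j∈t , j∈W = x∈p∩q⁻ (image σ (support t)) (initial n β) j∈ in
            σ ⟨$⟩ˡ j , x∈p∩q⁺ (∈-image⁻ σ (support t) j∈t , ∈-image⁻ σ W (subst (j ∈_) (sym σW) j∈W)))))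
        (cong not (dec-false (member? (E H) (support t)) λ t∈ → ∉H (support t , t∈ , refl)))

    card-△≤ : ι (card (relabel σ (E H) △ E (S n k β))) ≤ ∑ₜ k (λ t → ⟦ crossing (lookup W) t ∧ not (edgeᵇ H t) ⟧)
    card-△≤ = ≤-trans (card≤∑ₜ Δ Δ-uniform) (≤-trans
      (≤-reflexive (∑ₜ-permute k (λ t → ⟦ does (member? Δ (support t)) ⟧) σ))
      (∑ₜ-mono k λ t → ⟦⟧-mono λ h → Δ⇒missing t (subst (_∈ₛ Δ) (support-map σ t)
        (does⁻ (member? Δ (support (Vec.map (σ ⟨$⟩ʳ_) t))) h))))

-- The argument over ℚ, at a single index of the Cauchy sequences

module RationalCore where

  open import Data.Rational.Base using (_≤_; _<_)
  open import Data.Fin.Subset using (∣_∣)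
  open import Data.List.Base using (length)
  open RationalSums
  open TupleInequalities
  open DistinctTuples
  open CrossingTuples
  open Regimes
  open Stability
  open HeavyVertices
  open MissingEdges

  first : ∀ {n} → ℕ → Fin n → Bool
  first β j = Fin.toℕ j <ᵇ β

  size-first : ∀ {n β} → β ℕ.≤ n → size {n} (first β) ≡ ι β
  size-first {zero} ℕ.z≤n = refl
  size-first {suc n} ℕ.z≤n = sum-zero {suc n} (λ _ → refl)
  size-first {suc n} (ℕ.s≤s β≤n) = cong (1ℚ +_) (size-first β≤n)

  module _ {l β n : ℕ} {a h : ℚ} (R : Regime l β n a h) (β≤n : β ℕ.≤ n) where

    open Regime R
    open ≤-Reasoning

    sum-weight≤X : sum (weight {n} (first β) a) ≤ X
    sum-weight≤X = begin
      sum (weight {n} (first β) a)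
        ≤⟨ sum-weight≤ {n} (first β) {a} 0≤a ⟩
      N + size {n} (first β) * a
        ≡⟨ cong (λ s → N + s * a) (size-first {n} {β} β≤n) ⟩
      N + b * a
        ≤⟨ by-difference (b * a) (*-nonneg 0≤b 0≤a) (solve 3 (λ N b a → N :+ con (ι 2) :* b :* a := (N :+ b :* a) :+ b :* a) refl N b a) ⟩
      X ∎

    link-in-lower : ∀ (w : Fin n) → first β w ≡ true → D ^ suc l ≤ link (suc l) (first β) a w
    link-in-lower w w-in = link-in-≥ (suc l) (first β) w w-in 1≤a 0≤D (begin
      size {n} (first β) + M + D
        ≡⟨ cong (λ s → s + M + D) (size-first {n} {β} β≤n) ⟩
      b + M + (N - (b + 1ℚ + M))
        ≤⟨ by-difference 1ℚ 0≤1 (solve 3 (λ b M N → N := (b :+ M :+ (N :- (b :+ con 1ℚ :+ M))) :+ con 1ℚ) refl b M N) ⟩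
      N ∎)

    link-out-lower : ∀ (v : Fin n) → first β v ≡ false → M * (b * a) * D ^ l ≤ link (suc l) (first β) a v
    link-out-lower v v-out = subst (λ s → M * (s * a) * D ^ l ≤ link (suc l) (first β) a v) (size-first {n} {β} β≤n)
      (link-out-≥ l (first β) v v-out 1≤a 0<D (begin
        size {n} (first β) + 1ℚ + M + D
          ≡⟨ cong (λ s → s + 1ℚ + M + D) (size-first {n} {β} β≤n) ⟩
        b + 1ℚ + M + (N - (b + 1ℚ + M))
          ≡⟨ solve 2 (λ c N → c :+ (N :- c) := N) refl (b + 1ℚ + M) N ⟩
        N ∎))

    link-in-upper : ∀ (w : Fin n) → link (suc l) (first β) a w ≤ X ^ suc l
    link-in-upper w = ≤-trans (link-≤ (suc l) (first β) {a} w 1≤a)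
      (^-mono {sum (weight {n} (first β) a)} (suc l) (sum-nonneg (weight-≥0 {n} (first β) {a} 1≤a)) sum-weight≤X)

    link-out-upper : ∀ (v : Fin n) → first β v ≡ false → link (suc l) (first β) a v ≤ M * (b * a * X ^ l)
    link-out-upper v v-out = ≤-trans (link-out-≤ l (first β) {a} v v-out 1≤a)
      (*-monoˡ 0≤M (≤-trans (≤-reflexive (cong (λ s → s * a * sum (weight {n} (first β) a) ^ l) (size-first {n} {β} β≤n)))
        (*-monoˡ (*-nonneg 0≤b 0≤a) (^-mono {sum (weight {n} (first β) a)} l (sum-nonneg (weight-≥0 {n} (first β) {a} 1≤a)) sum-weight≤X))))

  -- Rational approximation, from above, to the ratio a of the entries of the
  -- Perron vector of S inside and outside [β], together with a test vector y
  -- for H; link m (first β) a v approximates (k − 1)! ρ(S).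
  record Witness {l β n : ℕ} (h : ℚ) (H : Hypergraph (suc (suc l)) n) (v w : Fin n) (δ : ℚ) : Set where
    field
      a       : ℚ
      regime  : Regime l β n a h
      a-large : ι 32 * ι (suc (suc l) ℕ.* suc β) ≤ a
      lower   : link (suc l) (first β) a w ≤ link (suc l) (first β) a v * a ^ suc l
      upper   : link (suc l) (first β) a v * a ^ suc l ≤ link (suc l) (first β) a w + 1ℚ
      y       : Fin n → ℚ
      0≤y     : ∀ i → 0ℚ ≤ y i
      0<Y     : 0ℚ < Y (suc (suc l)) y
      large   : (1ℚ - δ) * (link (suc l) (first β) a v * Y (suc (suc l)) y) ≤ Z (edgeᵇ H) y

  module _ {l β n : ℕ} {h δ : ℚ} {H : Hypergraph (suc (suc l)) n} {v w : Fin n} (4δ≤h : ι 4 * δ ≤ h)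
           (β≤n : β ℕ.≤ n) (v-out : first β v ≡ false) (w-in : first β w ≡ true)
           (μ≤β : ∀ M → IsMatching H M → length M ℕ.≤ β)
           (wit : Witness {β = β} h H v w δ)
    where

    open Witness wit
    open Regime regime
    open ≤-Reasoning

    private
      k m B : ℕ
      k = suc (suc l)
      m = suc l
      B = k ℕ.* suc β

      Λ : ℚ
      Λ = link m (first β) a v

      W : Subset n
      W = heavySet H B

      inΛ : D ^ m ≤ Λ * a ^ m
      inΛ = ≤-trans (link-in-lower regime β≤n w w-in) lower

      outΛ : M * (b * a) * D ^ l ≤ Λ
      outΛ = link-out-lower regime β≤n v v-out

      -- Since h b = 1/8 and 1 - h ≥ 1/2, the right side is at least M a Nˡ / 16. So a ≥ 32 B is
      -- enough, which is the origin of `a-large`.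
      2threshold≤ : ι 2 * threshold H B ≤ h * Λ
      2threshold≤ = begin
        ι 2 * (M * (ι B * N ^ l))
          ≡⟨ sym (trans (cong (ι 2 * (M * (ι B * N ^ l)) *_) 8bh≡1) (*-identityʳ (ι 2 * (M * (ι B * N ^ l))))) ⟩
        ι 2 * (M * (ι B * N ^ l)) * (ι 8 * b * h)
          ≤⟨ by-difference (M * b * h * N ^ l * ((½a-h) + ½ * (a - ι 32 * ι B)))
               (*-nonneg (*-nonneg (*-nonneg (*-nonneg 0≤M 0≤b) 0≤h) (^-nonneg l 0≤N))
                 (+-nonneg 0≤½a-h (*-nonneg (ℚ.nonNegative⁻¹ ½) (0≤q-p a-large))))
               (solve 7 (λ M B x b h a g → h :* (M :* (b :* a) :* (g :* x)) :=
                  con (ι 2) :* (M :* (B :* x)) :* (con (ι 8) :* b :* h) :+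
                  M :* b :* h :* x :* ((g :- con ½) :* a :+ con ½ :* (a :- con (ι 32) :* B))) refl M (ι B) (N ^ l) b h a (1ℚ - h)) ⟩
        h * (M * (b * a) * ((1ℚ - h) * N ^ l))
          ≤⟨ *-monoˡ 0≤h (*-monoˡ (*-nonneg 0≤M (*-nonneg 0≤b 0≤a)) (≤-trans (*-monoˡ 0≤1-h (^-mono l 0≤N N≤X)) (X^≤D^ l (ℕ.n≤1+n l)))) ⟩
        h * (M * (b * a) * D ^ l)
          ≤⟨ *-monoˡ 0≤h outΛ ⟩
        h * Λ ∎
        where
        open import Data.Rational.Base using (½)
        ½a-h : ℚ
        ½a-h = (1ℚ - h - ½) * a
        0≤½a-h : 0ℚ ≤ ½a-h
        0≤½a-h = *-nonneg (*-cancelˡ {p = 0ℚ} {q = 1ℚ - h - ½} (0<ι 7) (by-difference ((1ℚ - ι 8 * h) + ι 3) (+-nonneg 0≤1-8h (0≤ι 3))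
          (solve 1 (λ h → con (ι 8) :* (con 1ℚ :- h :- con ½) := con (ι 8) :* con 0ℚ :+ ((con 1ℚ :- con (ι 8) :* h) :+ con (ι 3))) refl h))) 0≤a

    heavySet-full : ∣ heavySet H B ∣ ≡ β
    heavySet-full = decidable-stable (∣ W ∣ ℕ.≟ β) λ ∣W∣≢β →
      sparse-rest {Λ = Λ} {δ = δ} regime inΛ outΛ 4δ≤h (edgeᵇ H) (edgeᵇ-insertAt H) y 0≤y 0<Y large
        (lookup W) (V<b (ℕ.≤∧≢⇒< (heavySet-small H B refl μ≤β) ∣W∣≢β)) (threshold H B) 2threshold≤ deg
      where
      V<b : ∣ W ∣ ℕ.< β → size (lookup W) + 1ℚ ≤ b
      V<b lt = ≤-trans (≤-reflexive (trans (cong (_+ 1ℚ) (sym (ι∣∣ W))) (+-comm (ι ∣ W ∣) 1ℚ))) (ι-mono lt)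
      0≤threshold : 0ℚ ≤ threshold H B
      0≤threshold = *-nonneg 0≤M (*-nonneg (0≤ι B) (^-nonneg l 0≤N))
      -- A heavy row becomes empty once the edges meeting W are removed; any other row is bounded by
      -- `threshold` already.
      deg : ∀ i → ∑ₜ m (λ is → ⟦ edgeᵇ H (i ∷ is) ∧ not (lookup W i ∨ meets (lookup W) is) ⟧) ≤ threshold H B
      deg i = by (lookup W i) refl
        where
        by : ∀ b → lookup W i ≡ b → ∑ₜ m (λ is → ⟦ edgeᵇ H (i ∷ is) ∧ not (lookup W i ∨ meets (lookup W) is) ⟧) ≤ threshold H B
        by true Wi = ≤-trans (≤-reflexive (∑ₜ-zero m (λ is → cong ⟦_⟧
          (trans (cong (λ b → edgeᵇ H (i ∷ is) ∧ not (b ∨ meets (lookup W) is)) Wi) (Bool.∧-zeroʳ (edgeᵇ H (i ∷ is))))))) 0≤threshold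
        by false Wi = ≤-trans (∑ₜ-mono m (λ is → ⟦⟧-mono {edgeᵇ H (i ∷ is) ∧ not (lookup W i ∨ meets (lookup W) is)} (Bool.∧-conicalˡ (edgeᵇ H (i ∷ is)) (not (lookup W i ∨ meets (lookup W) is))))) (∉-heavySet H B i Wi)

    module _ (σ : Permutation′ n) (σW : image σ (heavySet H B) ≡ initial n β) where

      private
        lookupW : ∀ j → lookup W (σ ⟨$⟩ˡ j) ≡ first β j
        lookupW j = trans (sym (lookup∘tabulate (λ j → lookup W (σ ⟨$⟩ˡ j)) j))
          (trans (cong (λ p → lookup p j) σW) (lookup∘tabulate (first β) j))

        link-W : ∀ j → link m (lookup W) a (σ ⟨$⟩ˡ j) ≡ link m (first β) a j
        link-W j = trans (link-permute m (lookup W) a (Perm.flip σ) j) (link-cong m lookupW a j)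

        -- Off [β] this is an equality, by the choice of Λ. On [β] a rational a cannot be expected
        -- to solve the equation exactly, and `lower` supplies the direction that the AM-GM bound
        -- needs.
        eigen-initial : ∀ j → link m (first β) a j ≤ Λ * weight (first β) a j ^ m
        eigen-initial j = by (first β j) refl
          where
          by : ∀ b → first β j ≡ b → link m (first β) a j ≤ Λ * weight (first β) a j ^ m
          by true j-in = subst₂ _≤_ (link-const m (first β) a w j (trans w-in (sym j-in)))
            (cong (λ b → Λ * (if b then a else 1ℚ) ^ m) (sym j-in)) lower
          by false j-out = ≤-reflexive (trans (link-const m (first β) a j v (trans j-out (sym v-out)))
            (trans (sym (*-identityʳ Λ)) (cong (Λ *_) (trans (sym (1^ m)) (cong (λ b → (if b then a else 1ℚ) ^ m) (sym j-out))))))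

        eigen : ∀ i → link m (lookup W) a i ≤ Λ * weight (lookup W) a i ^ m
        eigen i = subst (λ i → link m (lookup W) a i ≤ Λ * weight (lookup W) a i ^ m) (Perm.inverseˡ σ)
          (subst₂ _≤_ (sym (link-W (σ ⟨$⟩ʳ i))) (cong (λ b → Λ * (if b then a else 1ℚ) ^ m) (sym (lookupW (σ ⟨$⟩ʳ i))))
            (eigen-initial (σ ⟨$⟩ʳ i)))

        Λ≤ : Λ * a ^ m ≤ ι 2 * X ^ m
        Λ≤ = begin
          Λ * a ^ m
            ≤⟨ upper ⟩
          link m (first β) a w + 1ℚ
            ≤⟨ +-mono-≤ {link m (first β) a w} {X ^ m} (link-in-upper regime β≤n w) (1≤^ m (≤-trans 1≤N N≤X)) ⟩
          X ^ m + X ^ m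
            ≡⟨ solve 1 (λ x → x :+ x := con (ι 2) :* x) refl (X ^ m) ⟩
          ι 2 * X ^ m ∎

      card-few : 0ℚ ≤ δ → ι (card (relabel σ (E H) △ E (S n k β))) ≤ ι k * (ι 32 * ι β * ι k) ^ k * ι 2 * (ι 2 * ι n) ^ m * δ
      card-few 0≤δ = ≤-trans
        (card-△≤ {β = β} H W (heavySet-covers H B refl μ≤β heavySet-full) σ σW)
        (missing-few {Λ = Λ} {δ = δ} regime inΛ outΛ 4δ≤h (edgeᵇ H) (edgeᵇ-insertAt H) y 0≤y 0<Y large (lookup W)
          (trans (sym (ι∣∣ W)) (cong ι heavySet-full))
          (edge⇒crossing H W (heavySet-covers H B refl μ≤β heavySet-full)) eigen Λ≤ 0≤δ)

-- Real numbers, bisection and square roots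

module RealNumbers where

  open import Data.Rational.Base using (_≤_; _<_; ∣_∣)
  open RationalSums

  Ev : (ℕ → Set) → Set
  Ev P = ∃ λ N → ∀ n → N ℕ.≤ n → P n

  ev-map : ∀ {P Q : ℕ → Set} → (∀ n → P n → Q n) → Ev P → Ev Q
  ev-map f (N , h) = N , λ n N≤n → f n (h n N≤n)

  ev-always : ∀ {P : ℕ → Set} → (∀ n → P n) → Ev P
  ev-always h = 0 , λ n _ → h n

  ev-× : ∀ {P Q : ℕ → Set} → Ev P → Ev Q → Ev (λ n → P n × Q n)
  ev-× (N , h) (M , g) = N ℕ.⊔ M , λ n le → h n (ℕ.m⊔n≤o⇒m≤o N M le) , g n (ℕ.m⊔n≤o⇒n≤o N M le)

  ev-witness : ∀ {P : ℕ → Set} → Ev P → ∃ P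
  ev-witness (N , h) = N , h N ℕ.≤-refl

  archimedean : ∀ q → ∃ λ n → q ≤ ι n
  archimedean q@(mkℚ p d-1 _) = ℤ.∣ p ∣ , ≤-trans q≤ (≤-reflexive (sym (trans (ι≡/1 ℤ.∣ p ∣) (ℚ.fromℚᵘ-cong {x = u} ℚᵘ.≃-refl))))
    where
    u : ℚᵘ.ℚᵘ
    u = ℚᵘ.mkℚᵘ (ℤ.+ ℤ.∣ p ∣) 0
    p≤∣p∣ : ∀ p → p ℤ.≤ ℤ.+ ℤ.∣ p ∣
    p≤∣p∣ (ℤ.+ n) = ℤ.≤-refl
    p≤∣p∣ ℤ.-[1+ n ] = ℤ.-≤+
    q≤ : q ≤ ℚ.fromℚᵘ u
    q≤ = ℚ.toℚᵘ-cancel-≤ (ℚᵘ.≤-trans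
      (ℚᵘ.*≤* (ℤ.≤-trans (ℤ.≤-reflexive (ℤ.*-identityʳ p)) (ℤ.≤-trans (p≤∣p∣ p)
        (ℤ.≤-trans (ℤ.≤-reflexive (sym (ℤ.*-identityʳ (ℤ.+ ℤ.∣ p ∣))))
          (ℤ.*-monoˡ-≤-nonNeg (ℤ.+ ℤ.∣ p ∣) (ℤ.+≤+ (ℕ.s≤s ℕ.z≤n)))))))
      (ℚᵘ.≤-reflexive (ℚᵘ.≃-sym (ℚ.toℚᵘ-fromℚᵘ u))))

  0<½ : 0ℚ < ½
  0<½ = ℚ.positive⁻¹ ½

  ½^-small : ∀ n → ι (suc n) * ½ ^ n ≤ 1ℚ
  ½^-small zero = ≤-refl
  ½^-small (suc n) = ≤-trans (by-difference (½ * ι n * ½ ^ n)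
      (*-nonneg (*-nonneg (<⇒≤ 0<½) (0≤ι n)) (^-nonneg n (<⇒≤ 0<½)))
      (solve 2 (λ n x → (con 1ℚ :+ n) :* x := (con 1ℚ :+ (con 1ℚ :+ n)) :* (con ½ :* x) :+ con ½ :* n :* x) refl (ι n) (½ ^ n)))
    (½^-small n)

  ½^-antitone : ∀ {m n} → m ℕ.≤ n → ½ ^ n ≤ ½ ^ m
  ½^-antitone {n = zero} ℕ.z≤n = ≤-refl
  ½^-antitone {n = suc n} ℕ.z≤n = ≤-trans (*-mono (<⇒≤ 0<½) 0≤1 (<⇒≤ (½<1)) (½^-antitone {n = n} ℕ.z≤n)) (≤-reflexive (*-identityˡ 1ℚ))
    where
    ½<1 : ½ < 1ℚ
    ½<1 = +-monoʳ-< ½ 0<½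
  ½^-antitone (ℕ.s≤s le) = *-monoˡ (<⇒≤ 0<½) (½^-antitone le)

  ev-½^ : ∀ {ε} → 0ℚ < ε → Ev (λ n → ½ ^ n < ε)
  ev-½^ {ε} 0<ε = from (recip 0<ε)
    where
    from : (∃ λ r → 0ℚ < r × ε * r ≡ 1ℚ) → Ev (λ n → ½ ^ n < ε)
    from (r , 0<r , εr≡1) = N , λ n N≤n → ≤-<-trans (½^-antitone N≤n) (ℚ.*-cancelʳ-<-nonNeg r {{ℚ.nonNegative (<⇒≤ 0<r)}} (begin-strict
        ½ ^ N * r       ≤⟨ *-monoˡ (^-nonneg N (<⇒≤ 0<½)) (proj₂ (archimedean r)) ⟩
        ½ ^ N * ι N     <⟨ *-monoˡ-< (^-pos N 0<½) (subst (_< ι (suc N)) (+-identityˡ (ι N)) (+-monoˡ-< (ι N) 0<1)) ⟩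
        ½ ^ N * ι (suc N) ≡⟨ *-comm (½ ^ N) (ι (suc N)) ⟩
        ι (suc N) * ½ ^ N ≤⟨ ½^-small N ⟩
        1ℚ              ≡⟨ sym εr≡1 ⟩
        ε * r           ∎))
      where
      open ≤-Reasoning
      N : ℕ
      N = proj₁ (archimedean r)

  -- Dividing by B + 1 instead of B covers B = 0 and makes the inequality strict.
  divide : ∀ {B ε} → 0ℚ ≤ B → 0ℚ < ε → ∃ λ η → 0ℚ < η × B * η < ε
  divide {B} {ε} 0≤B 0<ε = from (recip {B + 1ℚ} (ℚ.+-mono-≤-< 0≤B 0<1))
    where
    from : (∃ λ r → 0ℚ < r × (B + 1ℚ) * r ≡ 1ℚ) → ∃ λ η → 0ℚ < η × B * η < ε
    from (r , 0<r , eq) = r * ε , *-pos 0<r 0<ε , subst (B * (r * ε) <_)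
      (trans (solve 3 (λ B r e → B :* (r :* e) :+ r :* e := (B :+ con 1ℚ) :* r :* e) refl B r ε) (trans (cong (_* ε) eq) (*-identityˡ ε)))
      (subst (_< B * (r * ε) + r * ε) (+-identityʳ (B * (r * ε))) (+-monoʳ-< (B * (r * ε)) (*-pos 0<r 0<ε)))

  half : ∀ {ε} → 0ℚ < ε → 0ℚ < ½ * ε
  half = *-pos 0<½

  half+half : ∀ ε → ½ * ε + ½ * ε ≡ ε
  half+half = solve 1 (λ e → con ½ :* e :+ con ½ :* e := e) refl

  minimum : ∀ {p q} → 0ℚ < p → 0ℚ < q → ∃ λ r → 0ℚ < r × r ≤ p × r ≤ q
  minimum {p} {q} 0<p 0<q with ≤-total p q
  ... | inj₁ p≤q = p , 0<p , ≤-refl , p≤q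
  ... | inj₂ q≤p = q , 0<q , q≤p , ≤-refl

  ∣∣≤ : ∀ {x e} → x ≤ e → - x ≤ e → ∣ x ∣ ≤ e
  ∣∣≤ {x} {e} p q with ℚ.∣p∣≡p∨∣p∣≡-p x
  ... | inj₁ eq = subst (_≤ e) (sym eq) p
  ... | inj₂ eq = subst (_≤ e) (sym eq) q

  x≤∣x∣ : ∀ x → x ≤ ∣ x ∣
  x≤∣x∣ x with ≤-total 0ℚ x
  ... | inj₁ 0≤x = ≤-reflexive (sym (ℚ.0≤p⇒∣p∣≡p 0≤x))
  ... | inj₂ x≤0 = ≤-trans x≤0 (ℚ.0≤∣p∣ x)

  ∣x-y∣≡∣y-x∣ : ∀ x y → ∣ x - y ∣ ≡ ∣ y - x ∣
  ∣x-y∣≡∣y-x∣ x y = trans (sym (ℚ.∣-p∣≡∣p∣ (x - y))) (cong ∣_∣ (solve 2 (λ x y → :- (x :- y) := y :- x) refl x y))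

  ∣∣-triangle : ∀ x y z → ∣ x - z ∣ ≤ ∣ x - y ∣ + ∣ y - z ∣
  ∣∣-triangle x y z = subst (λ w → ∣ w ∣ ≤ ∣ x - y ∣ + ∣ y - z ∣) (solve 3 (λ x y z → (x :- y) :+ (y :- z) := x :- z) refl x y z)
    (ℚ.∣p+q∣≤∣p∣+∣q∣ (x - y) (y - z))

  ∣x-y∣<⇒x≤y+ : ∀ {x y e} → ∣ x - y ∣ < e → x ≤ y + e
  ∣x-y∣<⇒x≤y+ {x} {y} {e} h = subst₂ _≤_ (solve 2 (λ x y → y :+ (x :- y) := x) refl x y) refl
    (+-monoʳ-≤ y (≤-trans (x≤∣x∣ (x - y)) (<⇒≤ h)))

  ∣x∣²≡x² : ∀ x → ∣ x ∣ * ∣ x ∣ ≡ x * x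
  ∣x∣²≡x² x = trans (sym (ℚ.∣p*q∣≡∣p∣*∣q∣ x x)) (ℚ.0≤p⇒∣p∣≡p (square-nonneg x))

  ²-cancel-≤ : ∀ {x y} → 0ℚ ≤ y → x * x ≤ y * y → x ≤ y
  ²-cancel-≤ {x} {y} 0≤y h with x ≤? y
  ... | yes p = p
  ... | no ¬p = contradiction (<-≤-trans (<-≤-trans (≤-<-trans (*-monoˡ 0≤y (<⇒≤ y<x)) (subst₂ _<_ (*-comm x y) refl (*-monoˡ-< 0<x y<x))) h) ≤-refl) (<-irrefl refl)
    where
    y<x : y < x
    y<x = ≰⇒> ¬p
    0<x : 0ℚ < x
    0<x = ≤-<-trans 0≤y y<x

  ²-cancel-< : ∀ {x y} → 0ℚ ≤ y → x * x < y * y → x < y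
  ²-cancel-< {x} {y} 0≤y h with x <? y
  ... | yes p = p
  ... | no ¬p = contradiction (<-≤-trans h (*-mono 0≤y (≤-trans 0≤y (≮⇒≥ ¬p)) (≮⇒≥ ¬p) (≮⇒≥ ¬p))) (<-irrefl refl)

  ≈-pointwise : ∀ {x y} → (∀ n → seq x n ≡ seq y n) → x ≈ℝ y
  ≈-pointwise {x} {y} h ε 0<ε = 0 , λ n _ → subst (_< ε)
    (sym (trans (cong (λ z → ∣ seq x n - z ∣) (sym (h n))) (cong ∣_∣ (+-inverseʳ (seq x n))))) 0<ε

  ≈-sym : ∀ {x y} → x ≈ℝ y → y ≈ℝ x
  ≈-sym {x} {y} h ε 0<ε = ev-map (λ n → subst (_< ε) (∣x-y∣≡∣y-x∣ (seq x n) (seq y n))) (h ε 0<ε)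

  ≈-trans : ∀ {x y z} → x ≈ℝ y → y ≈ℝ z → x ≈ℝ z
  ≈-trans {x} {y} {z} h g ε 0<ε = ev-map (λ n (p , q) → ≤-<-trans (∣∣-triangle (seq x n) (seq y n) (seq z n))
      (subst (∣ seq x n - seq y n ∣ + ∣ seq y n - seq z n ∣ <_) (half+half ε) (ℚ.+-mono-< p q)))
    (ev-× (h (½ * ε) (half 0<ε)) (g (½ * ε) (half 0<ε)))

  ≈⇒≤ : ∀ {x y} → x ≈ℝ y → x ≤ℝ y
  ≈⇒≤ h ε 0<ε = ev-map (λ n → ∣x-y∣<⇒x≤y+) (h ε 0<ε)

  ≤ℝ-pointwise : ∀ {x y} → (∀ n → seq x n ≤ seq y n) → x ≤ℝ y
  ≤ℝ-pointwise h ε 0<ε = 0 , λ n _ → ≤-trans (h n) (p≤p+q (<⇒≤ 0<ε))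

  ≤ℝ-trans : ∀ {x y z} → x ≤ℝ y → y ≤ℝ z → x ≤ℝ z
  ≤ℝ-trans {x} {y} {z} h g ε 0<ε = ev-map (λ n (p , q) → ≤-trans p (≤-trans (+-monoˡ-≤ (½ * ε) q)
      (≤-reflexive (trans (+-assoc (seq z n) (½ * ε) (½ * ε)) (cong (seq z n +_) (half+half ε))))))
    (ev-× (h (½ * ε) (half 0<ε)) (g (½ * ε) (half 0<ε)))

  ℝ-preorder : Preorder 0ℓ 0ℓ 0ℓ
  ℝ-preorder = record
    { Carrier = ℝ
    ; _≈_ = _≈ℝ_
    ; _≲_ = _≤ℝ_
    ; isPreorder = record
      { isEquivalence = record
        { refl = λ {x} → ≈-pointwise {x} {x} (λ _ → refl)
        ; sym = λ {x} {y} → ≈-sym {x} {y}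
        ; trans = λ {x} {y} {z} → ≈-trans {x} {y} {z}
        }
      ; reflexive = λ {x} {y} → ≈⇒≤ {x} {y}
      ; trans = λ {x} {y} {z} → ≤ℝ-trans {x} {y} {z}
      }
    }

  bounded : ∀ x → ∃ λ B → 0ℚ ≤ B × Ev (λ n → ∣ seq x n ∣ ≤ B)
  bounded x = ∣ seq x N ∣ + 1ℚ , +-nonneg (ℚ.0≤∣p∣ (seq x N)) 0≤1 , N , λ n N≤n →
    subst (_≤ ∣ seq x N ∣ + 1ℚ) (cong ∣_∣ (solve 2 (λ a b → b :+ (a :- b) := a) refl (seq x n) (seq x N)))
      (≤-trans (ℚ.∣p+q∣≤∣p∣+∣q∣ (seq x N) (seq x n - seq x N)) (+-monoʳ-≤ ∣ seq x N ∣ (<⇒≤ (proj₂ modulus n N N≤n ℕ.≤-refl))))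
    where
    modulus : ∃ λ N → ∀ m n → N ℕ.≤ m → N ℕ.≤ n → ∣ seq x m - seq x n ∣ < 1ℚ
    modulus = cauchy x 1ℚ 0<1
    N : ℕ
    N = proj₁ modulus

  +-cong : ∀ {x x′ y y′} → x ≈ℝ x′ → y ≈ℝ y′ → x +ℝ y ≈ℝ x′ +ℝ y′
  +-cong {x} {x′} {y} {y′} h g ε 0<ε = ev-map (λ n (p , q) → subst (_< ε)
      (cong ∣_∣ (solve 4 (λ a b c d → (a :- b) :+ (c :- d) := (a :+ c) :- (b :+ d)) refl (seq x n) (seq x′ n) (seq y n) (seq y′ n)))
      (≤-<-trans (ℚ.∣p+q∣≤∣p∣+∣q∣ (seq x n - seq x′ n) (seq y n - seq y′ n)) (subst (∣ seq x n - seq x′ n ∣ + ∣ seq y n - seq y′ n ∣ <_) (half+half ε) (ℚ.+-mono-< p q))))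
    (ev-× (h (½ * ε) (half 0<ε)) (g (½ * ε) (half 0<ε)))

  *-congˡ : ∀ {z x y} → x ≈ℝ y → z *ℝ x ≈ℝ z *ℝ y
  *-congˡ {z} {x} {y} h ε 0<ε =
    let B , 0≤B , evB = bounded z
        η , 0<η , Bη<ε = divide 0≤B 0<ε
    in ev-map (λ n (p , q) → ≤-<-trans (≤-reflexive (trans
          (cong ∣_∣ (solve 3 (λ z x y → z :* x :- z :* y := z :* (x :- y)) refl (seq z n) (seq x n) (seq y n)))
          (ℚ.∣p*q∣≡∣p∣*∣q∣ (seq z n) (seq x n - seq y n))))
        (≤-<-trans (*-mono (ℚ.0≤∣p∣ (seq z n)) (<⇒≤ 0<η) p (<⇒≤ q)) Bη<ε))
      (ev-× evB (h η 0<η))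

  *-comm-≈ : ∀ x y → x *ℝ y ≈ℝ y *ℝ x
  *-comm-≈ x y = ≈-pointwise {x *ℝ y} {y *ℝ x} (λ n → *-comm (seq x n) (seq y n))

  *-cong : ∀ {x x′ y y′} → x ≈ℝ x′ → y ≈ℝ y′ → x *ℝ y ≈ℝ x′ *ℝ y′
  *-cong {x} {x′} {y} {y′} h g = ≈-trans {x *ℝ y} {x *ℝ y′} {x′ *ℝ y′} (*-congˡ {x} {y} {y′} g)
    (≈-trans {x *ℝ y′} {y′ *ℝ x} {x′ *ℝ y′} (*-comm-≈ x y′)
      (≈-trans {y′ *ℝ x} {y′ *ℝ x′} {x′ *ℝ y′} (*-congˡ {y′} {x} {x′} h) (*-comm-≈ y′ x′)))

  -- Nonnegative late terms of z allow multiplication index by index. The factor 1 - δ is of this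
  -- kind, because δ stays well below 1.
  *-mono-ev : ∀ {z x y} → Ev (λ n → 0ℚ ≤ seq z n) → x ≤ℝ y → z *ℝ x ≤ℝ z *ℝ y
  *-mono-ev {z} {x} {y} 0≤z h ε 0<ε =
    let B , 0≤B , evB = bounded z
        η , 0<η , Bη<ε = divide 0≤B 0<ε
    in ev-map (λ n (0≤zn , zn≤B , x≤y) → ≤-trans (*-monoˡ 0≤zn x≤y)
         (≤-trans (≤-reflexive (*-distribˡ-+ (seq z n) (seq y n) η))
           (+-monoʳ-≤ (seq z n * seq y n) (≤-trans (*-monoʳ (<⇒≤ 0<η) (≤-trans (x≤∣x∣ (seq z n)) zn≤B)) (<⇒≤ Bη<ε)))))
       (ev-× 0≤z (ev-× evB (h η 0<η)))

  -- The hypothesis is used with error ε²: x² ≤ y² + ε² ≤ (y + ε)².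
  ²-cancel-≤ℝ : ∀ {x y} → (∀ n → 0ℚ ≤ seq y n) → x *ℝ x ≤ℝ y *ℝ y → x ≤ℝ y
  ²-cancel-≤ℝ {x} {y} 0≤y h ε 0<ε = ev-map (λ n p → ²-cancel-≤ (+-nonneg (0≤y n) (<⇒≤ 0<ε))
      (≤-trans p (by-difference (ι 2 * (seq y n * ε)) (*-nonneg (0≤ι 2) (*-nonneg (0≤y n) (<⇒≤ 0<ε)))
        (solve 2 (λ y e → (y :+ e) :* (y :+ e) := y :* y :+ e :* e :+ con (ι 2) :* (y :* e)) refl (seq y n) ε))))
    (h (ε * ε) (*-pos 0<ε 0<ε))

  module Bisection {P : ℚ → Set} (P? : ∀ t → Dec (P t)) where

    branch : (l u c : ℚ) → Dec (P c) → ℚ × ℚ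
    branch l u c (yes _) = l , c
    branch l u c (no _) = c , u

    step : ℚ × ℚ → ℚ × ℚ
    step (l , u) = branch l u (½ * (l + u)) (P? (½ * (l + u)))

    iterate : ℚ → ℚ → ℕ → ℚ × ℚ
    iterate l u zero = l , u
    iterate l u (suc j) = step (iterate l u j)

    -- P holds at the upper end and fails at the lower end, unless the lower end is still l₀, where
    -- P is never tested.
    record Bracket (l₀ u₀ : ℚ) (w : ℚ) (lu : ℚ × ℚ) : Set where
      field
        l₀≤l : l₀ ≤ proj₁ lu
        u≤u₀ : proj₂ lu ≤ u₀
        width : proj₂ lu ≡ proj₁ lu + w
        above : P (proj₂ lu)
        below : proj₁ lu ≡ l₀ ⊎ ¬ P (proj₁ lu)

    branch-bracket : ∀ {l₀ u₀ w} l u c (d : Dec (P c)) → 0ℚ ≤ ½ * w → c ≡ l + ½ * w → u ≡ c + ½ * w → Bracket l₀ u₀ w (l , u) →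
      Bracket l₀ u₀ (½ * w) (branch l u c d) × l ≤ proj₁ (branch l u c d) × proj₂ (branch l u c d) ≤ u
    branch-bracket {w = w} l u c (yes Pc) 0≤½w c≡ u≡ br = record
        { l₀≤l = Bracket.l₀≤l br ; u≤u₀ = ≤-trans c≤u (Bracket.u≤u₀ br) ; width = c≡ ; above = Pc ; below = Bracket.below br }
      , ≤-refl , c≤u
      where
      c≤u : c ≤ u
      c≤u = by-difference (½ * w) 0≤½w u≡
    branch-bracket {w = w} l u c (no ¬Pc) 0≤½w c≡ u≡ br = record
        { l₀≤l = ≤-trans (Bracket.l₀≤l br) l≤c ; u≤u₀ = Bracket.u≤u₀ br ; width = u≡ ; above = Bracket.above br ; below = inj₂ ¬Pc }
      , l≤c , ≤-refl
      where
      l≤c : l ≤ c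
      l≤c = by-difference (½ * w) 0≤½w c≡

    step-bracket : ∀ {l₀ u₀ w} lu → 0ℚ ≤ w → Bracket l₀ u₀ w lu →
      Bracket l₀ u₀ (½ * w) (step lu) × proj₁ lu ≤ proj₁ (step lu) × proj₂ (step lu) ≤ proj₂ lu
    step-bracket {w = w} (l , u) 0≤w br = branch-bracket l u (½ * (l + u)) (P? (½ * (l + u))) (*-nonneg (<⇒≤ 0<½) 0≤w)
      (trans (cong (λ u → ½ * (l + u)) (Bracket.width br)) (solve 2 (λ l w → con ½ :* (l :+ (l :+ w)) := l :+ con ½ :* w) refl l w))
      (trans (Bracket.width br) (trans (solve 2 (λ l w → l :+ w := con ½ :* (l :+ (l :+ w)) :+ con ½ :* w) refl l w)
        (cong (λ u → ½ * (l + u) + ½ * w) (sym (Bracket.width br)))))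
      br

    module _ {l₀ w₀ : ℚ} (0≤w₀ : 0ℚ ≤ w₀) (Pu₀ : P (l₀ + w₀)) where

      lower upper : ℕ → ℚ
      lower j = proj₁ (iterate l₀ (l₀ + w₀) j)
      upper j = proj₂ (iterate l₀ (l₀ + w₀) j)

      gap-width : ℕ → ℚ
      gap-width zero = w₀
      gap-width (suc j) = ½ * gap-width j

      gap-nonneg : ∀ j → 0ℚ ≤ gap-width j
      gap-nonneg zero = 0≤w₀
      gap-nonneg (suc j) = *-nonneg (<⇒≤ 0<½) (gap-nonneg j)

      gap≡ : ∀ j → gap-width j ≡ w₀ * ½ ^ j
      gap≡ zero = sym (*-identityʳ w₀)
      gap≡ (suc j) = trans (cong (½ *_) (gap≡ j)) (solve 3 (λ h w x → h :* (w :* x) := w :* (h :* x)) refl ½ w₀ (½ ^ j))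

      bracket : ∀ j → Bracket l₀ (l₀ + w₀) (gap-width j) (iterate l₀ (l₀ + w₀) j)
      bracket zero = record { l₀≤l = ≤-refl ; u≤u₀ = ≤-refl ; width = refl ; above = Pu₀ ; below = inj₁ refl }
      bracket (suc j) = proj₁ (step-bracket (iterate l₀ (l₀ + w₀) j) (gap-nonneg j) (bracket j))

      lower≤upper : ∀ j → lower j ≤ upper j
      lower≤upper j = by-difference (gap-width j) (gap-nonneg j) (Bracket.width (bracket j))

      lower-mono : ∀ {i j} → i ℕ.≤′ j → lower i ≤ lower j
      lower-mono ℕ.≤′-refl = ≤-refl
      lower-mono {j = suc j} (ℕ.≤′-step le) = ≤-trans (lower-mono le) (proj₁ (proj₂ (step-bracket (iterate l₀ (l₀ + w₀) j) (gap-nonneg j) (bracket j))))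

      upper-anti : ∀ {i j} → i ℕ.≤′ j → upper j ≤ upper i
      upper-anti ℕ.≤′-refl = ≤-refl
      upper-anti {j = suc j} (ℕ.≤′-step le) = ≤-trans (proj₂ (proj₂ (step-bracket (iterate l₀ (l₀ + w₀) j) (gap-nonneg j) (bracket j)))) (upper-anti le)

      ev-gap : ∀ {ε} → 0ℚ < ε → Ev (λ j → gap-width j < ε)
      ev-gap {ε} 0<ε = let η , 0<η , wη<ε = divide 0≤w₀ 0<ε in
        ev-map (λ j p → ≤-<-trans (≤-reflexive (gap≡ j)) (≤-<-trans (*-monoˡ 0≤w₀ (<⇒≤ p)) wη<ε)) (ev-½^ 0<η)

      upper-cauchy : IsCauchy upper
      upper-cauchy ε 0<ε = N , λ m n N≤m N≤n → ≤-<-trans (∣∣≤ (close N≤m N≤n)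
          (subst (_≤ gap-width N) (solve 2 (λ x y → y :- x := :- (x :- y)) refl (upper m) (upper n)) (close N≤n N≤m)))
          (proj₂ (ev-gap 0<ε) N ℕ.≤-refl)
        where
        N : ℕ
        N = proj₁ (ev-gap 0<ε)
        close : ∀ {m n} → N ℕ.≤ m → N ℕ.≤ n → upper m - upper n ≤ gap-width N
        close {m} {n} N≤m N≤n = ≤-trans (+-mono-≤ (upper-anti (ℕ.≤⇒≤′ N≤m))
            (ℚ.neg-antimono-≤ (≤-trans (lower-mono (ℕ.≤⇒≤′ N≤n)) (lower≤upper n))))
          (≤-reflexive (trans (cong (_- lower N) (Bracket.width (bracket N)))
            (solve 2 (λ l w → (l :+ w) :- l := w) refl (lower N) (gap-width N))))

  abstract

    -- The approximation is from above: q ≤ r² later lets the approximate moduli dominate the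
    -- entries of the eigenvector at every index.
    √ℚ : ∀ {q ε} → 0ℚ ≤ q → 0ℚ < ε → ∃ λ r → 0ℚ ≤ r × q ≤ r * r × r * r ≤ q + ε
    √ℚ {q} {ε} 0≤q 0<ε = from (ev-witness (ev-gap {0ℚ} 0≤w₀ above₀ 0<η))
      where
      open Bisection (λ t → q ≤? t * t)
      w₀ : ℚ
      w₀ = q + 1ℚ
      0≤w₀ : 0ℚ ≤ w₀
      0≤w₀ = +-nonneg 0≤q 0≤1
      above₀ : q ≤ (0ℚ + w₀) * (0ℚ + w₀)
      above₀ = by-difference (q * q + q + 1ℚ) (+-nonneg (+-nonneg (square-nonneg q) 0≤q) 0≤1)
        (solve 1 (λ q → (con 0ℚ :+ (q :+ con 1ℚ)) :* (con 0ℚ :+ (q :+ con 1ℚ)) := q :+ (q :* q :+ q :+ con 1ℚ)) refl q)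
      η-data : ∃ λ η → 0ℚ < η × (ι 2 * w₀) * η < ε
      η-data = divide {ι 2 * w₀} (*-nonneg (0≤ι 2) 0≤w₀) 0<ε
      η : ℚ
      η = proj₁ η-data
      0<η : 0ℚ < η
      0<η = proj₁ (proj₂ η-data)
      enough : ∀ {l u w} → 0ℚ ≤ w → w < η → Bracket 0ℚ (0ℚ + w₀) w (l , u) → ∃ λ r → 0ℚ ≤ r × q ≤ r * r × r * r ≤ q + ε
      enough {l} {u} {w} 0≤w small br = u , 0≤u , Bracket.above br , upper-bound
        where
        0≤l : 0ℚ ≤ l
        0≤l = Bracket.l₀≤l br
        l≤u : l ≤ u
        l≤u = by-difference w 0≤w (Bracket.width br)
        0≤u : 0ℚ ≤ u
        0≤u = ≤-trans 0≤l l≤u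
        l²≤q : l ≡ 0ℚ ⊎ ¬ (q ≤ l * l) → l * l ≤ q
        l²≤q (inj₁ l≡0) = subst (λ l → l * l ≤ q) (sym l≡0) 0≤q
        l²≤q (inj₂ ¬P) = <⇒≤ (≰⇒> ¬P)
        u≤w₀ : u ≤ w₀
        u≤w₀ = subst (u ≤_) (+-identityˡ w₀) (Bracket.u≤u₀ br)
        upper-bound : u * u ≤ q + ε
        upper-bound = begin
          u * u               ≡⟨ cong₂ _*_ (Bracket.width br) (Bracket.width br) ⟩
          (l + w) * (l + w)   ≡⟨ solve 2 (λ l w → (l :+ w) :* (l :+ w) := l :* l :+ (l :+ (l :+ w)) :* w) refl l w ⟩
          l * l + (l + (l + w)) * w ≡⟨ cong (λ x → l * l + (l + x) * w) (sym (Bracket.width br)) ⟩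
          l * l + (l + u) * w ≤⟨ +-mono-≤ (l²≤q (Bracket.below br)) (*-mono (+-nonneg 0≤l 0≤u) (<⇒≤ 0<η) (+-mono-≤ (≤-trans l≤u u≤w₀) u≤w₀) (<⇒≤ small)) ⟩
          q + (w₀ + w₀) * η   ≡⟨ cong (λ x → q + x * η) (solve 1 (λ w → w :+ w := con (ι 2) :* w) refl w₀) ⟩
          q + ι 2 * w₀ * η    ≤⟨ +-monoʳ-≤ q (<⇒≤ (proj₂ (proj₂ η-data))) ⟩
          q + ε               ∎
          where open ≤-Reasoning
      from : (∃ λ j → gap-width {0ℚ} 0≤w₀ above₀ j < η) → ∃ λ r → 0ℚ ≤ r × q ≤ r * r × r * r ≤ q + ε
      from (j , small) = enough (gap-nonneg {0ℚ} 0≤w₀ above₀ j) small (bracket {0ℚ} 0≤w₀ above₀ j)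

  -- Term n is an approximate root with error at most 2⁻ⁿ in its square. The termwise bound x ≤ y²
  -- is recorded next to y² ≈ x because estimates are made at single indices.
  √ℝ : ∀ x → (∀ n → 0ℚ ≤ seq x n) →
       ∃ λ y → (∀ n → 0ℚ ≤ seq y n) × (∀ n → seq x n ≤ seq y n * seq y n) × y *ℝ y ≈ℝ x
  √ℝ x 0≤x = mkℝ root root-cauchy , 0≤root , x≤root² , root²≈x
    where
    approx : ∀ n → ∃ λ r → 0ℚ ≤ r × seq x n ≤ r * r × r * r ≤ seq x n + ½ ^ n
    approx n = √ℚ (0≤x n) (^-pos n 0<½)
    root : ℕ → ℚ
    root n = proj₁ (approx n)
    0≤root : ∀ n → 0ℚ ≤ root n
    0≤root n = proj₁ (proj₂ (approx n))
    x≤root² : ∀ n → seq x n ≤ root n * root n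
    x≤root² n = proj₁ (proj₂ (proj₂ (approx n)))
    root²≤ : ∀ n → root n * root n ≤ seq x n + ½ ^ n
    root²≤ n = proj₂ (proj₂ (proj₂ (approx n)))
    -- (a − b)² ≤ a² − b² for 0 ≤ b ≤ a.
    one-sided : ∀ {a b e} → 0ℚ ≤ b → 0ℚ < e → a * a < b * b + e * e → a - b < e
    one-sided {a} {b} {e} 0≤b 0<e h = subst (a - b <_) (solve 2 (λ b e → (b :+ e) :- b := e) refl b e)
      (+-monoˡ-< (- b) (²-cancel-< {a} (+-nonneg 0≤b (<⇒≤ 0<e)) (<-≤-trans h
        (by-difference (ι 2 * (b * e)) (*-nonneg (0≤ι 2) (*-nonneg 0≤b (<⇒≤ 0<e)))
          (solve 2 (λ b e → (b :+ e) :* (b :+ e) := b :* b :+ e :* e :+ con (ι 2) :* (b :* e)) refl b e)))))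
    root-cauchy : IsCauchy root
    root-cauchy ε 0<ε = N , λ m n N≤m N≤n →
        let p = close m n N≤m N≤n ; q = close n m N≤n N≤m in
        both {root m - root n} p (subst (_< ε) (solve 2 (λ a b → b :- a := :- (a :- b)) refl (root m) (root n)) q)
      where
      both : ∀ {x} → x < ε → - x < ε → ∣ x ∣ < ε
      both {x} p q with ℚ.∣p∣≡p∨∣p∣≡-p x
      ... | inj₁ eq = subst (_< ε) (sym eq) p
      ... | inj₂ eq = subst (_< ε) (sym eq) q
      δ : ℚ
      δ = ½ * (ε * ε)
      0<δ : 0ℚ < δ
      0<δ = half (*-pos 0<ε 0<ε)
      c : ∃ λ N → ∀ m n → N ℕ.≤ m → N ℕ.≤ n → ∣ seq x m - seq x n ∣ < δ
      c = cauchy x δ 0<δ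
      e : Ev (λ n → ½ ^ n < δ)
      e = ev-½^ 0<δ
      N : ℕ
      N = proj₁ c ℕ.⊔ proj₁ e
      close : ∀ m n → N ℕ.≤ m → N ℕ.≤ n → root m - root n < ε
      close m n N≤m N≤n = one-sided {root m} {root n} (0≤root n) 0<ε (begin-strict
        root m * root m        ≤⟨ root²≤ m ⟩
        seq x m + ½ ^ m        <⟨ +-monoʳ-< (seq x m) (proj₂ e m (ℕ.m⊔n≤o⇒n≤o (proj₁ c) (proj₁ e) N≤m)) ⟩
        seq x m + δ            ≤⟨ +-monoˡ-≤ δ (∣x-y∣<⇒x≤y+ {seq x m} {seq x n} (proj₂ c m n (ℕ.m⊔n≤o⇒m≤o (proj₁ c) (proj₁ e) N≤m) (ℕ.m⊔n≤o⇒m≤o (proj₁ c) (proj₁ e) N≤n))) ⟩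
        seq x n + δ + δ        ≡⟨ trans (+-assoc (seq x n) δ δ) (cong (seq x n +_) (half+half (ε * ε))) ⟩
        seq x n + ε * ε        ≤⟨ +-monoˡ-≤ (ε * ε) (x≤root² n) ⟩
        root n * root n + ε * ε ∎)
        where open ≤-Reasoning
    root²≈x : mkℝ root root-cauchy *ℝ mkℝ root root-cauchy ≈ℝ x
    root²≈x ε 0<ε = ev-map (λ n p → ≤-<-trans (∣∣≤
        (≤-trans (+-monoˡ-≤ (- seq x n) (root²≤ n)) (≤-reflexive (solve 2 (λ x h → (x :+ h) :- x := h) refl (seq x n) (½ ^ n))))
        (≤-trans (≤-reflexive (solve 2 (λ r x → :- (r :- x) := x :- r) refl (root n * root n) (seq x n)))
          (≤-trans (≤-trans (+-monoˡ-≤ (- (root n * root n)) (x≤root² n)) (≤-reflexive (+-inverseʳ (root n * root n)))) (^-nonneg n (<⇒≤ 0<½))))) p)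
      (ev-½^ 0<ε)

-- From a complex eigenvector to the vector of its moduli

module Eigenvectors where

  open import Data.Rational.Base using (_≤_; _<_; ∣_∣)
  open RationalSums
  open Stability
  open HeavyVertices
  open RealNumbers

  -- The operations act index by index, so the n-th terms of a complex expression are computed from
  -- the n-th terms of its parts; for real parts the result is the rational expression.
  record RealAt (n : ℕ) (z : ℂ) (q : ℚ) : Set where
    constructor at
    field
      re≡ : seq (re z) n ≡ q
      im≡ : seq (im z) n ≡ 0ℚ

  normSquare : ℕ → ℂ → ℚ
  normSquare n z = seq (re z) n * seq (re z) n + seq (im z) n * seq (im z) n

  -- This is |z| ≤ r at index n, squared because the modulus of a number with rational coordinates
  -- need not be rational.
  record Dominated (n : ℕ) (z : ℂ) (r : ℚ) : Set where
    constructor dominated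
    field
      0≤bound : 0ℚ ≤ r
      norm²≤  : normSquare n z ≤ r * r

  module _ (n : ℕ) where

    realAt-fromℝ : ∀ x → RealAt n (fromℝ x) (seq x n)
    realAt-fromℝ x = at refl refl

    realAt-+ : ∀ {z w q r} → RealAt n z q → RealAt n w r → RealAt n (z +ℂ w) (q + r)
    realAt-+ (at refl p) (at refl s) = at refl (trans (cong₂ _+_ p s) (+-identityʳ 0ℚ))

    realAt-* : ∀ {z w q r} → RealAt n z q → RealAt n w r → RealAt n (z *ℂ w) (q * r)
    realAt-* {z} {w} (at refl p) (at refl s) = at
      (trans (cong₂ (λ a b → seq (re z) n * seq (re w) n + - (a * b)) p s)
        (solve 1 (λ x → x :+ :- (con 0ℚ :* con 0ℚ) := x) refl (seq (re z) n * seq (re w) n)))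
      (trans (cong₂ (λ a b → seq (re z) n * b + a * seq (re w) n) p s)
        (solve 2 (λ x y → x :* con 0ℚ :+ con 0ℚ :* y := con 0ℚ) refl (seq (re z) n) (seq (re w) n)))

    realAt-sum : ∀ {m} {f : Fin m → ℂ} {g : Fin m → ℚ} → (∀ i → RealAt n (f i) (g i)) → RealAt n (ℂ-Ops.sum f) (sum g)
    realAt-sum {zero} h = at refl refl
    realAt-sum {suc m} h = realAt-+ (h zero) (realAt-sum (h ∘ suc))

    realAt-product : ∀ {m} {f : Fin m → ℂ} {g : Fin m → ℚ} → (∀ i → RealAt n (f i) (g i)) → RealAt n (ℂ-Ops.product f) (product g)
    realAt-product {zero} h = at refl refl
    realAt-product {suc m} h = realAt-* (h zero) (realAt-product (h ∘ suc))

    realAt-^ : ∀ m {z q} → RealAt n z q → RealAt n (z ℂ-Ops.^ m) (q ^ m)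
    realAt-^ zero h = at refl refl
    realAt-^ (suc m) h = realAt-* h (realAt-^ m h)

    realAt-sumTuples : ∀ m {d} {f : Vec (Fin d) m → ℂ} {g : Vec (Fin d) m → ℚ} → (∀ t → RealAt n (f t) (g t)) → RealAt n (sumTuples m f) (∑ₜ m g)
    realAt-sumTuples zero h = h []
    realAt-sumTuples (suc m) h = realAt-sum (λ i → realAt-sumTuples m (λ is → h (i ∷ is)))

    norm² : ℂ → ℚ
    norm² = normSquare n

    norm²-* : ∀ z w → norm² (z *ℂ w) ≡ norm² z * norm² w
    norm²-* z w = solve 4 (λ a b c d → (a :* c :+ :- (b :* d)) :* (a :* c :+ :- (b :* d)) :+ (a :* d :+ b :* c) :* (a :* d :+ b :* c)
        := (a :* a :+ b :* b) :* (c :* c :+ d :* d)) refl (seq (re z) n) (seq (im z) n) (seq (re w) n) (seq (im w) n)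

    norm²-^ : ∀ m z → norm² (z ℂ-Ops.^ m) ≡ norm² z ^ m
    norm²-^ zero z = refl
    norm²-^ (suc m) z = trans (norm²-* z (z ℂ-Ops.^ m)) (cong (norm² z *_) (norm²-^ m z))

    norm²-nonneg : ∀ z → 0ℚ ≤ norm² z
    norm²-nonneg z = +-nonneg (square-nonneg (seq (re z) n)) (square-nonneg (seq (im z) n))

    dominated-real : ∀ {z q} → 0ℚ ≤ q → RealAt n z q → Dominated n z q
    dominated-real {z} {q} 0≤q (at refl p) = dominated 0≤q (≤-reflexive (trans (cong (λ b → q * q + b * b) p) (solve 1 (λ x → x :+ con 0ℚ :* con 0ℚ := x) refl (q * q))))

    dominated-* : ∀ {z w q r} → Dominated n z q → Dominated n w r → Dominated n (z *ℂ w) (q * r)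
    dominated-* {z} {w} {q} {r} (dominated 0≤q z≤q) (dominated 0≤r w≤r) = dominated (*-nonneg 0≤q 0≤r)
      (≤-trans (≤-reflexive (norm²-* z w)) (≤-trans (*-mono (norm²-nonneg z) (*-nonneg 0≤r 0≤r) z≤q w≤r)
        (≤-reflexive (solve 2 (λ q r → (q :* q) :* (r :* r) := (q :* r) :* (q :* r)) refl q r))))

    -- By Cauchy–Schwarz the inner product of z and w is at most q r.
    dominated-+ : ∀ {z w q r} → Dominated n z q → Dominated n w r → Dominated n (z +ℂ w) (q + r)
    dominated-+ {z} {w} {q} {r} (dominated 0≤q z≤q) (dominated 0≤r w≤r) = dominated (+-nonneg 0≤q 0≤r) (begin
      (a + c) * (a + c) + (b + d) * (b + d)
        ≡⟨ solve 4 (λ a b c d → (a :+ c) :* (a :+ c) :+ (b :+ d) :* (b :+ d) := (a :* a :+ b :* b) :+ (c :* c :+ d :* d) :+ con (ι 2) :* (a :* c :+ b :* d)) refl a b c d ⟩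
      norm² z + norm² w + ι 2 * (a * c + b * d)
        ≤⟨ +-mono-≤ (+-mono-≤ z≤q w≤r) (*-monoˡ (0≤ι 2) inner) ⟩
      q * q + r * r + ι 2 * (q * r)
        ≡⟨ solve 2 (λ q r → q :* q :+ r :* r :+ con (ι 2) :* (q :* r) := (q :+ r) :* (q :+ r)) refl q r ⟩
      (q + r) * (q + r) ∎)
      where
      open ≤-Reasoning
      a b c d : ℚ
      a = seq (re z) n
      b = seq (im z) n
      c = seq (re w) n
      d = seq (im w) n
      inner : a * c + b * d ≤ q * r
      inner = ²-cancel-≤ (*-nonneg 0≤q 0≤r) (≤-trans
        (by-difference ((a * d - b * c) * (a * d - b * c)) (square-nonneg (a * d - b * c))
          (solve 4 (λ a b c d → (a :* a :+ b :* b) :* (c :* c :+ d :* d) := (a :* c :+ b :* d) :* (a :* c :+ b :* d) :+ (a :* d :- b :* c) :* (a :* d :- b :* c)) refl a b c d))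
        (≤-trans (*-mono (norm²-nonneg z) (*-nonneg 0≤r 0≤r) z≤q w≤r)
          (≤-reflexive (solve 2 (λ q r → (q :* q) :* (r :* r) := (q :* r) :* (q :* r)) refl q r))))

    dominated-sum : ∀ {m} {f : Fin m → ℂ} {g : Fin m → ℚ} → (∀ i → Dominated n (f i) (g i)) → Dominated n (ℂ-Ops.sum f) (sum g)
    dominated-sum {zero} h = dominated-real ≤-refl (at refl refl)
    dominated-sum {suc m} {f} {g} h = dominated-+ {f zero} {ℂ-Ops.sum (f ∘ suc)} (h zero) (dominated-sum (h ∘ suc))

    dominated-product : ∀ {m} {f : Fin m → ℂ} {g : Fin m → ℚ} → (∀ i → Dominated n (f i) (g i)) → Dominated n (ℂ-Ops.product f) (product g)
    dominated-product {zero} h = dominated-real 0≤1 (at refl refl)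
    dominated-product {suc m} {f} h = dominated-* {f zero} {ℂ-Ops.product (f ∘ suc)} (h zero) (dominated-product (h ∘ suc))

    dominated-sumTuples : ∀ m {d} {f : Vec (Fin d) m → ℂ} {g : Vec (Fin d) m → ℚ} → (∀ t → Dominated n (f t) (g t)) → Dominated n (sumTuples m f) (∑ₜ m g)
    dominated-sumTuples zero h = h []
    dominated-sumTuples (suc m) h = dominated-sum (λ i → dominated-sumTuples m (λ is → h (i ∷ is)))

  powℝ : ℝ → ℕ → ℝ
  powℝ x zero = 1ℝ
  powℝ x (suc m) = x *ℝ powℝ x m

  seq-powℝ : ∀ x m n → seq (powℝ x m) n ≡ seq x n ^ m
  seq-powℝ x zero n = refl
  seq-powℝ x (suc m) n = cong (seq x n *_) (seq-powℝ x m n)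

  powℝ-cong : ∀ {x y} m → x ≈ℝ y → powℝ x m ≈ℝ powℝ y m
  powℝ-cong zero h = ≈-pointwise {1ℝ} {1ℝ} (λ _ → refl)
  powℝ-cong {x} {y} (suc m) h = *-cong {x} {y} {powℝ x m} {powℝ y m} h (powℝ-cong {x} {y} m h)

  sumℝ : ∀ {d} → (Fin d → ℝ) → ℝ
  sumℝ {zero} f = 0ℝ
  sumℝ {suc d} f = f zero +ℝ sumℝ (f ∘ suc)

  seq-sumℝ : ∀ {d} (f : Fin d → ℝ) n → seq (sumℝ f) n ≡ sum (λ i → seq (f i) n)
  seq-sumℝ {zero} f n = refl
  seq-sumℝ {suc d} f n = cong (seq (f zero) n +_) (seq-sumℝ (f ∘ suc) n)

  +-mono-≤ℝ : ∀ {x x′ y y′} → x ≤ℝ x′ → y ≤ℝ y′ → x +ℝ y ≤ℝ x′ +ℝ y′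
  +-mono-≤ℝ {x} {x′} {y} {y′} h g ε 0<ε = ev-map (λ n (p , q) → ≤-trans (+-mono-≤ p q)
      (≤-reflexive (solve 3 (λ a b e → (a :+ con ½ :* e) :+ (b :+ con ½ :* e) := a :+ b :+ e) refl (seq x′ n) (seq y′ n) ε)))
    (ev-× (h (½ * ε) (half 0<ε)) (g (½ * ε) (half 0<ε)))

  sumℝ-mono : ∀ {d} {f g : Fin d → ℝ} → (∀ i → f i ≤ℝ g i) → sumℝ f ≤ℝ sumℝ g
  sumℝ-mono {zero} h = ≤ℝ-pointwise {0ℝ} {0ℝ} (λ _ → ≤-refl)
  sumℝ-mono {suc d} {f} {g} h = +-mono-≤ℝ {f zero} {g zero} {sumℝ (f ∘ suc)} {sumℝ (g ∘ suc)} (h zero) (sumℝ-mono (h ∘ suc))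

  apply : ∀ {m n} → Hypergraph (suc m) n → (Fin n → ℂ) → Fin n → ℂ
  apply {m} H x i = sumTuples m (λ is → adjacency H (i ∷ is) *ℂ ℂ-Ops.product (λ j → x (lookup is j)))

  applyℚ : ∀ {m n} → Hypergraph (suc m) n → (Fin n → ℚ) → Fin n → ℚ
  applyℚ {m} H u i = ∑ₜ m (λ is → ⟦ edgeᵇ H (i ∷ is) ⟧ * u ⟪ is ⟫)

  0<1/! : ∀ m → 0ℚ < 1/ m !
  0<1/! m = ℚ.positive⁻¹ (1/ m !) {{ℚ.normalize-pos 1 (m !) {{m ℕ.!≢0}}}}

  0≤1/! : ∀ m → 0ℚ ≤ 1/ m !
  0≤1/! m = <⇒≤ (0<1/! m)

  realAt-adjacency : ∀ {m n} (H : Hypergraph (suc m) n) t j → RealAt j (adjacency H t) (1/ m ! * ⟦ edgeᵇ H t ⟧)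
  realAt-adjacency {m} H t j with does (member? (E H) (support t))
  ... | true = at (sym (*-identityʳ (1/ m !))) refl
  ... | false = at (sym (*-zeroʳ (1/ m !))) refl

  factor-out : ∀ {m n} (H : Hypergraph (suc m) n) (u : Fin n → ℚ) i →
               ∑ₜ m (λ is → (1/ m ! * ⟦ edgeᵇ H (i ∷ is) ⟧) * u ⟪ is ⟫) ≡ 1/ m ! * applyℚ H u i
  factor-out {m} H u i = trans (∑ₜ-cong m (λ is → *-assoc (1/ m !) ⟦ edgeᵇ H (i ∷ is) ⟧ (u ⟪ is ⟫)))
    (∑ₜ-*ˡ m (1/ m !) (λ is → ⟦ edgeᵇ H (i ∷ is) ⟧ * u ⟪ is ⟫))

  realAt-apply : ∀ {m n} (H : Hypergraph (suc m) n) {x : Fin n → ℂ} {u : Fin n → ℚ} j → (∀ i → RealAt j (x i) (u i)) →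
                 ∀ i → RealAt j (apply H x i) (1/ m ! * applyℚ H u i)
  realAt-apply {m} H {x} {u} j h i = subst (RealAt j (apply H x i)) (factor-out H u i)
    (realAt-sumTuples j m (λ is → realAt-* j {adjacency H (i ∷ is)} {ℂ-Ops.product (λ l → x (lookup is l))}
      (realAt-adjacency H (i ∷ is) j) (realAt-product j (λ l → h (lookup is l)))))

  dominated-apply : ∀ {m n} (H : Hypergraph (suc m) n) {x : Fin n → ℂ} {u : Fin n → ℚ} j → (∀ i → Dominated j (x i) (u i)) →
                    ∀ i → Dominated j (apply H x i) (1/ m ! * applyℚ H u i)
  dominated-apply {m} H {x} {u} j h i = subst (Dominated j (apply H x i)) (factor-out H u i)
    (dominated-sumTuples j m (λ is → dominated-* j {adjacency H (i ∷ is)} {ℂ-Ops.product (λ l → x (lookup is l))}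
      (dominated-real j {adjacency H (i ∷ is)} (*-nonneg (0≤1/! m) (0≤⟦⟧ (edgeᵇ H (i ∷ is)))) (realAt-adjacency H (i ∷ is) j))
      (dominated-product j (λ l → h (lookup is l)))))

  normℝ : ℂ → ℝ
  normℝ z = re z *ℝ re z +ℝ im z *ℝ im z

  normℝ-cong : ∀ {z w} → z ≈ℂ w → normℝ z ≈ℝ normℝ w
  normℝ-cong {z} {w} (p , q) = +-cong {re z *ℝ re z} {re w *ℝ re w} {im z *ℝ im z} {im w *ℝ im w}
    (*-cong {re z} {re w} {re z} {re w} p p) (*-cong {im z} {im w} {im z} {im w} q q)

  module ℝ-Reasoning = Relation.Binary.Reasoning.Preorder ℝ-preorder

  module Moduli {m n : ℕ} (H : Hypergraph (suc m) n) (x : Fin n → ℂ) where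

    abstract
      y : Fin n → ℝ
      y i = proj₁ (√ℝ (normℝ (x i)) (λ j → norm²-nonneg j (x i)))

      0≤y : ∀ i j → 0ℚ ≤ seq (y i) j
      0≤y i = proj₁ (proj₂ (√ℝ (normℝ (x i)) (λ j → norm²-nonneg j (x i))))

      x≤y : ∀ i j → norm² j (x i) ≤ seq (y i) j * seq (y i) j
      x≤y i = proj₁ (proj₂ (proj₂ (√ℝ (normℝ (x i)) (λ j → norm²-nonneg j (x i)))))

      y²≈ : ∀ i → y i *ℝ y i ≈ℝ normℝ (x i)
      y²≈ i = proj₂ (proj₂ (proj₂ (√ℝ (normℝ (x i)) (λ j → norm²-nonneg j (x i)))))

    yAt : ℕ → Fin n → ℚ
    yAt j i = seq (y i) j

    s : Fin n → ℝ
    s i = re (apply H (fromℝ ∘ y) i)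

    seq-s : ∀ i j → seq (s i) j ≡ 1/ m ! * applyℚ H (yAt j) i
    seq-s i j = RealAt.re≡ (realAt-apply H j (λ i → realAt-fromℝ j (y i)) i)

    0≤s : ∀ i j → 0ℚ ≤ seq (s i) j
    0≤s i j = subst (0ℚ ≤_) (sym (seq-s i j)) (*-nonneg (0≤1/! m)
      (∑ₜ-nonneg m (λ is → *-nonneg (0≤⟦⟧ (edgeᵇ H (i ∷ is))) (product-nonneg (λ l → 0≤y (lookup is l) j)))))

    Yℝ : ℝ
    Yℝ = sumℝ (λ i → powℝ (y i) (suc m))

    seq-Yℝ : ∀ j → seq Yℝ j ≡ Y (suc m) (yAt j)
    seq-Yℝ j = trans (seq-sumℝ (λ i → powℝ (y i) (suc m)) j) (sum-cong (λ i → seq-powℝ (y i) (suc m) j))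

    0≤Yℝ : ∀ j → 0ℚ ≤ seq Yℝ j
    0≤Yℝ j = subst (0ℚ ≤_) (sym (seq-Yℝ j)) (sum-nonneg (λ i → ^-nonneg (suc m) (0≤y i j)))

    Zℝ : ℝ
    Zℝ = sumℝ (λ i → y i *ℝ s i)

    seq-Zℝ : ∀ j → seq Zℝ j ≡ 1/ m ! * Z (edgeᵇ H) (yAt j)
    seq-Zℝ j = begin
      seq Zℝ j
        ≡⟨ seq-sumℝ (λ i → y i *ℝ s i) j ⟩
      sum (λ i → yAt j i * seq (s i) j)
        ≡⟨ sum-cong (λ i → trans (cong (yAt j i *_) (seq-s i j))
             (trans (solve 3 (λ a b c → a :* (b :* c) := b :* (a :* c)) refl (yAt j i) (1/ m !) (applyℚ H (yAt j) i))
               (cong (1/ m ! *_) (trans (sym (∑ₜ-*ˡ m (yAt j i) (λ is → ⟦ edgeᵇ H (i ∷ is) ⟧ * yAt j ⟪ is ⟫)))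
                 (∑ₜ-cong m (λ is → solve 3 (λ a b c → a :* (b :* c) := b :* (a :* c)) refl (yAt j i) ⟦ edgeᵇ H (i ∷ is) ⟧ (yAt j ⟪ is ⟫))))))) ⟩
      sum (λ i → 1/ m ! * ∑ₜ m (λ is → ⟦ edgeᵇ H (i ∷ is) ⟧ * yAt j ⟪ i ∷ is ⟫))
        ≡⟨ sum-*ˡ (1/ m !) (λ i → ∑ₜ m (λ is → ⟦ edgeᵇ H (i ∷ is) ⟧ * yAt j ⟪ i ∷ is ⟫)) ⟩
      1/ m ! * Z (edgeᵇ H) (yAt j) ∎
      where open ≡-Reasoning

    module _ {l : ℂ} {ρ : ℝ} (eigen : IsEigenpair (adjacency H) l x) (modulus : IsModulus l ρ) where

      -- The triangle inequality in the eigenvalue equation. The moduli are known through their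
      -- squares, so the squares of both sides are compared.
      subeigen : ∀ i → ρ *ℝ powℝ (y i) m ≤ℝ s i
      subeigen i = ²-cancel-≤ℝ {p} {s i} (0≤s i) (begin
        p *ℝ p
          ≈⟨ ≈-pointwise {p *ℝ p} {(ρ *ℝ ρ) *ℝ powℝ (y i *ℝ y i) m} regroup ⟩
        (ρ *ℝ ρ) *ℝ powℝ (y i *ℝ y i) m
          ≈⟨ *-cong {ρ *ℝ ρ} {normℝ l} {powℝ (y i *ℝ y i) m} {powℝ (normℝ (x i)) m} (proj₂ modulus)
               (powℝ-cong {y i *ℝ y i} {normℝ (x i)} m (y²≈ i)) ⟩
        normℝ l *ℝ powℝ (normℝ (x i)) m
          ≈⟨ ≈-pointwise {normℝ l *ℝ powℝ (normℝ (x i)) m} {normℝ (l *ℂ (x i ℂ-Ops.^ m))} multiplicative ⟩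
        normℝ (l *ℂ (x i ℂ-Ops.^ m))
          ≈⟨ normℝ-cong {apply H x i} {l *ℂ (x i ℂ-Ops.^ m)} (proj₂ eigen i) ⟨
        normℝ (apply H x i)
          ≲⟨ ≤ℝ-pointwise {normℝ (apply H x i)} {s i *ℝ s i} bound ⟩
        s i *ℝ s i ∎)
        where
        open ℝ-Reasoning
        p : ℝ
        p = ρ *ℝ powℝ (y i) m
        regroup : ∀ j → seq (p *ℝ p) j ≡ seq ((ρ *ℝ ρ) *ℝ powℝ (y i *ℝ y i) m) j
        regroup j = trans (solve 2 (λ r p → (r :* p) :* (r :* p) := (r :* r) :* (p :* p)) refl (seq ρ j) (seq (powℝ (y i) m) j))
          (cong (seq ρ j * seq ρ j *_) (trans (cong₂ _*_ (seq-powℝ (y i) m j) (seq-powℝ (y i) m j))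
            (trans (sym (^-distrib-* (seq (y i) j) (seq (y i) j) m)) (sym (seq-powℝ (y i *ℝ y i) m j)))))
        multiplicative : ∀ j → seq (normℝ l *ℝ powℝ (normℝ (x i)) m) j ≡ seq (normℝ (l *ℂ (x i ℂ-Ops.^ m))) j
        multiplicative j = sym (trans (norm²-* j l (x i ℂ-Ops.^ m)) (cong (norm² j l *_)
          (trans (norm²-^ j m (x i)) (sym (seq-powℝ (normℝ (x i)) m j)))))
        bound : ∀ j → norm² j (apply H x i) ≤ seq (s i) j * seq (s i) j
        bound j = subst (λ r → norm² j (apply H x i) ≤ r * r) (sym (seq-s i j))
          (Dominated.norm²≤ (dominated-apply H {x} {yAt j} j (λ i → dominated (0≤y i j) (x≤y i j)) i))

      ρY≤Z : ρ *ℝ Yℝ ≤ℝ Zℝ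
      ρY≤Z = begin
        ρ *ℝ Yℝ    ≈⟨ ≈-pointwise {ρ *ℝ Yℝ} {sumℝ terms} distribute ⟩
        sumℝ terms ≲⟨ sumℝ-mono (λ i → *-mono-ev {y i} {ρ *ℝ powℝ (y i) m} {s i} (ev-always (0≤y i)) (subeigen i)) ⟩
        Zℝ         ∎
        where
        open ℝ-Reasoning
        terms : Fin n → ℝ
        terms i = y i *ℝ (ρ *ℝ powℝ (y i) m)
        distribute : ∀ j → seq (ρ *ℝ Yℝ) j ≡ seq (sumℝ terms) j
        distribute j = trans (cong (seq ρ j *_) (seq-sumℝ (λ i → powℝ (y i) (suc m)) j))
          (trans (sym (sum-*ˡ (seq ρ j) (λ i → yAt j i * seq (powℝ (y i) m) j)))
            (trans (sum-cong (λ i → solve 3 (λ a b c → a :* (b :* c) := b :* (a :* c)) refl (seq ρ j) (yAt j i) (seq (powℝ (y i) m) j)))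
              (sym (seq-sumℝ terms j))))

      -- An eigenvector is only known not to vanish identically, which gives no entry bounded away
      -- from 0; hence the double negation. Without a positive lower bound, Y would tend to 0, and
      -- with it every entry.
      Y-positive : ¬ ¬ (∃ λ κ → 0ℚ < κ × Ev (λ j → κ ≤ seq Yℝ j))
      Y-positive not-positive = proj₁ eigen (λ i → small i (re (x i)) (re≤ i) , small i (im (x i)) (im≤ i))
        where
        re≤ : ∀ i j → seq (re (x i)) j * seq (re (x i)) j ≤ norm² j (x i)
        re≤ i j = p≤p+q (square-nonneg (seq (im (x i)) j))
        im≤ : ∀ i j → seq (im (x i)) j * seq (im (x i)) j ≤ norm² j (x i)
        im≤ i j = subst (_≤ norm² j (x i)) (+-identityˡ (seq (im (x i)) j * seq (im (x i)) j))
          (+-monoˡ-≤ (seq (im (x i)) j * seq (im (x i)) j) (square-nonneg (seq (re (x i)) j)))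
        -- A late term of at least κ would keep all later terms above κ / 2, by the Cauchy condition
        -- for κ / 2.
        ev-Y< : ∀ {κ} → 0ℚ < κ → Ev (λ j → seq Yℝ j < κ)
        ev-Y< {κ} 0<κ = N , λ j N≤j → ≰⇒> (λ κ≤ → not-positive (½ * κ , half 0<κ , N , λ j′ N≤j′ →
          +-cancel′ (≤-trans κ≤ (∣x-y∣<⇒x≤y+ {seq Yℝ j} {seq Yℝ j′} (proj₂ c j j′ N≤j N≤j′)))))
          where
          c : ∃ λ N → ∀ m n → N ℕ.≤ m → N ℕ.≤ n → ∣ seq Yℝ m - seq Yℝ n ∣ < ½ * κ
          c = cauchy Yℝ (½ * κ) (half 0<κ)
          N : ℕ
          N = proj₁ c
          +-cancel′ : ∀ {b} → κ ≤ b + ½ * κ → ½ * κ ≤ b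
          +-cancel′ {b} h = +-cancelʳ (½ * κ) (subst (_≤ b + ½ * κ) (sym (half+half κ)) h)
        small : ∀ i (r : ℝ) → (∀ j → seq r j * seq r j ≤ norm² j (x i)) → r ≈ℝ 0ℝ
        small i r r≤ ε 0<ε = ev-map (λ j Yj< → subst (_< ε) (cong ∣_∣ (sym (+-identityʳ (seq r j))))
            (²-cancel-< (<⇒≤ 0<ε) (≤-<-trans (≤-trans (≤-reflexive (∣x∣²≡x² (seq r j))) (≤-trans (r≤ j) (x≤y i j)))
              (²-mono-< (0≤y i j) (^-cancel-< (suc m) (<⇒≤ 0<ε) (≤-<-trans
                (≤-trans (term≤sum (λ i → ^-nonneg (suc m) (0≤y i j)) i) (≤-reflexive (sym (seq-Yℝ j)))) Yj<))))))
          (ev-Y< (^-pos (suc m) 0<ε))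
          where
          ^-cancel-< : ∀ k {p q} → 0ℚ ≤ q → p ^ k < q ^ k → p < q
          ^-cancel-< k {p} {q} 0≤q h with p <? q
          ... | yes lt = lt
          ... | no ¬lt = contradiction (<-≤-trans h (^-mono k 0≤q (≮⇒≥ ¬lt))) (<-irrefl refl)
          ²-mono-< : ∀ {p q} → 0ℚ ≤ p → p < q → p * p < q * q
          ²-mono-< {p} {q} 0≤p p<q = ≤-<-trans (*-monoˡ 0≤p (<⇒≤ p<q))
            (subst₂ _<_ (*-comm q p) refl (*-monoˡ-< (≤-<-trans 0≤p p<q) p<q))

-- The eigenvector of S with two values

module PerronRoot where

  open import Data.Rational.Base using (_≤_; _<_; ∣_∣)
  open RationalSums
  open TupleInequalities
  open DistinctTuples
  open CrossingTuples
  open Stability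
  open HeavyVertices
  open RationalCore
  open RealNumbers
  open Eigenvectors

  product-mono : ∀ {m} {f g : Fin m → ℚ} → (∀ i → 0ℚ ≤ f i) → (∀ i → f i ≤ g i) → product f ≤ product g
  product-mono {zero} 0≤f f≤g = ≤-refl
  product-mono {suc m} 0≤f f≤g = *-mono (0≤f zero) (product-nonneg (λ i → ≤-trans (0≤f (suc i)) (f≤g (suc i))))
    (f≤g zero) (product-mono (0≤f ∘ suc) (f≤g ∘ suc))

  link-mono : ∀ {n} m (W : Fin n → Bool) {s t} → 1ℚ ≤ s → s ≤ t → ∀ i → link m W s i ≤ link m W t i
  link-mono m W {s} {t} 1≤s s≤t i = ∑ₜ-mono m (λ is → *-monoˡ (0≤⟦⟧ (crossing W (i ∷ is)))
    (product-mono (λ j → weight-≥0 W 1≤s (lookup is j)) (λ j → weight-mono (lookup is j))))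
    where
    weight-mono : ∀ i → weight W s i ≤ weight W t i
    weight-mono i with W i
    ... | true = s≤t
    ... | false = ≤-refl

  -- Each of the m entries contributes at most one factor r.
  link-scale : ∀ {n} m (W : Fin n → Bool) {r t} → 1ℚ ≤ r → 1ℚ ≤ t → ∀ i → link m W (r * t) i ≤ r ^ m * link m W t i
  link-scale m W {r} {t} 1≤r 1≤t i = ≤-trans
    (∑ₜ-mono m (λ is → ≤-trans (*-monoˡ (0≤⟦⟧ (crossing W (i ∷ is))) (scale is))
      (≤-reflexive (solve 3 (λ c r u → c :* (r :* u) := r :* (c :* u)) refl ⟦ crossing W (i ∷ is) ⟧ (r ^ m) (weight W t ⟪ is ⟫)))))
    (≤-reflexive (∑ₜ-*ˡ m (r ^ m) (λ is → ⟦ crossing W (i ∷ is) ⟧ * weight W t ⟪ is ⟫)))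
    where
    0≤r : 0ℚ ≤ r
    0≤r = ≤-trans 0≤1 1≤r
    1≤rt : 1ℚ ≤ r * t
    1≤rt = *-mono 0≤1 (≤-trans 0≤1 1≤t) 1≤r 1≤t
    each : ∀ i → weight W (r * t) i ≤ r * weight W t i
    each i with W i
    ... | true = ≤-refl
    ... | false = ≤-trans 1≤r (≤-reflexive (sym (*-identityʳ r)))
    scale : ∀ {l} (is : Vec _ l) → weight W (r * t) ⟪ is ⟫ ≤ r ^ l * weight W t ⟪ is ⟫
    scale [] = ≤-refl
    scale {suc l} (i ∷ is) = ≤-trans (*-mono (weight-≥0 W 1≤rt i) (*-nonneg (^-nonneg l 0≤r) (0≤weight⟪⟫ W 1≤t is)) (each i) (scale is))
      (≤-reflexive (solve 4 (λ r u q p → (r :* u) :* (q :* p) := (r :* q) :* (u :* p)) refl r (weight W t i) (r ^ l) (weight W t ⟪ is ⟫)))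

  -- The chord over [0, 1] lies above the convex function (1 + e)ᵐ.
  1+e^≤ : ∀ m {e} → 0ℚ ≤ e → e ≤ 1ℚ → (1ℚ + e) ^ m ≤ 1ℚ + e * (ι 2 ^ m - 1ℚ)
  1+e^≤ zero {e} 0≤e e≤1 = ≤-reflexive (solve 1 (λ e → con 1ℚ := con 1ℚ :+ e :* (con 1ℚ :- con 1ℚ)) refl e)
  1+e^≤ (suc m) {e} 0≤e e≤1 = ≤-trans (*-monoˡ (+-nonneg 0≤1 0≤e) (1+e^≤ m 0≤e e≤1))
    (by-difference (e * (1ℚ - e) * (ι 2 ^ m - 1ℚ)) (*-nonneg (*-nonneg 0≤e (0≤q-p e≤1)) (0≤q-p (1≤^ m (1≤ι 1))))
      (solve 2 (λ e x → con 1ℚ :+ e :* (con (ι 2) :* x :- con 1ℚ) :=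
         (con 1ℚ :+ e) :* (con 1ℚ :+ e :* (x :- con 1ℚ)) :+ e :* (con 1ℚ :- e) :* (x :- con 1ℚ)) refl e (ι 2 ^ m)))

  edgeᵇ-S : ∀ {n k} β (t : Vec (Fin n) k) → edgeᵇ (S n k β) t ≡ crossing (first β) t
  edgeᵇ-S {n} {k} β t = cong (spans t ∧_) (go (nonempty? (support t ∩ initial n β)))
    where
    meets-initial : meets (lookup (initial n β)) t ≡ meets (first β) t
    meets-initial = meets-cong (lookup∘tabulate (first β)) t
    go : (d : Dec (Nonempty (support t ∩ initial n β))) → does d ≡ meets (first β) t
    go (yes p) = sym (trans (sym meets-initial) (meets-∩⁺ t (initial n β) p))
    go (no ¬p) = sym (Bool.¬-not (λ h → ¬p (meets-∩⁻ t (initial n β) (trans meets-initial h))))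

  applyℚ-S : ∀ {m n} β a (i : Fin n) → applyℚ (S n (suc m) β) (weight (first β) a) i ≡ link m (first β) a i
  applyℚ-S {m} β a i = ∑ₜ-cong m (λ is → cong (λ b → ⟦ b ⟧ * weight (first β) a ⟪ is ⟫) (edgeᵇ-S β (i ∷ is)))

  module Perron {l β n : ℕ} (v w : Fin n) (v-out : first β v ≡ false) (w-in : first β w ≡ true)
    {a₀ w₀ : ℚ} (1≤a₀ : 1ℚ ≤ a₀) (0≤w₀ : 0ℚ ≤ w₀)
    (start : link (suc l) (first β) a₀ v * a₀ ^ suc l ≤ link (suc l) (first β) a₀ w)
    (end : link (suc l) (first β) (a₀ + w₀) w ≤ link (suc l) (first β) (a₀ + w₀) v * (a₀ + w₀) ^ suc l)
    where

    private
      m : ℕ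
      m = suc l
      χ : Fin n → Bool
      χ = first β

    -- With d = 1 / m!, the vector with entries t on [β] and 1 elsewhere has the two equations λ = d
    -- Q t off [β] and λ tᵐ = d P t on [β]. Eliminating λ leaves P t = g t.
    P Q g : ℚ → ℚ
    P t = link m χ t w
    Q t = link m χ t v
    g t = Q t * t ^ m

    private
      module B = Bisection (λ t → P t ≤? g t)

    -- u decreases to the root a of P (t) = Q (t) tᵐ.  As P ≤ g holds at every u j,
    -- the rational number u j can replace a in all upper bounds.
    abstract
      u : ℕ → ℚ
      u = B.upper {a₀} 0≤w₀ end

      u-cauchy : IsCauchy u
      u-cauchy = B.upper-cauchy {a₀} 0≤w₀ end

      lo : ℕ → ℚ
      lo = B.lower {a₀} 0≤w₀ end

      width : ℕ → ℚ
      width = B.gap-width {a₀} 0≤w₀ end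

      0≤width : ∀ j → 0ℚ ≤ width j
      0≤width = B.gap-nonneg {a₀} 0≤w₀ end

      ev-width : ∀ {ε} → 0ℚ < ε → Ev (λ j → width j < ε)
      ev-width = B.ev-gap {a₀} 0≤w₀ end

      u≡ : ∀ j → u j ≡ lo j + width j
      u≡ j = B.Bracket.width (B.bracket {a₀} 0≤w₀ end j)

      a₀≤lo : ∀ j → a₀ ≤ lo j
      a₀≤lo j = B.Bracket.l₀≤l (B.bracket {a₀} 0≤w₀ end j)

      u≤ : ∀ j → u j ≤ a₀ + w₀
      u≤ j = B.Bracket.u≤u₀ (B.bracket {a₀} 0≤w₀ end j)

      P≤g : ∀ j → P (u j) ≤ g (u j)
      P≤g j = B.Bracket.above (B.bracket {a₀} 0≤w₀ end j)

      below : ∀ j → lo j ≡ a₀ ⊎ ¬ P (lo j) ≤ g (lo j)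
      below j = B.Bracket.below (B.bracket {a₀} 0≤w₀ end j)

    -- Bisection says nothing about the left end as long as this is a₀; there `start` takes over.
    g≤P : ∀ j → g (lo j) ≤ P (lo j)
    g≤P j = by (below j)
      where
      by : lo j ≡ a₀ ⊎ ¬ P (lo j) ≤ g (lo j) → g (lo j) ≤ P (lo j)
      by (inj₁ eq) = subst (λ t → g t ≤ P t) (sym eq) start
      by (inj₂ ¬p) = <⇒≤ (≰⇒> ¬p)

    lo≤u : ∀ j → lo j ≤ u j
    lo≤u j = by-difference (width j) (0≤width j) (u≡ j)

    1≤lo : ∀ j → 1ℚ ≤ lo j
    1≤lo j = ≤-trans 1≤a₀ (a₀≤lo j)

    a₀≤u : ∀ j → a₀ ≤ u j
    a₀≤u j = ≤-trans (a₀≤lo j) (lo≤u j)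

    1≤u : ∀ j → 1ℚ ≤ u j
    1≤u j = ≤-trans 1≤a₀ (a₀≤u j)

    0≤link : ∀ i {t} → 1ℚ ≤ t → 0ℚ ≤ link m χ t i
    0≤link i {t} 1≤t = ∑ₜ-nonneg m (λ is → *-nonneg (0≤⟦⟧ (crossing χ (i ∷ is))) (0≤weight⟪⟫ χ 1≤t is))

    -- G bounds g at every lower end, since g ≤ P there and P is monotone; c is the resulting
    -- Lipschitz constant.
    G c : ℚ
    G = P (a₀ + w₀)
    c = ι 2 ^ m * ι 2 ^ m * G

    0≤G : 0ℚ ≤ G
    0≤G = 0≤link w (≤-trans 1≤a₀ (p≤p+q 0≤w₀))

    0≤c : 0ℚ ≤ c
    0≤c = *-nonneg (*-nonneg (^-nonneg m (0≤ι 2)) (^-nonneg m (0≤ι 2))) 0≤G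

    -- g (u) − g (lo) is small because u ≤ (1 + e) lo with e = u − lo and g has
    -- degree at most 2m.
    g-P≤ : ∀ j → width j ≤ 1ℚ → g (u j) - P (u j) ≤ c * width j
    g-P≤ j e≤1 = p≤q⇐0≤q-p (subst (0ℚ ≤_)
        (solve 5 (λ gu pu gl pl ce → ((pu :- pl) :+ (pl :- gl) :+ ((gl :+ ce) :- gu)) := ce :- (gu :- pu))
          refl (g (u j)) (P (u j)) (g (lo j)) (P (lo j)) (c * e))
        (+-nonneg (+-nonneg (0≤q-p (link-mono m χ (1≤lo j) (lo≤u j) w)) (0≤q-p (g≤P j))) (0≤q-p g-lip)))
      where
      e r L : ℚ
      e = width j
      r = 1ℚ + e
      L = lo j
      0≤e : 0ℚ ≤ e
      0≤e = 0≤width j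
      0≤L : 0ℚ ≤ L
      0≤L = ≤-trans 0≤1 (1≤lo j)
      1≤r : 1ℚ ≤ r
      1≤r = p≤p+q 0≤e
      u≤rL : u j ≤ r * L
      u≤rL = by-difference (e * (L - 1ℚ)) (*-nonneg 0≤e (0≤q-p (1≤lo j)))
        (trans (solve 2 (λ e L → (con 1ℚ :+ e) :* L := (L :+ e) :+ e :* (L :- con 1ℚ)) refl e L) (cong (_+ e * (L - 1ℚ)) (sym (u≡ j))))
      1≤rL : 1ℚ ≤ r * L
      1≤rL = *-mono 0≤1 0≤L 1≤r (1≤lo j)
      0≤gL : 0ℚ ≤ g L
      0≤gL = *-nonneg (0≤link v (1≤lo j)) (^-nonneg m 0≤L)
      gL≤G : g L ≤ G
      gL≤G = ≤-trans (g≤P j) (link-mono m χ (1≤lo j) (≤-trans (lo≤u j) (u≤ j)) w)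
      r^ : r ^ m ≤ 1ℚ + e * (ι 2 ^ m - 1ℚ)
      r^ = 1+e^≤ m 0≤e e≤1
      x : ℚ
      x = ι 2 ^ m
      1≤x : 1ℚ ≤ x
      1≤x = 1≤^ m (1≤ι 1)
      -- As e² ≤ e, squaring the chord bound gives (1 + e (x - 1))² ≤ 1 + x² e.
      r^r^ : r ^ m * r ^ m ≤ 1ℚ + x * x * e
      r^r^ = ≤-trans (*-mono (^-nonneg m (≤-trans 0≤1 1≤r)) (+-nonneg 0≤1 (*-nonneg 0≤e (0≤q-p 1≤x))) r^ r^)
        (by-difference (e * (1ℚ - e) * ((x - 1ℚ) * (x - 1ℚ)) + e)
          (+-nonneg (*-nonneg (*-nonneg 0≤e (0≤q-p e≤1)) (square-nonneg (x - 1ℚ))) 0≤e)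
          (solve 2 (λ e x → con 1ℚ :+ x :* x :* e :=
            (con 1ℚ :+ e :* (x :- con 1ℚ)) :* (con 1ℚ :+ e :* (x :- con 1ℚ)) :+ (e :* (con 1ℚ :- e) :* ((x :- con 1ℚ) :* (x :- con 1ℚ)) :+ e)) refl e x))
      g-lip : g (u j) ≤ g L + c * e
      g-lip = begin
        Q (u j) * u j ^ m
          ≤⟨ *-mono (0≤link v (1≤u j)) (^-nonneg m (≤-trans 0≤1 1≤rL)) (link-mono m χ (1≤u j) u≤rL v) (^-mono m (≤-trans 0≤1 (1≤u j)) u≤rL) ⟩
        Q (r * L) * (r * L) ^ m
          ≤⟨ *-monoʳ (^-nonneg m (≤-trans 0≤1 1≤rL)) (link-scale m χ 1≤r (1≤lo j) v) ⟩
        r ^ m * Q L * (r * L) ^ m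
          ≡⟨ trans (cong (r ^ m * Q L *_) (^-distrib-* r L m))
               (solve 3 (λ r q l → r :* q :* (r :* l) := (r :* r) :* (q :* l)) refl (r ^ m) (Q L) (L ^ m)) ⟩
        r ^ m * r ^ m * g L
          ≤⟨ *-monoʳ 0≤gL r^r^ ⟩
        (1ℚ + x * x * e) * g L
          ≤⟨ by-difference (x * x * e * (G - g L)) (*-nonneg (*-nonneg (square-nonneg x) 0≤e) (0≤q-p gL≤G))
               (solve 4 (λ x e G gl → gl :+ x :* x :* G :* e := (con 1ℚ :+ x :* x :* e) :* gl :+ x :* x :* e :* (G :- gl)) refl x e G (g L)) ⟩
        g L + c * e ∎
        where open ≤-Reasoning

    ev-g-P : ∀ {ε} → 0ℚ < ε → Ev (λ j → g (u j) - P (u j) < ε)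
    ev-g-P {ε} 0<ε =
      let η , 0<η , cη<ε = divide 0≤c 0<ε
          μ , 0<μ , μ≤1 , μ≤η = minimum 0<1 0<η
      in ev-map (λ j p → ≤-<-trans (g-P≤ j (≤-trans (<⇒≤ p) μ≤1))
           (≤-<-trans (*-monoˡ 0≤c (≤-trans (<⇒≤ p) μ≤η)) cη<ε)) (ev-width 0<μ)

    aℝ : ℝ
    aℝ = mkℝ u u-cauchy

    uℝ : Fin n → ℝ
    uℝ i = if χ i then aℝ else 1ℝ

    seq-uℝ : ∀ i j → seq (uℝ i) j ≡ weight χ (u j) i
    seq-uℝ i j with χ i
    ... | true = refl
    ... | false = refl

    private
      H : Hypergraph (suc m) n
      H = S n (suc m) β

      x : Fin n → ℂ
      x = fromℝ ∘ uℝ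

      d : ℚ
      d = 1/ m !

    -- The eigenvalue is read off at v, which lies outside [β] and so has entry 1.
    λS : ℝ
    λS = re (apply H x v)

    realAt-x : ∀ i j → RealAt j (x i) (weight χ (u j) i)
    realAt-x i j = subst (RealAt j (x i)) (seq-uℝ i j) (realAt-fromℝ j (uℝ i))

    realAt-Ax : ∀ i j → RealAt j (apply H x i) (d * link m χ (u j) i)
    realAt-Ax i j = subst (λ q → RealAt j (apply H x i) (d * q)) (applyℚ-S {m} β (u j) i) (realAt-apply H j (λ i → realAt-x i j) i)

    seq-λS : ∀ j → seq λS j ≡ d * Q (u j)
    seq-λS j = RealAt.re≡ (realAt-Ax v j)

    0≤λS : ∀ j → 0ℚ ≤ seq λS j
    0≤λS j = subst (0ℚ ≤_) (sym (seq-λS j)) (*-nonneg (0≤1/! m) (0≤link v (1≤u j)))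

    realAt-λx : ∀ i j → RealAt j (fromℝ λS *ℂ (x i ℂ-Ops.^ m)) (d * Q (u j) * weight χ (u j) i ^ m)
    realAt-λx i j = realAt-* j (subst (RealAt j (fromℝ λS)) (seq-λS j) (realAt-fromℝ j λS)) (realAt-^ j m (realAt-x i j))

    -- Off [β] the equation holds at every index. On [β] it holds in the limit only, the difference
    -- of the two sides being d (g - P) at u j, which tends to 0.
    eigenpair : IsEigenpair (adjacency H) (fromℝ λS) x
    eigenpair = nonzero , λ i → by i (χ i) refl , ≈-pointwise {im (apply H x i)} {im (fromℝ λS *ℂ (x i ℂ-Ops.^ m))}
        (λ j → trans (RealAt.im≡ (realAt-Ax i j)) (sym (RealAt.im≡ (realAt-λx i j))))
      where
      nonzero : ¬ (∀ i → x i ≈ℂ 0ℂ)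
      nonzero h = let j , lt = ev-witness (proj₁ (h v) 1ℚ 0<1) in
        <-irrefl refl (subst (λ q → ∣ q - 0ℚ ∣ < 1ℚ) (trans (seq-uℝ v j) (cong (λ b → if b then u j else 1ℚ) v-out)) lt)
      by : ∀ i b → χ i ≡ b → re (apply H x i) ≈ℝ re (fromℝ λS *ℂ (x i ℂ-Ops.^ m))
      by i false i-out = ≈-pointwise {re (apply H x i)} {re (fromℝ λS *ℂ (x i ℂ-Ops.^ m))} (λ j →
        trans (RealAt.re≡ (realAt-Ax i j)) (trans (cong (d *_) (link-const m χ (u j) i v (trans i-out (sym v-out))))
          (trans (trans (sym (*-identityʳ (d * Q (u j)))) (cong (d * Q (u j) *_)
            (trans (sym (1^ m)) (cong (λ b → (if b then u j else 1ℚ) ^ m) (sym i-out))))) (sym (RealAt.re≡ (realAt-λx i j))))))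
      by i true i-in ε 0<ε =
        let η , 0<η , dη<ε = divide (0≤1/! m) 0<ε
        in ev-map (λ j p → subst (_< ε) (sym (difference j)) (≤-<-trans (*-monoˡ (0≤1/! m) (<⇒≤ p)) dη<ε)) (ev-g-P 0<η)
        where
        difference : ∀ j → ∣ seq (re (apply H x i)) j - seq (re (fromℝ λS *ℂ (x i ℂ-Ops.^ m))) j ∣ ≡ d * (g (u j) - P (u j))
        difference j = trans (cong₂ (λ p q → ∣ p - q ∣)
            (trans (RealAt.re≡ (realAt-Ax i j)) (cong (d *_) (link-const m χ (u j) i w (trans i-in (sym w-in)))))
            (trans (RealAt.re≡ (realAt-λx i j)) (cong (λ b → d * Q (u j) * (if b then u j else 1ℚ) ^ m) i-in)))
          (trans (∣x-y∣≡∣y-x∣ (d * P (u j)) (d * Q (u j) * u j ^ m))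
            (trans (cong ∣_∣ (solve 4 (λ d p q t → d :* q :* t :- d :* p := d :* (q :* t :- p)) refl d (P (u j)) (Q (u j)) (u j ^ m)))
              (ℚ.0≤p⇒∣p∣≡p (*-nonneg (0≤1/! m) (0≤q-p (P≤g j))))))

    -- λS is nonnegative, hence its own modulus. This bounds ρ(S) from below, the direction in which
    -- ρ(H) ≥ (1 - δ) ρ(S) is used.
    λS≤ : ∀ {ρ} → (∀ l r → IsEigenvalue (adjacency H) l → IsModulus l r → r ≤ℝ ρ) → λS ≤ℝ ρ
    λS≤ largest = largest (fromℝ λS) λS (x , eigenpair)
      (≤ℝ-pointwise {0ℝ} {λS} 0≤λS , ≈-pointwise {λS *ℝ λS} {λS *ℝ λS +ℝ 0ℝ *ℝ 0ℝ}
        (λ j → solve 1 (λ x → x := x :+ con 0ℚ :* con 0ℚ) refl (seq λS j * seq λS j)))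

-- Choice of the constants

module Thresholds where

  open import Data.Rational.Base using (_≤_; _<_)
  open RationalSums
  open CrossingTuples
  open Regimes
  open MissingEdges
  open RationalCore
  open RealNumbers
  open PerronRoot

  module Constants (l β : ℕ) (1≤β : 1 ℕ.≤ β) where

    k m B : ℕ
    k = suc (suc l)
    m = suc l
    B = k ℕ.* suc β

    b M c a₀ q : ℚ
    b = ι β
    M = ι m
    c = b + 1ℚ + M
    -- a₀ is the bound required by `a-large`, and q a ≤ n is the condition `a-small`.
    a₀ = ι 32 * ι B
    q = ι 32 * b * b * M

    1≤b : 1ℚ ≤ b
    1≤b = ι-mono 1≤β

    0≤b : 0ℚ ≤ b
    0≤b = 0≤ι β

    0<b : 0ℚ < b
    0<b = <-≤-trans 0<1 1≤b

    0≤M : 0ℚ ≤ M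
    0≤M = 0≤ι m

    0≤c : 0ℚ ≤ c
    0≤c = +-nonneg (+-nonneg 0≤b 0≤1) 0≤M

    abstract
      inverse : ∃ λ h → 0ℚ < h × ι 8 * b * h ≡ 1ℚ
      inverse = recip (*-pos (0<ι 7) 0<b)

    h : ℚ
    h = proj₁ inverse

    0<h : 0ℚ < h
    0<h = proj₁ (proj₂ inverse)

    8bh≡1 : ι 8 * b * h ≡ 1ℚ
    8bh≡1 = proj₂ (proj₂ inverse)

    0<q : 0ℚ < q
    0<q = *-pos (*-pos (*-pos (0<ι 31) 0<b) 0<b) (0<ι l)

    0≤q : 0ℚ ≤ q
    0≤q = <⇒≤ 0<q

    1≤a₀ : 1ℚ ≤ a₀
    1≤a₀ = *-mono 0≤1 (0≤ι B) (1≤ι 31) (1≤ι (β ℕ.+ suc l ℕ.* suc β))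

    0≤a₀ : 0ℚ ≤ a₀
    0≤a₀ = ≤-trans 0≤1 1≤a₀

    -- n ≥ E₁ and n ≥ E₂ put n in the regime of a₀, E₃ makes the bisection start
    -- below the root at a₀, and E₄ makes it end above the root at n / q.
    E₁ E₂ E₃ E₄ : ℚ
    E₁ = ι 16 * b * M * c
    E₂ = q * a₀
    E₃ = ι 4 * (M * b * a₀ * a₀ ^ m)
    E₄ = ι 4 * (q * q)

    0≤E₁ : 0ℚ ≤ E₁
    0≤E₁ = *-nonneg (*-nonneg (*-nonneg (0≤ι 16) 0≤b) 0≤M) 0≤c

    0≤E₂ : 0ℚ ≤ E₂
    0≤E₂ = *-nonneg 0≤q 0≤a₀

    0≤E₃ : 0ℚ ≤ E₃
    0≤E₃ = *-nonneg (0≤ι 4) (*-nonneg (*-nonneg (*-nonneg 0≤M 0≤b) 0≤a₀) (^-nonneg m 0≤a₀))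

    0≤E₄ : 0ℚ ≤ E₄
    0≤E₄ = *-nonneg (0≤ι 4) (square-nonneg q)

    abstract
      n₀ : ℕ
      n₀ = proj₁ (archimedean (E₁ + E₂ + E₃ + E₄))

      E≤n₀ : E₁ + E₂ + E₃ + E₄ ≤ ι n₀
      E≤n₀ = proj₂ (archimedean (E₁ + E₂ + E₃ + E₄))

    -- The factor of `missing-few`, with nᵐ split off from (2n)ᵐ.
    Cℚ : ℚ
    Cℚ = ι k * (ι 32 * b * ι k) ^ k * ι 2 * ι 2 ^ m

    0<Cℚ : 0ℚ < Cℚ
    0<Cℚ = *-pos (*-pos (*-pos (0<ι (suc l)) (^-pos k (*-pos (*-pos (0<ι 31) 0<b) (0<ι (suc l))))) (0<ι 1)) (^-pos m (0<ι 1))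

    -- This is h / 8 and not h / 4: the rational number replacing δ may be as large as 2 δ₀, and
    -- four times it must not exceed h.
    δ₀ : ℚ
    δ₀ = ½ * (½ * (½ * h))

    0<δ₀ : 0ℚ < δ₀
    0<δ₀ = half (half (half 0<h))

    module Large (n : ℕ) (n₀≤n : n₀ ℕ.≤ n) where

      N : ℚ
      N = ι n

      total : E₁ + E₂ + E₃ + E₄ ≤ N
      total = ≤-trans E≤n₀ (ι-mono n₀≤n)

      E₁≤ : E₁ ≤ N
      E₁≤ = ≤-trans (by-difference (E₂ + E₃ + E₄) (+-nonneg (+-nonneg 0≤E₂ 0≤E₃) 0≤E₄)
        (solve 4 (λ x y z w → x :+ y :+ z :+ w := x :+ (y :+ z :+ w)) refl E₁ E₂ E₃ E₄)) total

      E₂≤ : E₂ ≤ N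
      E₂≤ = ≤-trans (by-difference (E₁ + E₃ + E₄) (+-nonneg (+-nonneg 0≤E₁ 0≤E₃) 0≤E₄)
        (solve 4 (λ x y z w → x :+ y :+ z :+ w := y :+ (x :+ z :+ w)) refl E₁ E₂ E₃ E₄)) total

      E₃≤ : E₃ ≤ N
      E₃≤ = ≤-trans (by-difference (E₁ + E₂ + E₄) (+-nonneg (+-nonneg 0≤E₁ 0≤E₂) 0≤E₄)
        (solve 4 (λ x y z w → x :+ y :+ z :+ w := z :+ (x :+ y :+ w)) refl E₁ E₂ E₃ E₄)) total

      E₄≤ : E₄ ≤ N
      E₄≤ = ≤-trans (by-difference (E₁ + E₂ + E₃) (+-nonneg (+-nonneg 0≤E₁ 0≤E₂) 0≤E₃)
        (solve 4 (λ x y z w → x :+ y :+ z :+ w := w :+ (x :+ y :+ z)) refl E₁ E₂ E₃ E₄)) total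

      0≤N : 0ℚ ≤ N
      0≤N = 0≤ι n

      regime-at : ∀ {a} → a₀ ≤ a → q * a ≤ N → Regime l β n a h
      regime-at a₀≤a qa≤N = record
        { 1≤b = 1≤b ; 1≤a = ≤-trans 1≤a₀ a₀≤a ; 0<h = 0<h ; 8bh≡1 = 8bh≡1 ; a-small = qa≤N ; n-large = E₁≤ }

      β<n : β ℕ.< n
      β<n = ι-cancel (≤-trans (by-difference (M + E₁ - c) (subst (0ℚ ≤_) (sym (+-assoc M E₁ (- c))) (+-nonneg 0≤M (0≤q-p c≤E₁)))
        (solve 3 (λ b M E → E := (con 1ℚ :+ b) :+ (M :+ E :- (b :+ con 1ℚ :+ M))) refl b M E₁)) E₁≤)
        where
        c≤E₁ : c ≤ E₁
        c≤E₁ = subst (_≤ E₁) (*-identityˡ c) (*-monoʳ 0≤c (*-mono 0≤1 0≤M (*-mono 0≤1 0≤b (1≤ι 15) 1≤b) (1≤ι l)))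

      β≤n : β ℕ.≤ n
      β≤n = ℕ.<⇒≤ β<n

      -- One vertex outside and one inside [β]; by `link-const` their two equations stand for all n.
      v w : Fin n
      v = Fin.fromℕ< β<n
      w = Fin.fromℕ< {0} (ℕ.≤-trans (ℕ.s≤s ℕ.z≤n) β<n)

      v-out : first β v ≡ false
      v-out = trans (cong (_<ᵇ β) (Fin.toℕ-fromℕ< β<n)) (≮ᵇ {β} ℕ.≤-refl)

      w-in : first β w ≡ true
      w-in = trans (cong (_<ᵇ β) (Fin.toℕ-fromℕ< {0} (ℕ.≤-trans (ℕ.s≤s ℕ.z≤n) β<n))) (go 1≤β)
        where
        go : ∀ {β} → 1 ℕ.≤ β → (0 <ᵇ β) ≡ true
        go (ℕ.s≤s _) = refl

      abstract
        endpoint : ∃ λ t → q * t ≡ N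
        endpoint = let r , 0<r , qr≡1 = recip 0<q in
          r * N , trans (sym (*-assoc q r N)) (trans (cong (_* N) qr≡1) (*-identityˡ N))

      -- t₁ = n / q is the largest a that `a-small` admits.
      w₀ t₁ : ℚ
      w₀ = proj₁ endpoint - a₀
      t₁ = a₀ + w₀

      qt₁≡N : q * t₁ ≡ N
      qt₁≡N = trans (cong (q *_) (solve 2 (λ a t → a :+ (t :- a) := t) refl a₀ (proj₁ endpoint))) (proj₂ endpoint)

      a₀≤t₁ : a₀ ≤ t₁
      a₀≤t₁ = *-cancelˡ 0<q (≤-trans E₂≤ (≤-reflexive (sym qt₁≡N)))

      0≤w₀ : 0ℚ ≤ w₀
      0≤w₀ = subst (0ℚ ≤_) (solve 2 (λ a w → (a :+ w) :- a := w) refl a₀ w₀) (0≤q-p a₀≤t₁)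

      R₀ : Regime l β n a₀ h
      R₀ = regime-at ≤-refl E₂≤

      R₁ : Regime l β n t₁ h
      R₁ = regime-at a₀≤t₁ (≤-reflexive qt₁≡N)

      1≤2-2h : 1ℚ ≤ ι 2 * (1ℚ - h)
      1≤2-2h = by-difference ((1ℚ - ι 8 * h) + ι 6 * h) (+-nonneg (Regime.0≤1-8h R₀) (*-nonneg (0≤ι 6) (<⇒≤ 0<h)))
        (solve 1 (λ h → con (ι 2) :* (con 1ℚ :- h) := con 1ℚ :+ ((con 1ℚ :- con (ι 8) :* h) :+ con (ι 6) :* h)) refl h)

      -- For the fixed number a₀ the left side has order nˡ and the right side order n^(l+1).
      start : link m (first β) a₀ v * a₀ ^ m ≤ link m (first β) a₀ w
      start = begin
        link m (first β) a₀ v * a₀ ^ m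
          ≤⟨ *-monoʳ (^-nonneg m 0≤a₀) (link-out-upper R₀ β≤n v v-out) ⟩
        M * (b * a₀ * X ^ l) * a₀ ^ m
          ≡⟨ solve 5 (λ M b a x p → M :* (b :* a :* x) :* p := M :* b :* a :* p :* x) refl M b a₀ (X ^ l) (a₀ ^ m) ⟩
        M * b * a₀ * a₀ ^ m * X ^ l
          ≤⟨ *-monoʳ (^-nonneg l 0≤X) bound ⟩
        D * (1ℚ - h) * X ^ l
          ≡⟨ *-assoc D (1ℚ - h) (X ^ l) ⟩
        D * ((1ℚ - h) * X ^ l)
          ≤⟨ *-monoˡ 0≤D (X^≤D^ l (ℕ.n≤1+n l)) ⟩
        D * D ^ l
          ≤⟨ link-in-lower R₀ β≤n w w-in ⟩
        link m (first β) a₀ w ∎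
        where
        open ≤-Reasoning
        open Regime R₀ using (X; D; 0≤X; 0≤D; X^≤D^; N≤X; 0≤1-h)
        N≤2D : N ≤ ι 2 * D
        N≤2D = ≤-trans N≤X (begin
          X                          ≡⟨ sym (*-identityˡ X) ⟩
          1ℚ * X                     ≤⟨ *-monoʳ 0≤X 1≤2-2h ⟩
          ι 2 * (1ℚ - h) * X         ≡⟨ solve 2 (λ g x → con (ι 2) :* g :* x := con (ι 2) :* (g :* (x :* con 1ℚ))) refl (1ℚ - h) X ⟩
          ι 2 * ((1ℚ - h) * X ^ 1)   ≤⟨ *-monoˡ (0≤ι 2) (X^≤D^ 1 (ℕ.s≤s ℕ.z≤n)) ⟩
          ι 2 * D ^ 1                ≡⟨ cong (ι 2 *_) (*-identityʳ D) ⟩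
          ι 2 * D                    ∎)
        bound : M * b * a₀ * a₀ ^ m ≤ D * (1ℚ - h)
        bound = *-cancelˡ (0<ι 3) (begin
          ι 4 * (M * b * a₀ * a₀ ^ m) ≤⟨ E₃≤ ⟩
          N                           ≡⟨ sym (*-identityˡ N) ⟩
          1ℚ * N                      ≤⟨ *-mono 0≤1 (*-nonneg (0≤ι 2) 0≤D) 1≤2-2h N≤2D ⟩
          ι 2 * (1ℚ - h) * (ι 2 * D)  ≡⟨ solve 2 (λ g d → con (ι 2) :* g :* (con (ι 2) :* d) := con (ι 4) :* (d :* g)) refl (1ℚ - h) D ⟩
          ι 4 * (D * (1ℚ - h))        ∎)

      -- At t₁ = n / q the left side is at most X^(l+1), while the right side is at least t₁² Dˡ,
      -- which is larger by a factor of order n.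
      end : link m (first β) t₁ w ≤ link m (first β) t₁ v * t₁ ^ m
      end = begin
        link m (first β) t₁ w
          ≤⟨ link-in-upper R₁ β≤n w ⟩
        X * X ^ l
          ≤⟨ *-monoʳ (^-nonneg l 0≤X) X≤ ⟩
        t₁ * t₁ * (1ℚ - h) * X ^ l
          ≡⟨ *-assoc (t₁ * t₁) (1ℚ - h) (X ^ l) ⟩
        t₁ * t₁ * ((1ℚ - h) * X ^ l)
          ≤⟨ *-monoˡ (square-nonneg t₁) (X^≤D^ l (ℕ.n≤1+n l)) ⟩
        t₁ * t₁ * D ^ l
          ≤⟨ *-monoʳ (^-nonneg l 0≤D) (*-mono 0≤t₁ (^-nonneg m 0≤t₁) t₁≤ t₁≤t₁^m) ⟩
        M * (b * t₁) * t₁ ^ m * D ^ l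
          ≡⟨ solve 3 (λ x p d → x :* p :* d := x :* d :* p) refl (M * (b * t₁)) (t₁ ^ m) (D ^ l) ⟩
        M * (b * t₁) * D ^ l * t₁ ^ m
          ≤⟨ *-monoʳ (^-nonneg m 0≤t₁) (link-out-lower R₁ β≤n v v-out) ⟩
        link m (first β) t₁ v * t₁ ^ m ∎
        where
        open ≤-Reasoning
        open Regime R₁ using (X; D; 0≤X; 0≤D; X^≤D^; X≤2N)
        1≤t₁ : 1ℚ ≤ t₁
        1≤t₁ = ≤-trans 1≤a₀ a₀≤t₁
        0≤t₁ : 0ℚ ≤ t₁
        0≤t₁ = ≤-trans 0≤1 1≤t₁
        t₁≤ : t₁ ≤ M * (b * t₁)
        t₁≤ = subst (_≤ M * (b * t₁)) (solve 1 (λ t → con 1ℚ :* (con 1ℚ :* t) := t) refl t₁)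
          (*-mono 0≤1 (*-nonneg 0≤b 0≤t₁) (1≤ι l) (*-monoʳ 0≤t₁ 1≤b))
        t₁≤t₁^m : t₁ ≤ t₁ ^ m
        t₁≤t₁^m = subst (_≤ t₁ ^ m) (*-identityʳ t₁) (*-monoˡ 0≤t₁ (1≤^ l 1≤t₁))
        4N≤t₁² : ι 4 * N ≤ t₁ * t₁
        4N≤t₁² = *-cancelˡ (*-pos 0<q 0<q) (begin
          q * q * (ι 4 * N)     ≡⟨ solve 2 (λ q N → q :* q :* (con (ι 4) :* N) := con (ι 4) :* (q :* q) :* N) refl q N ⟩
          ι 4 * (q * q) * N     ≤⟨ *-monoʳ 0≤N E₄≤ ⟩
          N * N                 ≡⟨ sym (cong₂ _*_ qt₁≡N qt₁≡N) ⟩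
          q * t₁ * (q * t₁)     ≡⟨ solve 2 (λ q t → q :* t :* (q :* t) := q :* q :* (t :* t)) refl q t₁ ⟩
          q * q * (t₁ * t₁)     ∎)
        X≤ : X ≤ t₁ * t₁ * (1ℚ - h)
        X≤ = *-cancelˡ (0<ι 1) (begin
          ι 2 * X                       ≤⟨ *-monoˡ (0≤ι 2) X≤2N ⟩
          ι 2 * (ι 2 * N)               ≡⟨ solve 1 (λ N → con (ι 2) :* (con (ι 2) :* N) := con 1ℚ :* (con (ι 4) :* N)) refl N ⟩
          1ℚ * (ι 4 * N)                ≤⟨ *-mono 0≤1 (square-nonneg t₁) 1≤2-2h 4N≤t₁² ⟩
          ι 2 * (1ℚ - h) * (t₁ * t₁)    ≡⟨ solve 2 (λ g t → con (ι 2) :* g :* t := con (ι 2) :* (t :* g)) refl (1ℚ - h) (t₁ * t₁) ⟩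
          ι 2 * (t₁ * t₁ * (1ℚ - h))    ∎)

      module Root = Perron {l} {β} {n} v w v-out w-in {a₀} {w₀} 1≤a₀ 0≤w₀ start end

      regime-u : ∀ j → Regime l β n (Root.u j) h
      regime-u j = regime-at (Root.a₀≤u j) (≤-trans (*-monoˡ 0≤q (Root.u≤ j)) (≤-reflexive qt₁≡N))

      -- A positive lower bound independent of j, against which the error at a finite index is
      -- measured in `large-at`.
      1-h≤Q : ∀ j → 1ℚ - h ≤ Root.Q (Root.u j)
      1-h≤Q j = begin
        1ℚ - h
          ≡⟨ solve 1 (λ g → g := con 1ℚ :* (con 1ℚ :* con 1ℚ) :* (g :* con 1ℚ)) refl (1ℚ - h) ⟩
        1ℚ * (1ℚ * 1ℚ) * ((1ℚ - h) * 1ℚ)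
          ≤⟨ *-mono (*-nonneg 0≤1 (*-nonneg 0≤1 0≤1)) (^-nonneg l 0≤D)
               (*-mono 0≤1 (*-nonneg 0≤b (≤-trans 0≤1 (Root.1≤u j))) (1≤ι l) (*-mono 0≤1 (≤-trans 0≤1 (Root.1≤u j)) 1≤b (Root.1≤u j)))
               (≤-trans (*-monoˡ 0≤1-h (1≤^ l (≤-trans 1≤N N≤X))) (X^≤D^ l (ℕ.n≤1+n l))) ⟩
        M * (b * Root.u j) * D ^ l
          ≤⟨ link-out-lower (regime-u j) β≤n v v-out ⟩
        Root.Q (Root.u j) ∎
        where
        open ≤-Reasoning
        open Regime (regime-u j) using (X; D; 0≤D; X^≤D^; N≤X; 1≤N; 0≤1-h)

-- Transfer between real and rational inequalities, and the theorem

module Conclusion where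

  open import Data.Rational.Base using (_≤_; _<_)
  open import Data.List.Base using (length)
  open RationalSums
  open Regimes
  open Stability
  open HeavyVertices
  open MissingEdges
  open RationalCore
  open RealNumbers
  open Eigenvectors
  open PerronRoot
  open Thresholds

  module Comparison (l β : ℕ) (1≤β : 1 ℕ.≤ β) (n : ℕ) (n₀≤n : Constants.n₀ l β 1≤β ℕ.≤ n)
    (H : Hypergraph (suc (suc l)) n) (δ ρH ρS : ℝ)
    (δ≤ : δ ≤ℝ fromℚ (Constants.δ₀ l β 1≤β))
    (radius-H : IsSpectralRadius (adjacency H) ρH) (radius-S : IsSpectralRadius (adjacency (S n (suc (suc l)) β)) ρS)
    (large : (1ℝ -ℝ δ) *ℝ ρS ≤ℝ ρH) where

    open Constants l β 1≤β
    open Large n n₀≤n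

    private
      eigenvalue : ℂ
      eigenvalue = proj₁ (proj₁ radius-H)

      x : Fin n → ℂ
      x = proj₁ (proj₁ (proj₂ (proj₁ radius-H)))

      modulus : IsModulus eigenvalue ρH
      modulus = proj₂ (proj₂ (proj₁ radius-H))

      eigen : IsEigenpair (adjacency H) eigenvalue x
      eigen = proj₂ (proj₁ (proj₂ (proj₁ radius-H)))

      module Mod = Moduli {m} {n} H x

    open Mod using (Yℝ; Zℝ; yAt)
    open Root using (λS; u)

    8δ₀≡h : ι 8 * δ₀ ≡ h
    8δ₀≡h = solve 1 (λ h → con (ι 8) :* (con ½ :* (con ½ :* (con ½ :* h))) := h) refl h

    ev-1-δ : Ev (λ j → 0ℚ ≤ seq (1ℝ -ℝ δ) j)
    ev-1-δ = ev-map (λ j p → 0≤q-p (≤-trans p 2δ₀≤1)) (δ≤ δ₀ 0<δ₀)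
      where
      2δ₀≤1 : δ₀ + δ₀ ≤ 1ℚ
      2δ₀≤1 = ≤-trans (by-difference (ι 6 * δ₀) (*-nonneg (0≤ι 6) (<⇒≤ 0<δ₀))
        (trans (sym 8δ₀≡h) (solve 1 (λ d → con (ι 8) :* d := (d :+ d) :+ con (ι 6) :* d) refl δ₀))) (Regime.h≤1 R₀)

    comparison : Yℝ *ℝ ((1ℝ -ℝ δ) *ℝ λS) ≤ℝ Zℝ
    comparison = begin
      Yℝ *ℝ ((1ℝ -ℝ δ) *ℝ λS)
        ≲⟨ *-mono-ev {Yℝ} {(1ℝ -ℝ δ) *ℝ λS} {(1ℝ -ℝ δ) *ℝ ρS} (ev-always Mod.0≤Yℝ)
             (*-mono-ev {1ℝ -ℝ δ} {λS} {ρS} ev-1-δ (Root.λS≤ {ρS} (proj₂ radius-S))) ⟩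
      Yℝ *ℝ ((1ℝ -ℝ δ) *ℝ ρS)
        ≲⟨ *-mono-ev {Yℝ} {(1ℝ -ℝ δ) *ℝ ρS} {ρH} (ev-always Mod.0≤Yℝ) large ⟩
      Yℝ *ℝ ρH
        ≈⟨ *-comm-≈ Yℝ ρH ⟩
      ρH *ℝ Yℝ
        ≲⟨ Mod.ρY≤Z {eigenvalue} {ρH} eigen modulus ⟩
      Zℝ ∎
      where open ℝ-Reasoning

    -- Replacing δ by the larger δ′ gains at least η d Y Q, which is no less than `ε κ` and pays for
    -- the error of `comparison` at a finite index. The bound κ comes from `Y-positive`, hence the
    -- double negation.
    witness : ∀ {η δ′} → 0ℚ < η → Ev (λ j → seq δ j + η ≤ δ′) → ¬ ¬ Witness {β = β} h H v w δ′
    witness {η} {δ′} 0<η δ<δ′ no-witness = Mod.Y-positive {eigenvalue} {ρH} eigen modulus λ (κ , 0<κ , κ≤Y) →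
      let j , (δj , κj , cj , gj) = ev-witness (ev-× δ<δ′ (ev-× κ≤Y (ev-× (comparison (ε κ) (0<ε 0<κ)) (Root.ev-g-P 0<1)))) in
      no-witness record
        { a = u j
        ; regime = regime-u j
        ; a-large = Root.a₀≤u j
        ; lower = Root.P≤g j
        ; upper = subst₂ _≤_ (solve 2 (λ g p → (g :- p) :+ p := g) refl (Root.g (u j)) (Root.P (u j))) (+-comm 1ℚ (Root.P (u j)))
            (+-monoˡ-≤ (Root.P (u j)) (<⇒≤ gj))
        ; y = yAt j
        ; 0≤y = λ i → Mod.0≤y i j
        ; 0<Y = <-≤-trans 0<κ (≤-trans κj (≤-reflexive (Mod.seq-Yℝ j)))
        ; large = large-at j κ 0<κ δj (≤-trans κj (≤-reflexive (Mod.seq-Yℝ j)))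
            (subst₂ _≤_ (cong₂ (λ y s → y * ((1ℚ - seq δ j) * s)) (Mod.seq-Yℝ j) (Root.seq-λS j)) (cong (_+ ε κ) (Mod.seq-Zℝ j)) cj)
        }
      where
      d : ℚ
      d = 1/ m !
      0<d : 0ℚ < d
      0<d = 0<1/! m
      ε : ℚ → ℚ
      ε κ = η * (d * (κ * (1ℚ - h)))
      0<ε : ∀ {κ} → 0ℚ < κ → 0ℚ < ε κ
      0<ε 0<κ = *-pos 0<η (*-pos 0<d (*-pos 0<κ (Regime.0<1-h R₀)))
      large-at : ∀ j κ → 0ℚ < κ → seq δ j + η ≤ δ′ → κ ≤ Y k (yAt j) →
        Y k (yAt j) * ((1ℚ - seq δ j) * (d * Root.Q (u j))) ≤ d * Z (edgeᵇ H) (yAt j) + ε κ →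
        (1ℚ - δ′) * (Root.Q (u j) * Y k (yAt j)) ≤ Z (edgeᵇ H) (yAt j)
      large-at j κ 0<κ δj κ≤ cj = *-cancelˡ 0<d (p≤q⇐0≤q-p (subst (0ℚ ≤_)
          (solve 9 (λ Yj Qj Zj d δj δ′ η κ g →
             ((d :* Zj :+ η :* (d :* (κ :* g))) :- Yj :* ((con 1ℚ :- δj) :* (d :* Qj))) :+
             (d :* (Qj :* Yj) :* (δ′ :- (δj :+ η)) :+ η :* (d :* (Yj :* Qj :- κ :* g)))
             := d :* Zj :- d :* ((con 1ℚ :- δ′) :* (Qj :* Yj))) refl
             (Y k (yAt j)) (Root.Q (u j)) (Z (edgeᵇ H) (yAt j)) d (seq δ j) δ′ η κ (1ℚ - h))
          (+-nonneg (0≤q-p cj) (+-nonneg (*-nonneg (*-nonneg (<⇒≤ 0<d) (*-nonneg 0≤Q 0≤Y)) (0≤q-p δj))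
            (*-nonneg (<⇒≤ 0<η) (*-nonneg (<⇒≤ 0<d) (0≤q-p (*-mono (<⇒≤ 0<κ) 0≤Q κ≤ (1-h≤Q j)))))))))
        where
        0≤Q : 0ℚ ≤ Root.Q (u j)
        0≤Q = Root.0≤link v (Root.1≤u j)
        0≤Y : 0ℚ ≤ Y k (yAt j)
        0≤Y = ≤-trans (<⇒≤ 0<κ) κ≤

    module _ (0≤δ : 0ℝ ≤ℝ δ) (μ≤β : ∀ M → IsMatching H M → length M ℕ.≤ β) where

      W : Subset n
      W = heavySet H B

      -- A quarter of δ₀. With η at most this and δ_J ≤ δ₀ + η, the number δ′ = δ_J + 2η is at most
      -- δ₀ + 3η, hence at most 2 δ₀.
      μ₀ : ℚ
      μ₀ = ½ * (½ * δ₀)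

      0<μ₀ : 0ℚ < μ₀
      0<μ₀ = half (half 0<δ₀)

      4[2δ₀]≤h : ι 4 * (ι 2 * δ₀) ≤ h
      4[2δ₀]≤h = ≤-reflexive (trans (solve 1 (λ d → con (ι 4) :* (con (ι 2) :* d) := con (ι 8) :* d) refl δ₀) 8δ₀≡h)

      ∣W∣≡β : Subset.∣ W ∣ ≡ β
      ∣W∣≡β = decidable-stable (Subset.∣ W ∣ ℕ.≟ β) λ ∣W∣≢β →
        witness {½ * δ₀} {ι 2 * δ₀} (half 0<δ₀)
          (ev-map (λ j p → ≤-trans (+-monoˡ-≤ (½ * δ₀) p)
            (≤-reflexive (solve 1 (λ d → d :+ con ½ :* d :+ con ½ :* d := con (ι 2) :* d) refl δ₀))) (δ≤ (½ * δ₀) (half 0<δ₀)))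
          λ wit → ∣W∣≢β (heavySet-full 4[2δ₀]≤h β≤n v-out w-in μ≤β wit)

      cover : ∀ e → e ∈ₛ E H → Nonempty (e ∩ W)
      cover = heavySet-covers H B refl μ≤β ∣W∣≡β

      σ : Permutation′ n
      σ = proj₁ (to-initial W)

      σW : image σ W ≡ initial n β
      σW = trans (tabulate-cong (proj₂ (to-initial W))) (cong (initial n) ∣W∣≡β)

      cardinality : ℕ
      cardinality = card (relabel σ (E H) △ E (S n k β))

      card≤ : ∀ {η δ′} → 0ℚ < η → Ev (λ j → seq δ j + η ≤ δ′) → 0ℚ ≤ δ′ → δ′ ≤ ι 2 * δ₀ → ι cardinality ≤ Cℚ * N ^ m * δ′
      card≤ {η} {δ′} 0<η ev 0≤δ′ δ′≤ = decidable-stable (ι cardinality ≤? Cℚ * N ^ m * δ′) λ ¬card≤ →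
        witness {η} {δ′} 0<η ev λ wit → ¬card≤ (≤-trans
          (card-few (≤-trans (*-monoˡ (0≤ι 4) δ′≤) 4[2δ₀]≤h) β≤n v-out w-in μ≤β wit σ σW 0≤δ′)
          (≤-reflexive (trans (cong (λ p → ι k * (ι 32 * b * ι k) ^ k * ι 2 * p * δ′) (^-distrib-* (ι 2) N m))
            (solve 5 (λ a t p q d → a :* t :* (p :* q) :* d := a :* t :* p :* q :* d) refl (ι k * (ι 32 * b * ι k) ^ k) (ι 2) (ι 2 ^ m) (N ^ m) δ′))))

      card-△≤Cδ : fromℕ cardinality ≤ℝ fromℚ Cℚ *ℝ δ *ℝ fromℕ (n ℕ.^ m)
      card-△≤Cδ ε 0<ε =
        let L = Cℚ * N ^ m
            0≤L = *-nonneg (<⇒≤ 0<Cℚ) (^-nonneg m 0≤N)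
            -- The total error is 3 L η: twice η from δ′ = δ_J + 2η and once from passing from index
            -- J to index j.
            η₁ , 0<η₁ , Lη₁<ε = divide {ι 3 * L} (*-nonneg (0≤ι 3) 0≤L) 0<ε
            η , 0<η , η≤η₁ , η≤μ₀ = minimum 0<η₁ 0<μ₀
            J₁ , close = cauchy δ η 0<η
            J₂ , small = ev-× (δ≤ η 0<η) (0≤δ η 0<η)
            J = J₁ ℕ.⊔ J₂
            δ′ = seq δ J + ι 2 * η
            J₁≤J = ℕ.m≤m⊔n J₁ J₂
            δJ≤ , 0≤δJ = small J (ℕ.m≤n⊔m J₁ J₂)
            bound = card≤ {η} {δ′} 0<η
              (J₁ , λ j J₁≤j → ≤-trans (+-monoˡ-≤ η (∣x-y∣<⇒x≤y+ {seq δ j} {seq δ J} (close j J J₁≤j J₁≤J)))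
                (≤-reflexive (solve 2 (λ d e → d :+ e :+ e := d :+ con (ι 2) :* e) refl (seq δ J) η)))
              (≤-trans 0≤δJ (by-difference η (<⇒≤ 0<η) (solve 2 (λ d e → d :+ con (ι 2) :* e := (d :+ e) :+ e) refl (seq δ J) η)))
              (δ′≤2δ₀ {η} {seq δ J} (<⇒≤ 0<η) η≤μ₀ δJ≤)
        in J₁ , λ j J₁≤j → final {seq δ J} {η} {ε} {L} j 0≤L
             (∣x-y∣<⇒x≤y+ {seq δ J} {seq δ j} (close J j J₁≤J J₁≤j)) bound
             (≤-trans (*-monoˡ (*-nonneg (0≤ι 3) 0≤L) η≤η₁) (<⇒≤ Lη₁<ε)) refl
        where
        δ′≤2δ₀ : ∀ {η dJ} → 0ℚ ≤ η → η ≤ μ₀ → dJ ≤ δ₀ + η → dJ + ι 2 * η ≤ ι 2 * δ₀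
        δ′≤2δ₀ {η} {dJ} 0≤η η≤ dJ≤ = p≤q⇐0≤q-p (subst (0ℚ ≤_)
          (solve 3 (λ d e t → ((d :+ e) :- t) :+ con (ι 3) :* (con ½ :* (con ½ :* d) :- e) :+ con ½ :* (con ½ :* d) := con (ι 2) :* d :- (t :+ con (ι 2) :* e)) refl δ₀ η dJ)
          (+-nonneg (+-nonneg (0≤q-p dJ≤) (*-nonneg (0≤ι 3) (0≤q-p η≤))) (<⇒≤ 0<μ₀)))
        final : ∀ {dJ η ε L} j → 0ℚ ≤ L → dJ ≤ seq δ j + η → ι cardinality ≤ L * (dJ + ι 2 * η) → ι 3 * L * η ≤ ε → L ≡ Cℚ * N ^ m →
          seq (fromℕ cardinality) j ≤ seq (fromℚ Cℚ *ℝ δ *ℝ fromℕ (n ℕ.^ m)) j + ε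
        final {dJ} {η} {ε} {L} j 0≤L dJ≤ bound Lη≤ε L≡ = begin
          seq (fromℕ cardinality) j
            ≡⟨ sym (ι≡/1 cardinality) ⟩
          ι cardinality
            ≤⟨ bound ⟩
          L * (dJ + ι 2 * η)
            ≤⟨ *-monoˡ 0≤L (+-monoˡ-≤ (ι 2 * η) dJ≤) ⟩
          L * (seq δ j + η + ι 2 * η)
            ≡⟨ solve 3 (λ L d e → L :* (d :+ e :+ con (ι 2) :* e) := L :* d :+ con (ι 3) :* L :* e) refl L (seq δ j) η ⟩
          L * seq δ j + ι 3 * L * η
            ≤⟨ +-monoʳ-≤ (L * seq δ j) Lη≤ε ⟩
          L * seq δ j + ε
            ≡⟨ cong (_+ ε) (trans (cong (_* seq δ j) L≡) (trans (solve 3 (λ C p d → C :* p :* d := C :* d :* p) refl Cℚ (N ^ m) (seq δ j))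
                 (cong (Cℚ * seq δ j *_) (trans (sym (ι-^ n m)) (ι≡/1 (n ℕ.^ m)))))) ⟩
          seq (fromℚ Cℚ *ℝ δ *ℝ fromℕ (n ℕ.^ m)) j + ε ∎
          where open ≤-Reasoning

open import Data.Fin.Permutation using (Permutation′)
open import Data.Fin.Subset using (Subset; _∩_; ∣_∣; Nonempty)
open import Data.Nat.Base using (ℕ; _≤_; _∸_; _^_)
open import Data.Product.Base using (∃; _×_)
open import Relation.Binary.PropositionalEquality.Core using (_≡_)

theorem1p1 : ∀ (k β : ℕ) → 3 ≤ k → 2 ≤ β →
    ∃ λ (C : ℝ) → ∃ λ (n₀ : ℕ) → ∃ λ (δ* : ℝ) → 0ℝ <ℝ C × 0ℝ <ℝ δ* ×
    (∀ (n : ℕ) → n₀ ≤ n →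
    ∀ (δ : ℝ) → 0ℝ ≤ℝ δ → δ ≤ℝ δ* →
    ∀ (H : Hypergraph k n) →
    ∀ (μH : ℕ) → IsMatchingNumber H μH → μH ≤ β →
    ∀ (ρH ρS : ℝ) → IsSpectralRadius (adjacency H) ρH → IsSpectralRadius (adjacency (S n k β)) ρS →
    (1ℝ -ℝ δ) *ℝ ρS ≤ℝ ρH →
    ∃ λ (W : Subset n) → ∣ W ∣ ≡ β ×
    (∀ e → e ∈ₛ E H → Nonempty (e ∩ W)) ×
    (∃ λ (σ : Permutation′ n) → image σ W ≡ initial n β ×
    fromℕ (card (relabel σ (E H) △ E (S n k β))) ≤ℝ C *ℝ δ *ℝ fromℕ (n ^ (k ∸ 1))))
-- The parameter of the preceding modules is k - 2, here `suc l`.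
theorem1p1 (suc (suc (suc l))) β (ℕ.s≤s (ℕ.s≤s (ℕ.s≤s _))) 2≤β =
  fromℚ Cℚ , n₀ , fromℚ δ₀ , positive 0<Cℚ , positive 0<δ₀ ,
  λ n n₀≤n δ 0≤δ δ≤ H μH (_ , maximal) μ≤β ρH ρS radius-H radius-S large →
    let module C = Conclusion.Comparison (suc l) β 1≤β n n₀≤n H δ ρH ρS δ≤ radius-H radius-S large
        matchings = λ M match → ℕ.≤-trans (maximal M match) μ≤β
    in C.W 0≤δ matchings , C.∣W∣≡β 0≤δ matchings , C.cover 0≤δ matchings ,
       C.σ 0≤δ matchings , C.σW 0≤δ matchings , C.card-△≤Cδ 0≤δ matchings
  where
  1≤β : 1 ≤ β
  1≤β = ℕ.≤-trans (ℕ.s≤s ℕ.z≤n) 2≤β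
  open Thresholds.Constants (suc l) β 1≤β
  positive : ∀ {q} → 0ℚ ℚ.< q → 0ℝ <ℝ fromℚ q
  positive {q} 0<q = q , 0<q , 0 , λ _ _ → ≤-reflexive (+-identityˡ q)
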